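{- There is no algorithm that, given a finite set $\mathcal{F}$ of finite graphs, decides whether the class of finite graphs containing no induced subgraph isomorphic to a member of $\mathcal{F}$ has the joint embedding property.
   Context: Graphs are simple and undirected. A class $\mathcal{C}$ of finite graphs has the joint embedding property if for any $A,B\in\mathcal{C}$ there is $C\in\mathcal{C}$ such that both $A$ and $B$ are isomorphic to induced subgraphs of $C$. -}

module Defs where

open import Data.Nat using (ℕ; zero; suc; _+_; _*_; _^_; _<_)
open import Data.Fin using (Fin)
open import Data.Bool using (Bool; true; false; if_then_else_)
open import Data.List using (List; []; _∷_; map; concatMap; allFin)
open import Data.List.Membership.Propositional using (_∈_)
open import Data.Vec using (Vec; []; _∷_)
open import Data.Product using (Σ; _×_; _,_)
open import Function.Definitions using (Injective)
open import Relation.Binary.PropositionalEquality using (_≡_)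
open import Relation.Nullary using (¬_)

record Graph : Set where
  field
    size  : ℕ
    adj   : Fin size → Fin size → Bool
    sym   : ∀ x y → adj x y ≡ adj y x
    irrefl : ∀ x → adj x x ≡ false
open Graph public

_↪_ : Graph → Graph → Set
A ↪ B = Σ (Fin (size A) → Fin (size B)) λ f →
          Injective _≡_ _≡_ f × (∀ x y → adj B (f x) (f y) ≡ adj A x y)

Forb : List Graph → Graph → Set
Forb F G = ∀ H → H ∈ F → ¬ (H ↪ G)

JEP : (Graph → Set) → Set
JEP 𝒞 = ∀ A B → 𝒞 A → 𝒞 B → Σ Graph λ C → 𝒞 C × (A ↪ C) × (B ↪ C)

data PR : ℕ → Set where
  zer  : ∀ {n} → PR n
  succ : PR 1
  proj : ∀ {n} → Fin n → PR n
  comp : ∀ {m n} → PR m → Vec (PR n) m → PR n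
  prec : ∀ {n} → PR n → PR (suc (suc n)) → PR (suc n)
  mu   : ∀ {n} → PR (suc n) → PR n

lookupV : ∀ {n} → Vec ℕ n → Fin n → ℕ
lookupV (x ∷ xs) Fin.zero = x
lookupV (x ∷ xs) (Fin.suc i) = lookupV xs i

data Eval : ∀ {n} → PR n → Vec ℕ n → ℕ → Set
data EvalAll : ∀ {m n} → Vec (PR n) m → Vec ℕ n → Vec ℕ m → Set

data Eval where
  e-zer  : ∀ {n} {xs : Vec ℕ n} → Eval zer xs 0
  e-succ : ∀ {x} → Eval succ (x ∷ []) (suc x)
  e-proj : ∀ {n} {xs : Vec ℕ n} (i : Fin n) → Eval (proj i) xs (lookupV xs i)
  e-comp : ∀ {m n} {f : PR m} {gs : Vec (PR n) m} {xs ys v} →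
           EvalAll gs xs ys → Eval f ys v → Eval (comp f gs) xs v
  e-prec0 : ∀ {n} {f : PR n} {g} {xs v} →
            Eval f xs v → Eval (prec f g) (0 ∷ xs) v
  e-precS : ∀ {n} {f : PR n} {g} {k xs r v} →
            Eval (prec f g) (k ∷ xs) r → Eval g (k ∷ r ∷ xs) v →
            Eval (prec f g) (suc k ∷ xs) v
  e-mu   : ∀ {n} {f : PR (suc n)} {xs k} →
           Eval f (k ∷ xs) 0 →
           (∀ j → j < k → Σ ℕ λ w → Eval f (j ∷ xs) (suc w)) →
           Eval (mu f) xs k

data EvalAll where
  ea-[] : ∀ {n} {xs : Vec ℕ n} → EvalAll [] xs []
  ea-∷  : ∀ {m n} {g : PR n} {gs : Vec (PR n) m} {xs y ys} →
          Eval g xs y → EvalAll gs xs ys → EvalAll (g ∷ gs) xs (y ∷ ys)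

pair : ℕ → ℕ → ℕ
pair a b = 2 ^ a * suc (2 * b)

codeList : List ℕ → ℕ
codeList [] = 0
codeList (x ∷ xs) = suc (pair x (codeList xs))

bit : Bool → ℕ
bit b = if b then 1 else 0

codeGraph : Graph → ℕ
codeGraph G = codeList (size G ∷ concatMap (λ i → map (λ j → bit (adj G i j)) (allFin (size G)))
                                          (allFin (size G)))

codeFamily : List Graph → ℕ
codeFamily F = codeList (map codeGraph F)

Decides : PR 1 → (List Graph → Set) → Set
Decides p P = ∀ F → (P F → Eval p (codeFamily F ∷ []) 1)
                  × (¬ P F → Eval p (codeFamily F ∷ []) 0)

{-# OPTIONS --safe #-}
-- From p : PR 1 we build a family on which p errs. A cell is a clique of nine vertices, and a point
-- is attached to it in a role ρ when it sees exactly the first (mark ρ) of them. Cells describe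
-- points as trees built from leaf, node and der, and a top cell singles out a point β. The
-- constraints make the tree of a point unique and force an edge between x and β whenever every
-- der-subtree of the tree of x is an instance of a rule for the evaluation of partial recursive
-- functions.
--
-- Two members of the class are joined by their disjoint union, where a point x on one side is made
-- adjacent to a top point on the other exactly when x has a tree all of whose claims are true.
-- Every edge at a cell lies in a triangle and no new edge does, so the cells of the union lie on
-- one side and the constraints persist. One more forbidden graph, chain (3 + n), then occurs only
-- if some such tree claims that the coded program maps n to 1. Hence joint embedding holds if the
-- program returns 0 on n, and fails if it returns 1: then a derivation, laid out as a forest of
-- cells, and a top cell have no common extension.
--
-- The input n occurs only in chain (3 + n), so the code of the family is a recursive function of n
-- once n is chosen to be the code of the remaining constraints. Running p on that code is a program
-- contradicting p on its own family. Truth of claims is decided with bounded fuel, and every claim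
-- is accepted when the fuel runs out.
module Submission where

open import Defs hiding (sym)
open import Data.Bool using (Bool; T; _∧_; _∨_; false; if_then_else_; not; true)
open import Data.Bool.Properties using (∧-comm; ∧-idem; ∨-comm) renaming (_≟_ to _≟ᵇ_)
open import Data.Empty using (⊥; ⊥-elim)
open import Data.Fin using (#_; Fin; fromℕ<; punchIn; punchOut; suc; toℕ; zero)
open import Data.Fin.Properties using (all?; any?; injective⇒existsPivot; injective⇒≤; pigeonhole;
  punchIn-injective; punchInᵢ≢i; punchOut-injective; toℕ-fromℕ<; toℕ-injective; toℕ<n) renaming (_≟_
  to _≟ᶠ_)
open import Data.List using (List; []; _++_; _∷_; allFin; cartesianProductWith; concatMap; filter;
  foldr; length; map; upTo) renaming (tabulate to tabulateᴸ)
open import Data.List.Membership.Propositional using (_∈_; lose)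
open import Data.List.Membership.Propositional.Properties using (∈-++⁺ʳ; ∈-++⁺ˡ; ∈-++⁻; ∈-allFin;
  ∈-cartesianProductWith⁺; ∈-cartesianProductWith⁻; ∈-concatMap⁺; ∈-filter⁺; ∈-filter⁻; ∈-map⁺;
  ∈-map⁻; ∈-upTo⁺)
open import Data.List.Properties using (foldr-map; length-++)
open import Data.List.Relation.Unary.Any using (here; there)
open import Data.Maybe using (Maybe; _>>=_; just; nothing)
open import Data.Nat using (_*_; _+_; _<?_; _<_; _<ᵇ_; _^_; _∸_; _≡ᵇ_; _≤?_; _≤_; _⊔_; pred; suc;
  s≤s; s≤s⁻¹; zero; z≤n; ℕ) renaming (_≟_ to _≟ᴺ_)
open import Data.Nat.Properties using (*-monoˡ-≤; +-identityʳ; +-mono-<-≤; +-mono-≤; +-suc;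
  +-∸-assoc; 1+n≰n; <-cmp; <-irrelevant; <ᵇ⇒<; <⇒<ᵇ; <⇒≢; m∸[m∸n]≡n; m∸n+n≡m; m≤m+n; m≤m⊔n; m≤n+m;
  m≤n⇒m<n∨m≡n; m≤n⇒m≤1+n; m≤n⊔m; m⊔n≤o⇒m≤o; m⊔n≤o⇒n≤o; n<1+n; n∸n≡0; n≤1+n; n≮n; pred[m∸n]≡m∸[1+n];
  suc-injective; ∸-+-assoc; ≡ᵇ⇒≡; ≤-<-trans; ≤-antisym; ≤-refl; ≤-trans; ≤⇒≯; ≮⇒≥; ⊔-lub; ⊔-sel)
open import Data.Product using (_,_; _×_; proj₁; proj₂; Σ; ∃)
open import Data.Product.Properties using (≡-dec)
open import Data.Sum using ([_,_]; _⊎_; inj₁; inj₂)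
open import Data.Unit using (tt; ⊤)
open import Data.Vec using (Vec; []; _∷_; lookup; tabulate; toList)
open import Data.Vec.Properties using (lookup-map; lookup∘tabulate)
open import Relation.Binary.Definitions using (DecidableEquality; tri<; tri>; tri≈)
open import Relation.Binary.PropositionalEquality using (_≡_; _≢_; cong; cong₂; refl; subst; subst₂;
  sym; trans)
open import Relation.Nullary using (Dec; contradiction; does; no; yes; ¬_)
open import Relation.Nullary.Decidable using (_×-dec_; _⊎-dec_; from-yes; map′; ¬?; ⌊_⌋)
import Data.List.Properties as List
import Data.Sum.Properties as Sum
import Data.Vec as Vec

-- Existential formulas and finite families of forbidden graphs

-- The obstacle is finiteness: derivations are unbounded, while a forbidden graph sees boundedly
-- many vertices. So an edge to a top point climbs a derivation one constructor at a time, and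
-- `chain` inspects only the spine below the root. This is why the goal rule turns its conclusion
-- into a bare numeral, whose size can be read off along `rightR` links. Excluding induced subgraphs
-- expresses the failure of existential formulas, and such failure passes to induced subgraphs.
-- Joint embedding needs a Boolean set of trees that is closed under the rules and omits the goal
-- for n. Truth of claims is undecidable in general. At a fixed fuel, however, the interpreter is
-- compositional: an undefined premise makes the conclusion undefined. Counting undefined as true
-- therefore keeps every evaluation rule sound, and the fuel has to suffice only for the one run on
-- n that ends in 0.

record PreGraph : Set₁ where
  field
    Vertex : Set
    adjacent : Vertex → Vertex → Bool
    adjacent-sym : ∀ x y → adjacent x y ≡ adjacent y x
    adjacent-irrefl : ∀ x → adjacent x x ≡ false
open PreGraph public

pre : Graph → PreGraph
pre G = record { Vertex = Fin (size G) ; adjacent = adj G ; adjacent-sym = Graph.sym G ; adjacent-irrefl = irrefl G }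

record _⊑_ (P Q : PreGraph) : Set where
  field
    to : Vertex P → Vertex Q
    to-injective : ∀ {x y} → to x ≡ to y → x ≡ y
    to-adjacent : ∀ x y → adjacent Q (to x) (to y) ≡ adjacent P x y
open _⊑_ public

⊑-trans : ∀ {P Q R} → P ⊑ Q → Q ⊑ R → P ⊑ R
⊑-trans f g = record
  { to = λ x → to g (to f x)
  ; to-injective = λ e → to-injective f (to-injective g e)
  ; to-adjacent = λ x y → trans (to-adjacent g _ _) (to-adjacent f x y) }

↪⇒⊑ : ∀ {A B} → A ↪ B → pre A ⊑ pre B
↪⇒⊑ (f , f-inj , f-adj) = record { to = f ; to-injective = f-inj ; to-adjacent = f-adj }

⊑⇒↪ : ∀ {A B} → pre A ⊑ pre B → A ↪ B
⊑⇒↪ f = to f , to-injective f , to-adjacent f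

-- No quantifier is universal over vertices: `every` and `some` are conjunctions and disjunctions
-- over a fixed finite index set. Hence satisfaction passes from an induced subgraph to the whole
-- graph and is witnessed by boundedly many vertices.
data Formula : Set → Set₁ where
  edge   : ∀ {X} → X → X → Bool → Formula X
  same   : ∀ {X} → X → X → Formula X
  differ : ∀ {X} → X → X → Formula X
  _&_    : ∀ {X} → Formula X → Formula X → Formula X
  every  : ∀ {X} k → (Fin k → Formula X) → Formula X
  some   : ∀ {X} k → (Fin k → Formula X) → Formula X
  ex     : ∀ {X} k → Formula (X ⊎ Fin k) → Formula X
infixr 6 _&_

Sat : ∀ {X} (P : PreGraph) → Formula X → (X → Vertex P) → Set
Sat P (edge x y b) e = adjacent P (e x) (e y) ≡ b
Sat P (same x y)   e = e x ≡ e y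
Sat P (differ x y) e = e x ≢ e y
Sat P (φ & ψ)      e = Sat P φ e × Sat P ψ e
Sat P (every k φ)  e = ∀ i → Sat P (φ i) e
Sat P (some k φ)   e = Σ (Fin k) λ i → Sat P (φ i) e
Sat P (ex k φ)     e = Σ (Vec (Vertex P) k) λ v → Sat P φ [ e , lookup v ]

Sat-up : ∀ {X P Q} (f : P ⊑ Q) (φ : Formula X) {e e′} → (∀ x → to f (e x) ≡ e′ x) →
         Sat P φ e → Sat Q φ e′
Sat-up {Q = Q} f (edge x y b) h s =
  trans (cong₂ (adjacent Q) (sym (h x)) (sym (h y))) (trans (to-adjacent f _ _) s)
Sat-up f (same x y) h s = trans (sym (h x)) (trans (cong (to f) s) (h y))
Sat-up f (differ x y) h s p = s (to-injective f (trans (h x) (trans p (sym (h y)))))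
Sat-up f (φ & ψ) h (s , t) = Sat-up f φ h s , Sat-up f ψ h t
Sat-up f (every k φ) h s i = Sat-up f (φ i) h (s i)
Sat-up f (some k φ) h (i , s) = i , Sat-up f (φ i) h s
Sat-up f (ex k φ) {e} {e′} h (v , s) = Vec.map (to f) v , Sat-up f φ h′ s
  where
  h′ : ∀ x → to f ([ e , lookup v ] x) ≡ [ e′ , lookup (Vec.map (to f) v) ] x
  h′ (inj₁ x) = h x
  h′ (inj₂ i) = sym (lookup-map i (to f) v)

anyVec? : ∀ {n} k {P : Vec (Fin n) k → Set} → (∀ v → Dec (P v)) → Dec (∃ P)
anyVec? zero P? = map′ ([] ,_) (λ { ([] , p) → p }) (P? [])
anyVec? (suc k) P? =
  map′ (λ { (x , v , p) → x ∷ v , p }) (λ { (x ∷ v , p) → x , v , p })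
       (any? λ x → anyVec? k λ v → P? (x ∷ v))

sat? : ∀ {X} G (φ : Formula X) e → Dec (Sat (pre G) φ e)
sat? G (edge x y b) e = adj G (e x) (e y) ≟ᵇ b
sat? G (same x y) e = e x ≟ᶠ e y
sat? G (differ x y) e = ¬? (e x ≟ᶠ e y)
sat? G (φ & ψ) e = sat? G φ e ×-dec sat? G ψ e
sat? G (every k φ) e = all? λ i → sat? G (φ i) e
sat? G (some k φ) e = any? λ i → sat? G (φ i) e
sat? G (ex k φ) e = anyVec? k λ v → sat? G φ [ e , lookup v ]

total : ∀ k → (Fin k → ℕ) → ℕ
total zero f = 0
total (suc k) f = f zero + total k (λ i → f (suc i))

rank : ∀ {X} → Formula X → ℕ
rank (edge x y b) = 0
rank (same x y) = 0
rank (differ x y) = 0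
rank (φ & ψ) = rank φ + rank ψ
rank (every k φ) = total k (λ i → rank (φ i))
rank (some k φ) = total k (λ i → rank (φ i))
rank (ex k φ) = k + rank φ

InImage : ∀ {P Q} → P ⊑ Q → Vertex Q → Set
InImage f v = ∃ λ u → to f u ≡ v

-- The vertices chosen for the quantifiers: an induced subgraph that contains them and the values of
-- the free variables still satisfies the formula. As there are at most `rank φ` of them, models
-- shrink to bounded size.
record Support {X} (G : Graph) (φ : Formula X) (e : X → Fin (size G)) : Set where
  field
    vertices : List (Fin (size G))
    bounded  : length vertices ≤ rank φ
    restrict : ∀ H (f : pre H ⊑ pre G) {e′} → (∀ x → to f (e′ x) ≡ e x) →
               (∀ {v} → v ∈ vertices → InImage f v) → Sat (pre H) φ e′
open Support

collect : ∀ {A : Set} k (xs : Fin k → List A) → List A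
collect zero xs = []
collect (suc k) xs = xs zero ++ collect k (λ i → xs (suc i))

length-++-≤ : ∀ {A : Set} (xs : List A) {ys m n} → length xs ≤ m → length ys ≤ n → length (xs ++ ys) ≤ m + n
length-++-≤ xs {ys} p q = subst (_≤ _) (sym (length-++ xs)) (+-mono-≤ p q)

collect-length : ∀ {A : Set} k (xs : Fin k → List A) (r : Fin k → ℕ) →
                 (∀ i → length (xs i) ≤ r i) → length (collect k xs) ≤ total k r
collect-length zero xs r h = z≤n
collect-length (suc k) xs r h =
  length-++-≤ (xs zero) (h zero) (collect-length k _ _ (λ i → h (suc i)))

∈-collect : ∀ {A : Set} {k} (xs : Fin k → List A) i {x} → x ∈ xs i → x ∈ collect k xs
∈-collect xs zero p = ∈-++⁺ˡ p
∈-collect xs (suc i) p = ∈-++⁺ʳ (xs zero) (∈-collect (λ i → xs (suc i)) i p)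

total-≥ : ∀ k (r : Fin k → ℕ) i → r i ≤ total k r
total-≥ (suc k) r zero = m≤m+n _ _
total-≥ (suc k) r (suc i) = ≤-trans (total-≥ k _ i) (m≤n+m _ _)

length-toList-≤ : ∀ {A : Set} {k} (v : Vec A k) → length (toList v) ≤ k
length-toList-≤ [] = z≤n
length-toList-≤ (x ∷ v) = s≤s (length-toList-≤ v)

lookup-∈ : ∀ {A : Set} {k} (v : Vec A k) i → lookup v i ∈ toList v
lookup-∈ (x ∷ v) zero = here refl
lookup-∈ (x ∷ v) (suc i) = there (lookup-∈ v i)

preimage : ∀ {P Q} (f : P ⊑ Q) {k} (v : Vec (Vertex Q) k) → (∀ i → InImage f (lookup v i)) →
           Σ (Vec (Vertex P) k) λ u → ∀ i → to f (lookup u i) ≡ lookup v i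
preimage f v h = tabulate (λ i → proj₁ (h i)) ,
                 λ i → trans (cong (to f) (lookup∘tabulate _ i)) (proj₂ (h i))

support : ∀ {X} G (φ : Formula X) e → Sat (pre G) φ e → Support G φ e
support G (edge x y b) e s = record
  { vertices = [] ; bounded = z≤n
  ; restrict = λ H f h _ → trans (sym (to-adjacent f _ _)) (trans (cong₂ (adj G) (h x) (h y)) s) }
support G (same x y) e s = record
  { vertices = [] ; bounded = z≤n
  ; restrict = λ H f h _ → to-injective f (trans (h x) (trans s (sym (h y)))) }
support G (differ x y) e s = record
  { vertices = [] ; bounded = z≤n
  ; restrict = λ H f h _ p → s (trans (sym (h x)) (trans (cong (to f) p) (h y))) }
support G (φ & ψ) e (s , t) = record
  { vertices = vertices S ++ vertices T′
  ; bounded = length-++-≤ (vertices S) (bounded S) (bounded T′)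
  ; restrict = λ H f h c → restrict S H f h (λ p → c (∈-++⁺ˡ p)) ,
                           restrict T′ H f h (λ p → c (∈-++⁺ʳ (vertices S) p)) }
  where
  S = support G φ e s
  T′ = support G ψ e t
support G (every k φ) e s = record
  { vertices = collect k (λ i → vertices (S i))
  ; bounded = collect-length k _ _ (λ i → bounded (S i))
  ; restrict = λ H f h c i → restrict (S i) H f h (λ p → c (∈-collect _ i p)) }
  where
  S : ∀ i → Support G (φ i) e
  S i = support G (φ i) e (s i)
support G (some k φ) e (i , s) = record
  { vertices = vertices S
  ; bounded = ≤-trans (bounded S) (total-≥ k _ i)
  ; restrict = λ H f h c → i , restrict S H f h c }
  where S = support G (φ i) e s
support G (ex k φ) e (v , s) = record
  { vertices = toList v ++ vertices S
  ; bounded = length-++-≤ (toList v) (length-toList-≤ v) (bounded S)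
  ; restrict = res }
  where
  S = support G φ _ s
  res : ∀ H (f : pre H ⊑ pre G) {e′} → (∀ x → to f (e′ x) ≡ e x) →
        (∀ {w} → w ∈ toList v ++ vertices S → InImage f w) → Sat (pre H) (ex k φ) e′
  res H f {e′} h c with preimage f v (λ i → c (∈-++⁺ˡ (lookup-∈ v i)))
  ... | u , u-eq = u , restrict S H f h′ (λ p → c (∈-++⁺ʳ (toList v) p))
    where
    h′ : ∀ x → to f ([ e′ , lookup u ] x) ≡ [ e , lookup v ] x
    h′ (inj₁ x) = h x
    h′ (inj₂ i) = u-eq i

-- Induced subgraphs on listed vertices

record Cover (P : PreGraph) (xs : List (Vertex P)) : Set where
  field
    graph   : Graph
    small   : size graph ≤ length xs
    embed   : pre graph ⊑ P
    covers  : ∀ {v} → v ∈ xs → InImage embed v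
open Cover public

-- A list may repeat vertices while an embedding must be injective, so repetitions are dropped and
-- the length only bounds the size.
record Enumeration {A : Set} (xs : List A) : Set where
  field
    count     : ℕ
    count-≤   : count ≤ length xs
    element   : Fin count → A
    injective : ∀ {i j} → element i ≡ element j → i ≡ j
    complete  : ∀ {x} → x ∈ xs → ∃ λ i → element i ≡ x

enumerate : ∀ {A : Set} → DecidableEquality A → (xs : List A) → Enumeration xs
enumerate _≟_ [] = record
  { count = 0 ; count-≤ = z≤n ; element = λ () ; injective = λ { {()} } ; complete = λ () }
enumerate {A} _≟_ (x ∷ xs) with enumerate _≟_ xs
... | E with any? (λ i → Enumeration.element E i ≟ x)
...   | yes found = record
  { count = count ; count-≤ = m≤n⇒m≤1+n count-≤ ; element = element ; injective = injective
  ; complete = λ { (here refl) → found ; (there p) → complete p } }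
  where open Enumeration E
...   | no new = record
  { count = suc count ; count-≤ = s≤s count-≤ ; element = el ; injective = inj
  ; complete = λ { (here refl) → zero , refl
                 ; (there p) → suc (proj₁ (complete p)) , proj₂ (complete p) } }
  where
  open Enumeration E
  el : Fin (suc count) → A
  el zero = x
  el (suc i) = element i
  inj : ∀ {i j} → el i ≡ el j → i ≡ j
  inj {zero} {zero} _ = refl
  inj {zero} {suc j} p = contradiction (j , sym p) new
  inj {suc i} {zero} p = contradiction (i , p) new
  inj {suc i} {suc j} p = cong suc (injective p)

cover : ∀ P → DecidableEquality (Vertex P) → ∀ xs → Cover P xs
cover P _≟_ xs = record
  { graph = record { size = count ; adj = λ i j → adjacent P (element i) (element j)
                   ; sym = λ i j → adjacent-sym P _ _ ; irrefl = λ i → adjacent-irrefl P _ }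
  ; small = count-≤
  ; embed = record { to = element ; to-injective = injective ; to-adjacent = λ _ _ → refl }
  ; covers = complete }
  where open Enumeration (enumerate _≟_ xs)

-- Enumeration of the graphs of bounded size

Matrix : ℕ → Set
Matrix k = Vec (Vec Bool k) k

entry : ∀ {k} → Matrix k → Fin k → Fin k → Bool
entry m i j = lookup (lookup m i) j

-- Symmetrising and clearing the diagonal turns every Boolean matrix into a graph, so the
-- enumeration needs no filter.
matrixGraph : ∀ {k} → Matrix k → Graph
matrixGraph {k} m = record
  { size = k ; adj = λ i j → (entry m i j ∧ entry m j i) ∧ not ⌊ i ≟ᶠ j ⌋ ; sym = symm ; irrefl = irr }
  where
  symm : ∀ i j → (entry m i j ∧ entry m j i) ∧ not ⌊ i ≟ᶠ j ⌋ ≡ (entry m j i ∧ entry m i j) ∧ not ⌊ j ≟ᶠ i ⌋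
  symm i j with i ≟ᶠ j | j ≟ᶠ i
  ... | yes _ | yes _ = cong (_∧ false) (∧-comm (entry m i j) _)
  ... | yes p | no q = contradiction (sym p) q
  ... | no p | yes q = contradiction (sym q) p
  ... | no _ | no _ = cong (_∧ true) (∧-comm (entry m i j) _)
  irr : ∀ i → (entry m i i ∧ entry m i i) ∧ not ⌊ i ≟ᶠ i ⌋ ≡ false
  irr i with i ≟ᶠ i
  ... | yes _ = ∧-comm _ false
  ... | no q = contradiction refl q

vectors : ∀ {A : Set} → List A → ∀ k → List (Vec A k)
vectors xs zero = [] ∷ []
vectors xs (suc k) = cartesianProductWith _∷_ xs (vectors xs k)

∈-vectors : ∀ {A : Set} {xs : List A} → (∀ x → x ∈ xs) → ∀ {k} (v : Vec A k) → v ∈ vectors xs k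
∈-vectors h [] = here refl
∈-vectors h (x ∷ v) = ∈-cartesianProductWith⁺ _∷_ (h x) (∈-vectors h v)

bools : List Bool
bools = true ∷ false ∷ []

∈-bools : ∀ b → b ∈ bools
∈-bools true = here refl
∈-bools false = there (here refl)

graphsOfSize : ℕ → List Graph
graphsOfSize k = map matrixGraph (vectors (vectors bools k) k)

graphsUpTo : ℕ → List Graph
graphsUpTo m = concatMap graphsOfSize (upTo (suc m))

-- A `Graph` holds functions and proofs, so a list can contain a given one only up to isomorphism.
-- The copy through its matrix has pointwise the same edges.
canonical : Graph → Graph
canonical G = matrixGraph (tabulate λ i → tabulate λ j → adj G i j)

canonical-adj : ∀ G i j → adj (canonical G) i j ≡ adj G i j
canonical-adj G i j = trans (cong (_∧ not ⌊ i ≟ᶠ j ⌋) (cong₂ _∧_ (entry-tab i j) (entry-tab j i))) reduce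
  where
  entry-tab : ∀ i j → entry (tabulate λ i → tabulate λ j → adj G i j) i j ≡ adj G i j
  entry-tab i j = trans (cong (λ r → lookup r j) (lookup∘tabulate _ i)) (lookup∘tabulate _ j)
  reduce : (adj G i j ∧ adj G j i) ∧ not ⌊ i ≟ᶠ j ⌋ ≡ adj G i j
  reduce with i ≟ᶠ j
  ... | yes refl = trans (∧-comm _ false) (sym (irrefl G i))
  ... | no _ = trans (∧-comm _ true) (trans (cong (adj G i j ∧_) (Graph.sym G j i)) (∧-idem _))

∈-graphsUpTo : ∀ m G → size G ≤ m → canonical G ∈ graphsUpTo m
∈-graphsUpTo m G h =
  ∈-concatMap⁺ graphsOfSize
    (Any-at (∈-upTo⁺ (s≤s h)) (∈-map⁺ matrixGraph (∈-vectors (∈-vectors ∈-bools) _)))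
  where
  open import Data.List.Relation.Unary.Any using (Any)
  Any-at : ∀ {A : Set} {P : A → Set} {x xs} → x ∈ xs → P x → Any P xs
  Any-at (here refl) p = here p
  Any-at (there q) p = there (Any-at q p)

noEnv : ∀ {A : Set} → ⊥ → A
noEnv ()

Holds : PreGraph → Formula ⊥ → Set
Holds P φ = Sat P φ noEnv

holds-up : ∀ {P Q} → P ⊑ Q → ∀ φ → Holds P φ → Holds Q φ
holds-up f φ = Sat-up f φ λ ()

forbidden : Formula ⊥ → List Graph
forbidden φ = filter (λ G → sat? G φ noEnv) (graphsUpTo (rank φ))

-- A model of `φ` shrinks to the witnesses of its quantifiers, and the canonical copy of that small
-- subgraph is a listed model embedded in `G`.
forbidden-complete : ∀ φ G → Forb (forbidden φ) G → ¬ Holds (pre G) φ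
forbidden-complete φ G forb s =
  forb (canonical H) (∈-filter⁺ (λ G → sat? G φ noEnv) (∈-graphsUpTo (rank φ) H H-small) (holds-up to-canonical φ H-sat))
       (⊑⇒↪ {canonical H} {G} (⊑-trans from-canonical (embed C)))
  where
  S = support G φ noEnv s
  C = cover (pre G) _≟ᶠ_ (vertices S)
  H = graph C
  H-small : size H ≤ rank φ
  H-small = ≤-trans (small C) (bounded S)
  H-sat : Holds (pre H) φ
  H-sat = restrict S H (embed C) (λ ()) (covers C)
  to-canonical : pre H ⊑ pre (canonical H)
  to-canonical = record { to = λ x → x ; to-injective = λ p → p ; to-adjacent = canonical-adj H }
  from-canonical : pre (canonical H) ⊑ pre H
  from-canonical = record { to = λ x → x ; to-injective = λ p → p
                          ; to-adjacent = λ x y → sym (canonical-adj H x y) }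

forbidden-sound : ∀ φ G → ¬ Holds (pre G) φ → Forb (forbidden φ) G
forbidden-sound φ G ¬s H H∈ f =
  ¬s (holds-up (↪⇒⊑ {H} {G} f) φ (proj₂ (∈-filter⁻ (λ G → sat? G φ noEnv) {xs = graphsUpTo (rank φ)} H∈)))

family : List (Formula ⊥) → List Graph
family = concatMap forbidden

Forb-++ : ∀ {F F′ G} → Forb (F ++ F′) G → Forb F G × Forb F′ G
Forb-++ {F} forb = (λ H p → forb H (∈-++⁺ˡ p)) , (λ H p → forb H (∈-++⁺ʳ F p))

++-Forb : ∀ {F F′ G} → Forb F G → Forb F′ G → Forb (F ++ F′) G
++-Forb {F} f f′ H p with ∈-++⁻ F p
... | inj₁ q = f H q
... | inj₂ q = f′ H q

family-complete : ∀ φs G → Forb (family φs) G → ∀ {φ} → φ ∈ φs → ¬ Holds (pre G) φ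
family-complete (φ ∷ φs) G forb (here refl) = forbidden-complete φ G (proj₁ (Forb-++ {G = G} forb))
family-complete (φ ∷ φs) G forb (there p) = family-complete φs G (proj₂ (Forb-++ {forbidden φ} {G = G} forb)) p

family-sound : ∀ φs G → (∀ {φ} → φ ∈ φs → ¬ Holds (pre G) φ) → Forb (family φs) G
family-sound [] G h H ()
family-sound (φ ∷ φs) G h =
  ++-Forb {G = G} (forbidden-sound φ G (h (here refl))) (family-sound φs G (λ p → h (there p)))

-- Cells, points and the axioms

data Role : Set where
  leafR leftR rightR derR childR topR : Role

-- At least two, so that every edge between a cell and its point lies in a triangle; at most seven,
-- so that a point misses two of the nine vertices whereas a cell vertex misses only itself;
-- distinct, so that the number of vertices seen determines the role.
mark : Role → ℕ
mark leafR = 2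
mark leftR = 3
mark rightR = 4
mark derR = 5
mark childR = 6
mark topR = 7

isTop : Role → Bool
isTop topR = true
isTop _ = false

-- A point is built by a single constructor, `leftR` and `rightR` both belonging to `node`. It may
-- in addition be a child anywhere, and top points take no part in trees.
compatible : Role → Role → Bool
compatible topR topR = true
compatible topR _ = false
compatible _ topR = false
compatible childR _ = true
compatible _ childR = true
compatible leafR leafR = true
compatible derR derR = true
compatible leftR leftR = true
compatible leftR rightR = true
compatible rightR leftR = true
compatible rightR rightR = true
compatible _ _ = false

Cell : PreGraph → Set
Cell P = Vec (Vertex P) 9

IsClique : ∀ P → Cell P → Set
IsClique P K = ∀ i j → adjacent P (lookup K i) (lookup K j) ≡ not ⌊ i ≟ᶠ j ⌋

Attached : ∀ P → Role → Cell P → Vertex P → Set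
Attached P ρ K x = ∀ i → adjacent P (lookup K i) x ≡ (toℕ i <ᵇ mark ρ)

Has : ∀ P → Role → Vertex P → Set
Has P ρ x = Σ (Cell P) λ K → IsClique P K × Attached P ρ K x

Link : ∀ P → Role → Vertex P → Vertex P → Set
Link P ρ x y = Σ (Cell P) λ K → IsClique P K × Attached P ρ K x × Attached P childR K y

link⇒has : ∀ P ρ {x y} → Link P ρ x y → Has P ρ x
link⇒has P ρ (K , cl , ax , ay) = K , cl , ax

-- Eight variables are as many as the largest rule, `stepᴿ`, uses.
data Term : Set where
  var  : Fin 8 → Term
  leaf : Term
  node : Term → Term → Term
  der  : Term → Term

data Tree : Set where
  leaf : Tree
  node : Tree → Tree → Tree
  der  : Tree → Tree

inst : (Fin 8 → Tree) → Term → Tree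
inst σ (var i) = σ i
inst σ leaf = leaf
inst σ (node p q) = node (inst σ p) (inst σ q)
inst σ (der p) = der (inst σ p)

-- A variable stands for a vertex, not for a tree: repeated variables must meet the same vertex,
-- which a bounded formula can express. Equality of the trees below two different vertices could not
-- be tested that way.
Match : ∀ P → Term → (Fin 8 → Vertex P) → Vertex P → Set
Match P (var i) e x = x ≡ e i
Match P leaf e x = Has P leafR x
Match P (node p q) e x =
  Σ (Vertex P) λ y → Σ (Vertex P) λ z → Link P leftR x y × Link P rightR x z × Match P p e y × Match P q e z
Match P (der p) e x = Σ (Vertex P) λ y → Link P derR x y × Match P p e y

-- `functional` and `exclusive` make trees unique. `independent` and `separated` keep the edges
-- added in a joint graph out of triangles and away from cell vertices. `isolated` settles all pairs
-- between a tree cell with its point and a top cell with its point, except the two points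
-- themselves: that edge is the one the closure axioms force, and the other pairs must be non-edges
-- for `chain` to occur as an induced subgraph.
record Axioms (rules : List Term) (P : PreGraph) : Set where
  field
    functional  : ∀ ρ {x y y′} → Link P ρ x y → Link P ρ x y′ → y ≡ y′
    exclusive   : ∀ ρ ρ′ {x} → Has P ρ x → Has P ρ′ x → compatible ρ ρ′ ≡ true
    independent : ∀ ρ ρ′ {x y} → Has P ρ x → Has P ρ′ y → isTop ρ ≡ isTop ρ′ → adjacent P x y ≡ false
    separated   : ∀ ρ ρ′ {x y} → Has P ρ x → ∀ K → IsClique P K → Attached P ρ′ K y → ∀ i → x ≢ lookup K i
    isolated    : ∀ ρ {x y} → isTop ρ ≡ false → ∀ K K′ → IsClique P K → Attached P ρ K x →
                  IsClique P K′ → Attached P topR K′ y →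
                  (∀ i j → adjacent P (lookup K i) (lookup K′ j) ≡ false)
                  × (∀ i → adjacent P (lookup K i) y ≡ false)
                  × (∀ j → adjacent P x (lookup K′ j) ≡ false)
    leaf-closed : ∀ {w β} → Has P topR β → Has P leafR w → adjacent P w β ≡ true
    node-closed : ∀ {w y z β} → Has P topR β → Link P leftR w y → Link P rightR w z →
                  adjacent P y β ≡ true → adjacent P z β ≡ true → adjacent P w β ≡ true
    der-closed  : ∀ {p} → p ∈ rules → ∀ {w y β} e → Has P topR β → Link P derR w y → Match P p e y →
                  adjacent P y β ≡ true → adjacent P w β ≡ true

-- Counterexamples to the axioms as existential sentences

cliqueF : ∀ {X} → (Fin 9 → X) → Formula X
cliqueF K = every 9 λ i → every 9 λ j → edge (K i) (K j) (not ⌊ i ≟ᶠ j ⌋)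

attachedF : ∀ {X} → Role → (Fin 9 → X) → X → Formula X
attachedF ρ K x = every 9 λ i → edge (K i) x (toℕ i <ᵇ mark ρ)

hasF : ∀ {X} → Role → X → Formula X
hasF ρ x = ex 9 (cliqueF inj₂ & attachedF ρ inj₂ (inj₁ x))

linkF : ∀ {X} → Role → X → X → Formula X
linkF ρ x y = ex 9 (cliqueF inj₂ & attachedF ρ inj₂ (inj₁ x) & attachedF childR inj₂ (inj₁ y))

matchF : ∀ {X} → Term → (Fin 8 → X) → X → Formula X
matchF (var i) e x = same x (e i)
matchF leaf e x = hasF leafR x
matchF (node p q) e x =
  ex 2 (linkF leftR (inj₁ x) (inj₂ zero) & linkF rightR (inj₁ x) (inj₂ (suc zero))
        & matchF p (λ i → inj₁ (e i)) (inj₂ zero) & matchF q (λ i → inj₁ (e i)) (inj₂ (suc zero)))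
matchF (der p) e x = ex 1 (linkF derR (inj₁ x) (inj₂ zero) & matchF p (λ i → inj₁ (e i)) (inj₂ zero))

matchF⇒ : ∀ {X P} p {e : Fin 8 → X} {x} {ε : X → Vertex P} →
          Sat P (matchF p e x) ε → Match P p (λ i → ε (e i)) (ε x)
matchF⇒ (var i) s = s
matchF⇒ leaf s = s
matchF⇒ (node p q) (y ∷ z ∷ [] , l , r , m , n) = y , z , l , r , matchF⇒ p m , matchF⇒ q n
matchF⇒ (der p) (y ∷ [] , d , m) = y , d , matchF⇒ p m

⇒matchF : ∀ {X P} p {e : Fin 8 → X} {x} {ε : X → Vertex P} →
          Match P p (λ i → ε (e i)) (ε x) → Sat P (matchF p e x) ε
⇒matchF (var i) s = s
⇒matchF leaf s = s
⇒matchF (node p q) (y , z , l , r , m , n) = y ∷ z ∷ [] , l , r , ⇒matchF p m , ⇒matchF q n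
⇒matchF (der p) (y , d , m) = y ∷ [] , d , ⇒matchF p m

-- The empty disjunction serves as falsity.
when : ∀ {X} → Bool → Formula X → Formula X
when true φ = φ
when false φ = some 0 λ ()

when-intro : ∀ {X P b} (φ : Formula X) {e} → b ≡ true → Sat P φ e → Sat P (when b φ) e
when-intro φ refl s = s

when-elim : ∀ {X P} b (φ : Formula X) {e} → Sat P (when b φ) e → b ≡ true × Sat P φ e
when-elim true φ s = refl , s
when-elim false φ (() , _)

functionalF : Role → Formula ⊥
functionalF ρ = ex 9 (ex 9 (ex 3
  (cliqueF K & attachedF ρ K x & attachedF childR K y
   & cliqueF K′ & attachedF ρ K′ x & attachedF childR K′ y′ & differ y y′)))
  where
  X = ((⊥ ⊎ Fin 9) ⊎ Fin 9) ⊎ Fin 3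
  K K′ : Fin 9 → X
  K i = inj₁ (inj₁ (inj₂ i))
  K′ i = inj₁ (inj₂ i)
  x y y′ : X
  x = inj₂ zero
  y = inj₂ (suc zero)
  y′ = inj₂ (suc (suc zero))

Pair : Set
Pair = ((⊥ ⊎ Fin 9) ⊎ Fin 9) ⊎ Fin 2

pattern K₁ i = inj₁ (inj₁ (inj₂ i))
pattern K₂ i = inj₁ (inj₂ i)
pattern x₁ = inj₂ zero
pattern x₂ = inj₂ (suc zero)

bothSorts : Role → Role → Bool
bothSorts ρ ρ′ = not (isTop ρ) ∧ isTop ρ′

sameSort : Role → Role → Bool
sameSort ρ ρ′ = ⌊ isTop ρ ≟ᵇ isTop ρ′ ⌋

-- In this order: failures of `exclusive`, of `independent`, of `separated` and of the three parts
-- of `isolated`. All of them concern two cells with one attached point each, so a single quantifier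
-- prefix serves them all.
offence : Role → Role → Fin 6 → Formula Pair
offence ρ ρ′ zero = when (not (compatible ρ ρ′)) (same x₁ x₂)
offence ρ ρ′ (suc zero) = when (sameSort ρ ρ′) (edge x₁ x₂ true)
offence ρ ρ′ (suc (suc zero)) = some 9 λ i → same x₁ (K₂ i)
offence ρ ρ′ (suc (suc (suc zero))) =
  when (bothSorts ρ ρ′) (some 9 λ i → some 9 λ j → edge (K₁ i) (K₂ j) true)
offence ρ ρ′ (suc (suc (suc (suc zero)))) = when (bothSorts ρ ρ′) (some 9 λ i → edge (K₁ i) x₂ true)
offence ρ ρ′ (suc (suc (suc (suc (suc zero))))) = when (bothSorts ρ ρ′) (some 9 λ j → edge x₁ (K₂ j) true)

pairF : Role → Role → Formula ⊥
pairF ρ ρ′ = ex 9 (ex 9 (ex 2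
  (cliqueF (λ i → K₁ i) & attachedF ρ (λ i → K₁ i) x₁ & cliqueF (λ i → K₂ i) & attachedF ρ′ (λ i → K₂ i) x₂
   & some 6 (offence ρ ρ′))))

leafF : Formula ⊥
leafF = ex 2 (hasF topR (inj₂ (suc zero)) & hasF leafR (inj₂ zero) & edge (inj₂ zero) (inj₂ (suc zero)) false)

nodeF : Formula ⊥
nodeF = ex 4 (hasF topR β & linkF leftR w y & linkF rightR w z & edge y β true & edge z β true & edge w β false)
  where
  w y z β : ⊥ ⊎ Fin 4
  w = inj₂ zero
  y = inj₂ (suc zero)
  z = inj₂ (suc (suc zero))
  β = inj₂ (suc (suc (suc zero)))

derF : Term → Formula ⊥
derF p = ex 8 (ex 3 (hasF topR β & linkF derR w y & matchF p (λ i → inj₁ (inj₂ i)) y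
                     & edge y β true & edge w β false))
  where
  w y β : (⊥ ⊎ Fin 8) ⊎ Fin 3
  w = inj₂ zero
  y = inj₂ (suc zero)
  β = inj₂ (suc (suc zero))

roles : List Role
roles = leafR ∷ leftR ∷ rightR ∷ derR ∷ childR ∷ topR ∷ []

∈-roles : ∀ ρ → ρ ∈ roles
∈-roles leafR = here refl
∈-roles leftR = there (here refl)
∈-roles rightR = there (there (here refl))
∈-roles derR = there (there (there (here refl)))
∈-roles childR = there (there (there (there (here refl))))
∈-roles topR = there (there (there (there (there (here refl)))))

abstract
  structural : List (Formula ⊥)
  structural = map functionalF roles ++ cartesianProductWith pairF roles roles

  functional-∈ : ∀ ρ → functionalF ρ ∈ structural
  functional-∈ ρ = ∈-++⁺ˡ {xs = map functionalF roles} (∈-map⁺ functionalF {xs = roles} (∈-roles ρ))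

  pair-∈ : ∀ ρ ρ′ → pairF ρ ρ′ ∈ structural
  pair-∈ ρ ρ′ = ∈-++⁺ʳ (map functionalF roles)
    (∈-cartesianProductWith⁺ pairF {xs = roles} {ys = roles} (∈-roles ρ) (∈-roles ρ′))

  structural⁻ : ∀ {φ} → φ ∈ structural →
                (Σ Role λ ρ → φ ≡ functionalF ρ) ⊎ (Σ Role λ ρ → Σ Role λ ρ′ → φ ≡ pairF ρ ρ′)
  structural⁻ {φ} φ∈ with ∈-++⁻ (map functionalF roles) φ∈
  ... | inj₁ p = inj₁ (proj₁ q , proj₂ (proj₂ q))
    where
    q : Σ Role λ ρ → (ρ ∈ roles) × (φ ≡ functionalF ρ)
    q = ∈-map⁻ functionalF {xs = roles} p
  ... | inj₂ p = inj₂ (proj₁ q , proj₁ (proj₂ q) , proj₂ (proj₂ (proj₂ (proj₂ q))))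
    where
    q : Σ Role λ ρ → Σ Role λ ρ′ → (ρ ∈ roles) × (ρ′ ∈ roles) × (φ ≡ pairF ρ ρ′)
    q = ∈-cartesianProductWith⁻ pairF roles roles p

sentences : List Term → List (Formula ⊥)
sentences rules = structural ++ (leafF ∷ nodeF ∷ map derF rules)

≢true⇒≡false : ∀ {b} → (b ≡ true → ⊥) → b ≡ false
≢true⇒≡false {true} h = ⊥-elim (h refl)
≢true⇒≡false {false} h = refl

≢false⇒≡true : ∀ {b} → (b ≡ false → ⊥) → b ≡ true
≢false⇒≡true {true} h = refl
≢false⇒≡true {false} h = ⊥-elim (h refl)

-- Adjacency is Boolean and equality of vertices of a finite graph is decidable, so the absence of a
-- counterexample gives the positive statement.
axioms : ∀ rules G → (∀ {φ} → φ ∈ sentences rules → ¬ Holds (pre G) φ) → Axioms rules (pre G)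
axioms rules G fails = record
  { functional = func
  ; exclusive = λ ρ ρ′ {x} (K , c , a) (K′ , c′ , a′) → ≢false⇒≡true λ p →
      no-pair ρ ρ′ (K , K′ , x ∷ x ∷ [] , c , a , c′ , a′ , # 0 , when-intro (same x₁ x₂) (cong not p) refl)
  ; independent = λ ρ ρ′ {x} {y} (K , c , a) (K′ , c′ , a′) t → ≢true⇒≡false λ p →
      no-pair ρ ρ′ (K , K′ , x ∷ y ∷ [] , c , a , c′ , a′ , # 1 , when-intro (edge x₁ x₂ true) (dec-true t) p)
  ; separated = λ ρ ρ′ {x} {y} (K , c , a) K′ c′ a′ i p →
      no-pair ρ ρ′ (K , K′ , x ∷ y ∷ [] , c , a , c′ , a′ , # 2 , i , p)
  ; isolated = λ ρ {x} {y} t K K′ c a c′ a′ →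
      (λ i j → ≢true⇒≡false λ p → no-pair ρ topR (K , K′ , x ∷ y ∷ [] , c , a , c′ , a′ , # 3 ,
         when-intro (some 9 λ i → some 9 λ j → edge (K₁ i) (K₂ j) true) (mixed ρ t) (i , j , p))) ,
      (λ i → ≢true⇒≡false λ p → no-pair ρ topR (K , K′ , x ∷ y ∷ [] , c , a , c′ , a′ , # 4 ,
         when-intro (some 9 λ i → edge (K₁ i) x₂ true) (mixed ρ t) (i , p))) ,
      (λ j → ≢true⇒≡false λ p → no-pair ρ topR (K , K′ , x ∷ y ∷ [] , c , a , c′ , a′ , # 5 ,
         when-intro (some 9 λ j → edge x₁ (K₂ j) true) (mixed ρ t) (j , p)))
  ; leaf-closed = λ {w} {β} b l → ≢false⇒≡true λ p → fails (∈-++⁺ʳ structural (here refl)) (w ∷ β ∷ [] , b , l , p)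
  ; node-closed = λ {w} {y} {z} {β} b l r p q → ≢false⇒≡true λ n →
      fails (∈-++⁺ʳ structural (there (here refl))) (w ∷ y ∷ z ∷ β ∷ [] , b , l , r , p , q , n)
  ; der-closed = λ {t} t∈ {w} {y} {β} e b d m q → ≢false⇒≡true λ n →
      fails (∈-++⁺ʳ structural (there (there (∈-map⁺ derF t∈))))
         (tabulate e , w ∷ y ∷ β ∷ [] , b , d ,
          ⇒matchF t (match-cong t (λ i → sym (lookup∘tabulate e i)) m) , q , n) }
  where
  func : ∀ ρ {x y y′} → Link (pre G) ρ x y → Link (pre G) ρ x y′ → y ≡ y′
  func ρ {x} {y} {y′} (K , c , a , b) (K′ , c′ , a′ , b′) with y ≟ᶠ y′
  ... | yes p = p
  ... | no q = ⊥-elim (fails (∈-++⁺ˡ (functional-∈ ρ))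
                          (K , K′ , x ∷ y ∷ y′ ∷ [] , c , a , b , c′ , a′ , b′ , q))
  no-pair : ∀ ρ ρ′ → ¬ Holds (pre G) (pairF ρ ρ′)
  no-pair ρ ρ′ =
    fails (∈-++⁺ˡ (pair-∈ ρ ρ′))
  dec-true : ∀ {a b} → a ≡ b → ⌊ a ≟ᵇ b ⌋ ≡ true
  dec-true {a} {b} p with a ≟ᵇ b
  ... | yes _ = refl
  ... | no q = ⊥-elim (q p)
  mixed : ∀ ρ → isTop ρ ≡ false → bothSorts ρ topR ≡ true
  mixed ρ t rewrite t = refl
  match-cong : ∀ p {e e′ x} → (∀ i → e i ≡ e′ i) → Match (pre G) p e x → Match (pre G) p e′ x
  match-cong (var i) h m = trans m (h i)
  match-cong leaf h m = m
  match-cong (node p q) h (y , z , l , r , m , n) = y , z , l , r , match-cong p h m , match-cong q h n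
  match-cong (der p) h (y , d , m) = y , d , match-cong p h m

unmix : ∀ ρ ρ′ → bothSorts ρ ρ′ ≡ true → isTop ρ ≡ false × ρ′ ≡ topR
unmix ρ ρ′ p with isTop ρ
unmix ρ topR p | false = refl , refl

sameSort⇒ : ∀ {ρ ρ′} → sameSort ρ ρ′ ≡ true → isTop ρ ≡ isTop ρ′
sameSort⇒ {ρ} {ρ′} p with isTop ρ ≟ᵇ isTop ρ′
... | yes q = q

sentences-fail : ∀ rules {P} → Axioms rules P → ∀ {φ} → φ ∈ sentences rules → ¬ Holds P φ
sentences-fail rules {P} ax φ∈ with ∈-++⁻ structural φ∈
sentences-fail rules {P} ax φ∈ | inj₁ s∈ with structural⁻ s∈
... | inj₁ (ρ , refl) = λ { (K , K′ , x ∷ y ∷ y′ ∷ [] , c , a , b , c′ , a′ , b′ , q) →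
                            q (functional ρ (K , c , a , b) (K′ , c′ , a′ , b′)) }
  where open Axioms ax
... | inj₂ (ρ , ρ′ , refl) =
  λ { (K , K′ , x ∷ y ∷ [] , c , a , c′ , a′ , i , s) → no-offence K K′ x y c a c′ a′ i s }
  where
  open Axioms ax
  true≢false : ∀ {b} → b ≡ true → b ≡ false → ⊥
  true≢false refl ()
  not-true : ∀ {b} → not b ≡ true → b ≡ false
  not-true {false} _ = refl
  no-offence : ∀ K K′ x y → IsClique P K → Attached P ρ K x → IsClique P K′ → Attached P ρ′ K′ y →
               ∀ i → Sat P (offence ρ ρ′ i) [ [ [ noEnv , lookup K ] , lookup K′ ] , lookup (x ∷ y ∷ []) ] → ⊥
  no-offence K K′ x y c a c′ a′ zero s with when-elim (not (compatible ρ ρ′)) (same x₁ x₂) s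
  ... | p , refl = true≢false (exclusive ρ ρ′ (K , c , a) (K′ , c′ , a′)) (not-true p)
  no-offence K K′ x y c a c′ a′ (suc zero) s with when-elim (sameSort ρ ρ′) (edge x₁ x₂ true) s
  ... | p , q = true≢false q (independent ρ ρ′ (K , c , a) (K′ , c′ , a′) (sameSort⇒ {ρ} {ρ′} p))
  no-offence K K′ x y c a c′ a′ (suc (suc zero)) (i , p) = separated ρ ρ′ (K , c , a) K′ c′ a′ i p
  no-offence K K′ x y c a c′ a′ (suc (suc (suc zero))) s
    with when-elim (bothSorts ρ ρ′) (some 9 λ i → some 9 λ j → edge (K₁ i) (K₂ j) true) s
  ... | m , i , j , q with unmix ρ ρ′ m
  ...   | t , refl = true≢false q (proj₁ (isolated ρ t K K′ c a c′ a′) i j)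
  no-offence K K′ x y c a c′ a′ (suc (suc (suc (suc zero)))) s
    with when-elim (bothSorts ρ ρ′) (some 9 λ i → edge (K₁ i) x₂ true) s
  ... | m , i , q with unmix ρ ρ′ m
  ...   | t , refl = true≢false q (proj₁ (proj₂ (isolated ρ t K K′ c a c′ a′)) i)
  no-offence K K′ x y c a c′ a′ (suc (suc (suc (suc (suc zero))))) s
    with when-elim (bothSorts ρ ρ′) (some 9 λ j → edge x₁ (K₂ j) true) s
  ... | m , j , q with unmix ρ ρ′ m
  ...   | t , refl = true≢false q (proj₂ (proj₂ (isolated ρ t K K′ c a c′ a′)) j)
sentences-fail rules {P} ax φ∈ | inj₂ (here refl) =
  λ { (w ∷ β ∷ [] , b , l , p) → contradiction (trans (sym (leaf-closed b l)) p) λ () }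
  where open Axioms ax
sentences-fail rules {P} ax φ∈ | inj₂ (there (here refl)) =
  λ { (w ∷ y ∷ z ∷ β ∷ [] , b , l , r , p , q , n) → contradiction (trans (sym (node-closed b l r p q)) n) λ () }
  where open Axioms ax
sentences-fail rules {P} ax φ∈ | inj₂ (there (there d∈)) with ∈-map⁻ derF d∈
... | p , p∈ , refl =
  λ { (v , w ∷ y ∷ β ∷ [] , b , d , m , q , n) →
      contradiction (trans (sym (der-closed p∈ (lookup v) b d (matchF⇒ p m) q)) n) λ () }
  where open Axioms ax

class⇒axioms : ∀ rules G → Forb (family (sentences rules)) G → Axioms rules (pre G)
class⇒axioms rules G forb = axioms rules G (family-complete (sentences rules) G forb)

-- Counterexamples are existential, so one in `G` would also be one in the possibly infinite `P`.
axioms⇒class : ∀ rules G {P} → pre G ⊑ P → Axioms rules P → Forb (family (sentences rules)) G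
axioms⇒class rules G f ax =
  family-sound (sentences rules) G λ {φ} φ∈ s → sentences-fail rules ax φ∈ (holds-up f φ s)

-- Values of points

abstract
  has? : ∀ G ρ x → Dec (Has (pre G) ρ x)
  has? G ρ x = sat? G (hasF ρ x) (λ y → y)

  link? : ∀ G ρ x y → Dec (Link (pre G) ρ x y)
  link? G ρ x y = sat? G (linkF ρ x y) (λ z → z)

-- Being inductive, this gives no value to a point whose links run into a cycle or break off; such
-- points receive no edges across the joint graph unless they are top points.
data Val (P : PreGraph) (x : Vertex P) : Tree → Set where
  val-leaf : Has P leafR x → Val P x leaf
  val-node : ∀ {y z t u} → Link P leftR x y → Link P rightR x z → Val P y t → Val P z u → Val P x (node t u)
  val-der  : ∀ {y t} → Link P derR x y → Val P y t → Val P x (der t)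

height : Tree → ℕ
height leaf = 0
height (node t u) = suc (height t ⊔ height u)
height (der t) = suc (height t)

module _ {rules P} (ax : Axioms rules P) where
  open Axioms ax

  -- `exclusive` settles the constructor at `x`, and `functional` the points below it.
  val-unique : ∀ {x t u} → Val P x t → Val P x u → t ≡ u
  val-unique (val-leaf h) (val-leaf h′) = refl
  val-unique (val-leaf h) (val-node l _ _ _) = contradiction (exclusive leafR leftR h (link⇒has P leftR l)) λ ()
  val-unique (val-leaf h) (val-der d _) = contradiction (exclusive leafR derR h (link⇒has P derR d)) λ ()
  val-unique (val-node l _ _ _) (val-leaf h) = contradiction (exclusive leafR leftR h (link⇒has P leftR l)) λ ()
  val-unique (val-node l r v w) (val-node l′ r′ v′ w′)
    with functional leftR l l′ | functional rightR r r′
  ... | refl | refl = cong₂ node (val-unique v v′) (val-unique w w′)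
  val-unique (val-node l _ _ _) (val-der d _) =
    contradiction (exclusive leftR derR (link⇒has P leftR l) (link⇒has P derR d)) λ ()
  val-unique (val-der d _) (val-leaf h) = contradiction (exclusive leafR derR h (link⇒has P derR d)) λ ()
  val-unique (val-der d _) (val-node l _ _ _) =
    contradiction (exclusive leftR derR (link⇒has P leftR l) (link⇒has P derR d)) λ ()
  val-unique (val-der d v) (val-der d′ v′) with functional derR d d′
  ... | refl = cong der (val-unique v v′)

  -- Agreement of `σ` is asked only where `e i` has a value: variables of `p` meet points below `x`,
  -- which have one, while the remaining variables may be assigned to arbitrary vertices.
  match-value : ∀ {e} (σ : Fin 8 → Tree) → (∀ i {u} → Val P (e i) u → σ i ≡ u) →
                ∀ p {x u} → Match P p e x → Val P x u → inst σ p ≡ u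
  match-value σ h (var i) refl v = h i v
  match-value σ h leaf m v = val-unique (val-leaf m) v
  match-value σ h (node p q) (y , z , l , r , m , n) (val-node l′ r′ v w)
    with functional leftR l l′ | functional rightR r r′
  ... | refl | refl = cong₂ node (match-value σ h p m v) (match-value σ h q n w)
  match-value σ h (node p q) (y , z , l , r , m , n) (val-leaf h′) =
    contradiction (exclusive leafR leftR h′ (link⇒has P leftR l)) λ ()
  match-value σ h (node p q) (y , z , l , r , m , n) (val-der d _) =
    contradiction (exclusive leftR derR (link⇒has P leftR l) (link⇒has P derR d)) λ ()
  match-value σ h (der p) (y , d , m) (val-leaf h′) =
    contradiction (exclusive leafR derR h′ (link⇒has P derR d)) λ ()
  match-value σ h (der p) (y , d , m) (val-node l _ _ _) =
    contradiction (exclusive leftR derR (link⇒has P leftR l) (link⇒has P derR d)) λ ()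
  match-value σ h (der p) (y , d , m) (val-der d′ v) with functional derR d d′
  ... | refl = cong der (match-value σ h p m v)

val-levels : ∀ {P x t} → Val P x t → ∀ i → i ≤ height t →
             Σ (Vertex P) λ y → Σ Tree λ u → Val P y u × height u ≡ i
val-levels {x = x} {t} v i h with m≤n⇒m<n∨m≡n h
... | inj₂ refl = x , t , v , refl
val-levels (val-leaf _) i h | inj₁ ()
val-levels (val-der _ v) i h | inj₁ (s≤s h′) = val-levels v i h′
val-levels (val-node {t = t} {u} _ _ v w) i h | inj₁ (s≤s h′) with ⊔-sel (height t) (height u)
... | inj₁ p = val-levels v i (subst (i ≤_) p h′)
... | inj₂ p = val-levels w i (subst (i ≤_) p h′)

-- Along a deepest branch the heights of the values, hence the vertices, are distinct.
val-height : ∀ {rules} G → Axioms rules (pre G) → ∀ {x t} → Val (pre G) x t → height t < size G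
val-height G ax {t = t} v with suc (height t) ≤? size G
... | yes p = p
... | no p with pigeonhole (s≤s (s≤s⁻¹ (≮⇒≥ λ q → p (s≤s⁻¹ q)))) (λ (i : Fin (suc (height t))) → proj₁ (val-levels v (toℕ i) (s≤s⁻¹ (toℕ<n i))))
...   | i , j , i<j , eq
  with val-levels v (toℕ i) (s≤s⁻¹ (toℕ<n i)) | val-levels v (toℕ j) (s≤s⁻¹ (toℕ<n j))
val-height G ax v | no p | i , j , i<j , refl | y , u , vu , hu | .y , u′ , vu′ , hu′ =
  contradiction (trans (sym hu) (trans (cong height (val-unique ax vu vu′)) hu′)) (<⇒≢ i<j)

-- Links may be cyclic, so the search recurses on a bound for the height. By `val-height` the bound
-- `size G` loses nothing.
valued-below? : ∀ G k x → Dec (Σ Tree λ t → Val (pre G) x t × height t < k)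
valued-below? G zero x = no λ ()
valued-below? G (suc k) x = map′ build split
  (has? G leafR x ⊎-dec
   any? (λ y → link? G derR x y ×-dec valued-below? G k y) ⊎-dec
   (any? (λ y → link? G leftR x y ×-dec valued-below? G k y) ×-dec
    any? (λ z → link? G rightR x z ×-dec valued-below? G k z)))
  where
  P = pre G
  Below : Vertex P → Set
  Below y = Σ Tree λ t → Val P y t × height t < k
  Cases : Set
  Cases = Has P leafR x ⊎ (∃ λ y → Link P derR x y × Below y) ⊎
          ((∃ λ y → Link P leftR x y × Below y) × (∃ λ z → Link P rightR x z × Below z))
  build : Cases → Σ Tree λ t → Val P x t × height t < suc k
  build (inj₁ h) = leaf , val-leaf h , s≤s z≤n
  build (inj₂ (inj₁ (y , d , t , v , h))) = der t , val-der d v , s≤s h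
  build (inj₂ (inj₂ ((y , l , t , v , h) , (z , r , u , w , h′)))) =
    node t u , val-node l r v w , s≤s (⊔-lub h h′)
  split : (Σ Tree λ t → Val P x t × height t < suc k) → Cases
  split (leaf , val-leaf h , _) = inj₁ h
  split (der t , val-der d v , s≤s h) = inj₂ (inj₁ (_ , d , t , v , h))
  split (node t u , val-node l r v w , s≤s h) =
    inj₂ (inj₂ ((_ , l , t , v , ≤-trans (s≤s (m⊔n≤o⇒m≤o (height t) (height u) ≤-refl)) h) ,
                (_ , r , u , w , ≤-trans (s≤s (m⊔n≤o⇒n≤o (height t) (height u) ≤-refl)) h)))

abstract
  valued? : ∀ {rules} G → Axioms rules (pre G) → ∀ x → Dec (Σ Tree λ t → Val (pre G) x t)
  valued? G ax x = map′ (λ (t , v , _) → t , v) (λ (t , v) → t , v , val-height G ax v) (valued-below? G (size G) x)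

-- The joint graph

-- These are the closure axioms read for edges between the two sides. A set larger than that of the
-- genuine derivations is allowed, which leaves room for a crude decidable choice.
record Sound (rules : List Term) (ok : Tree → Bool) : Set where
  field
    ok-leaf : ok leaf ≡ true
    ok-node : ∀ {t u} → ok t ≡ true → ok u ≡ true → ok (node t u) ≡ true
    ok-der  : ∀ {p} → p ∈ rules → ∀ σ → ok (inst σ p) ≡ true → ok (der (inst σ p)) ≡ true

does-true : ∀ {A : Set} (d : Dec A) → does d ≡ true → A
does-true (yes a) _ = a

true-does : ∀ {A : Set} (d : Dec A) → A → does d ≡ true
true-does (yes _) _ = refl
true-does (no ¬a) a = contradiction a ¬a

true≢false : ∀ {b} → b ≡ true → b ≡ false → ⊥
true≢false refl ()

∧-true : ∀ {a b} → a ∧ b ≡ true → a ≡ true × b ≡ true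
∧-true {true} {true} _ = refl , refl

∨-true : ∀ {a b} → a ∨ b ≡ true → a ≡ true ⊎ b ≡ true
∨-true {true} _ = inj₁ refl
∨-true {false} p = inj₂ p

third-side : ∀ {a b : Bool} c → a ≢ b → c ≢ a → c ≡ b
third-side {true} {true} c p q = contradiction refl p
third-side {false} {false} c p q = contradiction refl p
third-side {true} {false} true p q = contradiction refl q
third-side {true} {false} false p q = refl
third-side {false} {true} false p q = contradiction refl q
third-side {false} {true} true p q = refl

abstract
  distinct-third : ∀ (i j : Fin 9) → Σ (Fin 9) λ k → k ≢ i × k ≢ j
  distinct-third = from-yes (all? {n = 9} λ i → all? {n = 9} λ j → any? λ k → ¬? (k ≟ᶠ i) ×-dec ¬? (k ≟ᶠ j))

module Join {rules ok} (sound : Sound rules ok) (G : Bool → Graph) (ax : ∀ s → Axioms rules (pre (G s))) where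
  open Sound sound

  P : Bool → PreGraph
  P s = pre (G s)

  abstract
    good? : ∀ s x → Dec (Σ Tree λ t → Val (P s) x t × ok t ≡ true)
    good? s x with valued? (G s) (ax s) x
    ... | no n = no λ (t , v , _) → n (t , v)
    ... | yes (t , v) with ok t ≟ᵇ true
    ...   | yes k = yes (t , v , k)
    ...   | no n = no λ (u , w , k) → n (trans (cong ok (val-unique (ax s) v w)) k)

  good top : ∀ s → Fin (size (G s)) → Bool
  good s x = does (good? s x)
  top s x = does (has? (G s) topR x)

  Side : Set
  Side = Σ Bool λ s → Fin (size (G s))

  cross : Side → Side → Bool
  cross (s , x) (s′ , y) = (good s x ∧ top s′ y) ∨ (top s x ∧ good s′ y)

  joined : Side → Side → Bool
  joined (true , x) (true , y) = adj (G true) x y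
  joined (false , x) (false , y) = adj (G false) x y
  joined (true , x) (false , y) = cross (true , x) (false , y)
  joined (false , x) (true , y) = cross (false , x) (true , y)

  cross-sym : ∀ p q → cross p q ≡ cross q p
  cross-sym (s , x) (s′ , y) =
    trans (∨-comm (good s x ∧ top s′ y) _) (cong₂ _∨_ (∧-comm (top s x) _) (∧-comm (good s x) _))

  joined-same : ∀ s x y → joined (s , x) (s , y) ≡ adj (G s) x y
  joined-same true x y = refl
  joined-same false x y = refl

  joined-cross : ∀ {p q} → proj₁ p ≢ proj₁ q → joined p q ≡ cross p q
  joined-cross {true , _} {true , _} n = contradiction refl n
  joined-cross {true , _} {false , _} n = refl
  joined-cross {false , _} {true , _} n = refl
  joined-cross {false , _} {false , _} n = contradiction refl n

  joint : PreGraph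
  joint = record { Vertex = Side ; adjacent = joined ; adjacent-sym = symm ; adjacent-irrefl = irr }
    where
    symm : ∀ p q → joined p q ≡ joined q p
    symm (true , x) (true , y) = Graph.sym (G true) x y
    symm (true , x) (false , y) = cross-sym (true , x) (false , y)
    symm (false , x) (true , y) = cross-sym (false , x) (true , y)
    symm (false , x) (false , y) = Graph.sym (G false) x y
    irr : ∀ p → joined p p ≡ false
    irr (true , x) = irrefl (G true) x
    irr (false , x) = irrefl (G false) x

  inclusion : ∀ s → P s ⊑ joint
  inclusion s = record { to = λ x → s , x ; to-injective = λ { refl → refl } ; to-adjacent = joined-same s }

  good-has : ∀ s {x} → good s x ≡ true → Σ Role λ ρ → isTop ρ ≡ false × Has (P s) ρ x
  good-has s {x} g with does-true (good? s x) g
  ... | _ , val-leaf h , _ = leafR , refl , h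
  ... | _ , val-node l _ _ _ , _ = leftR , refl , link⇒has (P s) leftR l
  ... | _ , val-der d _ , _ = derR , refl , link⇒has (P s) derR d

  top-has : ∀ s {x} → top s x ≡ true → Has (P s) topR x
  top-has s {x} = does-true (has? (G s) topR x)

  good-not-top : ∀ s ρ {x} → good s x ≡ true → Has (P s) ρ x → isTop ρ ≡ false
  good-not-top s ρ g h with good-has s g
  ... | ρ′ , t , h′ with Axioms.exclusive (ax s) ρ ρ′ h h′
  good-not-top s leafR g h | ρ′ , t , h′ | c = refl
  good-not-top s leftR g h | ρ′ , t , h′ | c = refl
  good-not-top s rightR g h | ρ′ , t , h′ | c = refl
  good-not-top s derR g h | ρ′ , t , h′ | c = refl
  good-not-top s childR g h | ρ′ , t , h′ | c = refl
  good-not-top s topR g h | topR , () , h′ | c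

  top-top : ∀ s ρ {x} → top s x ≡ true → Has (P s) ρ x → isTop ρ ≡ true
  top-top s ρ t h with Axioms.exclusive (ax s) ρ topR h (top-has s t)
  top-top s topR t h | c = refl

  good-top-absurd : ∀ s {x} → good s x ≡ true → top s x ≡ true → ⊥
  good-top-absurd s g t = true≢false refl (good-not-top s topR g (top-has s t))

  crossing : ∀ {s x s′ y} → s ≢ s′ → joined (s , x) (s′ , y) ≡ true →
             (good s x ≡ true × top s′ y ≡ true) ⊎ (top s x ≡ true × good s′ y ≡ true)
  crossing {s} {x} {s′} {y} n e with ∨-true {good s x ∧ top s′ y} (trans (sym (joined-cross n)) e)
  ... | inj₁ p = inj₁ (∧-true p)
  ... | inj₂ p = inj₂ (∧-true p)

  crossing-has : ∀ {s x s′ y} → s ≢ s′ → joined (s , x) (s′ , y) ≡ true →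
                 (Σ Role λ ρ → Has (P s) ρ x) × (Σ Role λ ρ → Has (P s′) ρ y)
  crossing-has {s} {x} {s′} {y} n e with crossing n e
  ... | inj₁ (g , t) = (proj₁ (good-has s g) , proj₂ (proj₂ (good-has s g))) , (topR , top-has s′ t)
  ... | inj₂ (t , g) = (topR , top-has s t) , (proj₁ (good-has s′ g) , proj₂ (proj₂ (good-has s′ g)))

  -- An edge across joins a good point to a top point. If `x` and `z` are both good or both top,
  -- `independent` forbids the edge between them; otherwise `y` would be both good and top.
  no-crossing-triangle : ∀ {s x z s′ y} → s ≢ s′ → adj (G s) x z ≡ true →
                         joined (s , x) (s′ , y) ≡ true → joined (s , z) (s′ , y) ≡ true → ⊥
  no-crossing-triangle {s} {x} {z} {s′} {y} n e p q with crossing n p | crossing n q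
  ... | inj₁ (g , _) | inj₁ (g′ , _) =
    let (ρ , a , h) = good-has s g ; (ρ′ , a′ , h′) = good-has s g′ in
    true≢false e (Axioms.independent (ax s) ρ ρ′ h h′ (trans a (sym a′)))
  ... | inj₁ (_ , t) | inj₂ (_ , g) = good-top-absurd s′ g t
  ... | inj₂ (_ , g) | inj₁ (_ , t) = good-top-absurd s′ g t
  ... | inj₂ (t , _) | inj₂ (t′ , _) =
    true≢false e (Axioms.independent (ax s) topR topR (top-has s t) (top-has s t′) refl)

  -- If `p` and `q` were on different sides, `r` would share a side with one of them, and that edge
  -- with the remaining vertex would be a crossing triangle.
  triangle-side : ∀ {p q r} → joined p q ≡ true → joined q r ≡ true → joined p r ≡ true → proj₁ p ≡ proj₁ q
  triangle-side {s , x} {s′ , y} {u , z} pq qr pr with s ≟ᵇ s′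
  ... | yes e = e
  ... | no n with u ≟ᵇ s
  ...   | yes refl = ⊥-elim (no-crossing-triangle n (trans (sym (joined-same s x z)) pr) pq
                              (trans (adjacent-sym joint (s , z) (s′ , y)) qr))
  ...   | no m with third-side u n m
  ...     | refl = ⊥-elim (no-crossing-triangle (λ e → n (sym e)) (trans (sym (joined-same s′ y z)) qr)
                            (trans (adjacent-sym joint (s′ , y) (s , x)) pq)
                            (trans (adjacent-sym joint (s′ , z) (s , x)) pr))

  clique-edge : ∀ K → IsClique joint K → ∀ {i j} → i ≢ j → joined (lookup K i) (lookup K j) ≡ true
  clique-edge K c {i} {j} n with i ≟ᶠ j | c i j
  ... | yes e | _ = contradiction e n
  ... | no _ | e = e

  clique-side : ∀ K → IsClique joint K → ∀ i j → proj₁ (lookup K i) ≡ proj₁ (lookup K j)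
  clique-side K c i j with i ≟ᶠ j
  ... | yes refl = refl
  ... | no n with distinct-third i j
  ...   | k , ki , kj = triangle-side (clique-edge K c n) (clique-edge K c (λ e → kj (sym e)))
                                      (clique-edge K c (λ e → ki (sym e)))

  -- Every mark is at least two, so `v` forms a triangle with the vertices 0 and 1 of the cell.
  attached-side : ∀ ρ K {v} → IsClique joint K → Attached joint ρ K v → ∀ i → proj₁ (lookup K i) ≡ proj₁ v
  attached-side ρ K c a i =
    trans (clique-side K c i (# 0))
          (triangle-side (edge₀ ρ a) (trans (adjacent-sym joint _ (lookup K (# 1))) (edge₁ ρ a))
                         (clique-edge K c {# 0} {# 1} λ ()))
    where
    edge₀ : ∀ ρ {v} → Attached joint ρ K v → joined (lookup K (# 0)) v ≡ true
    edge₀ leafR a = a (# 0)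
    edge₀ leftR a = a (# 0)
    edge₀ rightR a = a (# 0)
    edge₀ derR a = a (# 0)
    edge₀ childR a = a (# 0)
    edge₀ topR a = a (# 0)
    edge₁ : ∀ ρ {v} → Attached joint ρ K v → joined (lookup K (# 1)) v ≡ true
    edge₁ leafR a = a (# 1)
    edge₁ leftR a = a (# 1)
    edge₁ rightR a = a (# 1)
    edge₁ derR a = a (# 1)
    edge₁ childR a = a (# 1)
    edge₁ topR a = a (# 1)

  record Local (s : Bool) (K : Cell joint) : Set where
    field
      cell   : Cell (P s)
      equal  : ∀ i → lookup K i ≡ (s , lookup cell i)
      clique : IsClique (P s) cell
    attach : ∀ ρ {x} → Attached joint ρ K (s , x) → Attached (P s) ρ cell x
    attach ρ {x} a i =
      trans (sym (joined-same s (lookup cell i) x)) (trans (cong (λ v → joined v (s , x)) (sym (equal i))) (a i))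
  open Local

  local : ∀ ρ {s x} K → IsClique joint K → Attached joint ρ K (s , x) → Local s K
  local ρ {s} K c a = record { cell = cell′ ; equal = equal′ ; clique = λ i j →
      trans (sym (joined-same s _ _)) (trans (cong₂ joined (sym (equal′ i)) (sym (equal′ j))) (c i j)) }
    where
    at : ∀ v → proj₁ v ≡ s → Σ (Vertex (P s)) λ x → v ≡ (s , x)
    at (_ , x) refl = x , refl
    vertex : Fin 9 → Vertex (P s)
    vertex i = proj₁ (at (lookup K i) (attached-side ρ K c a i))
    cell′ : Cell (P s)
    cell′ = tabulate vertex
    equal′ : ∀ i → lookup K i ≡ (s , lookup cell′ i)
    equal′ i = trans (proj₂ (at (lookup K i) (attached-side ρ K c a i)))
                     (cong (s ,_) (sym (lookup∘tabulate vertex i)))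

  has-local : ∀ ρ {s x} → Has joint ρ (s , x) → Has (P s) ρ x
  has-local ρ (K , c , a) = cell L , clique L , attach L ρ a
    where L = local ρ K c a

  link-local : ∀ ρ {s x w} → Link joint ρ (s , x) w → Σ (Vertex (P s)) λ y → w ≡ (s , y) × Link (P s) ρ x y
  link-local ρ {w = _ , y} (K , c , a , b)
    with trans (sym (attached-side ρ K c a (# 0))) (attached-side childR K c b (# 0))
  ... | refl = y , refl , cell L , clique L , attach L ρ a , attach L childR b
    where L = local ρ K c a

  -- Variables absent from a pattern may be assigned to the other side; they are sent to the default
  -- `d`. Variables that do occur are matched on side `s`, where nothing changes.
  project : ∀ s → Vertex (P s) → Side → Vertex (P s)
  project s d (s′ , x) with s′ ≟ᵇ s
  ... | yes refl = x
  ... | no _ = d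

  project-inclusion : ∀ s d x → project s d (s , x) ≡ x
  project-inclusion s d x with s ≟ᵇ s
  ... | yes refl = refl
  ... | no n = contradiction refl n

  match-local : ∀ s d p {e x} → Match joint p e (s , x) → Match (P s) p (λ i → project s d (e i)) x
  match-local s d (var i) {x = x} m = trans (sym (project-inclusion s d x)) (cong (project s d) m)
  match-local s d leaf m = has-local leafR m
  match-local s d (node p q) (_ , _ , l , r , m , n) with link-local leftR l | link-local rightR r
  ... | y , refl , l′ | z , refl , r′ = y , z , l′ , r′ , match-local s d p m , match-local s d q n
  match-local s d (der p) (_ , l , m) with link-local derR l
  ... | y , refl , l′ = y , l′ , match-local s d p m

  make-edge : ∀ {s x s′ y} → s ≢ s′ → good s x ≡ true → top s′ y ≡ true → joined (s , x) (s′ , y) ≡ true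
  make-edge n g t = trans (joined-cross n) (cong₂ (λ a b → a ∨ b) (cong₂ _∧_ g t) refl)

  edge-good : ∀ {s x s′ y} → s ≢ s′ → Has (P s′) topR y → joined (s , x) (s′ , y) ≡ true → good s x ≡ true
  edge-good {s′ = s′} {y} n h e with crossing n e
  ... | inj₁ (g , _) = g
  ... | inj₂ (_ , g) = ⊥-elim (true≢false refl (good-not-top s′ topR g h))

  has-top : ∀ {s x} → Has joint topR (s , x) → top s x ≡ true
  has-top {s} {x} h = true-does (has? (G s) topR x) (has-local topR h)

  joint-functional : ∀ ρ {x y y′} → Link joint ρ x y → Link joint ρ x y′ → y ≡ y′
  joint-functional ρ {s , x} l l′ with link-local ρ l | link-local ρ l′
  ... | y , refl , m | y′ , refl , m′ = cong (s ,_) (Axioms.functional (ax s) ρ m m′)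

  joint-exclusive : ∀ ρ ρ′ {x} → Has joint ρ x → Has joint ρ′ x → compatible ρ ρ′ ≡ true
  joint-exclusive ρ ρ′ {s , x} h h′ = Axioms.exclusive (ax s) ρ ρ′ (has-local ρ h) (has-local ρ′ h′)

  joint-independent : ∀ ρ ρ′ {x y} → Has joint ρ x → Has joint ρ′ y → isTop ρ ≡ isTop ρ′ → joined x y ≡ false
  joint-independent ρ ρ′ {s , x} {s′ , y} h h′ t with s ≟ᵇ s′
  ... | yes refl = trans (joined-same s x y)
                         (Axioms.independent (ax s) ρ ρ′ (has-local ρ h) (has-local ρ′ h′) t)
  ... | no n = ≢true⇒≡false clash
    where
    clash : joined (s , x) (s′ , y) ≡ true → ⊥
    clash e with crossing n e
    ... | inj₁ (g , u) = true≢false (trans t (top-top s′ ρ′ u (has-local ρ′ h′))) (good-not-top s ρ g (has-local ρ h))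
    ... | inj₂ (u , g) = true≢false (trans (sym t) (top-top s ρ u (has-local ρ h))) (good-not-top s′ ρ′ g (has-local ρ′ h′))

  joint-separated : ∀ ρ ρ′ {x y} → Has joint ρ x → ∀ K → IsClique joint K → Attached joint ρ′ K y → ∀ i → x ≢ lookup K i
  joint-separated ρ ρ′ {x} {s , y} h K c a i e =
    Axioms.separated (ax s) ρ ρ′ (has-local ρ (subst (Has joint ρ) (trans e (equal L i)) h))
                     (cell L) (clique L) (attach L ρ′ a) i refl
    where L = local ρ′ K c a

  -- Edges across end in attached points, and by `separated` no cell vertex is one.
  joint-isolated : ∀ ρ {x y} → isTop ρ ≡ false → ∀ K K′ → IsClique joint K → Attached joint ρ K x →
         IsClique joint K′ → Attached joint topR K′ y →
         (∀ i j → joined (lookup K i) (lookup K′ j) ≡ false)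
         × (∀ i → joined (lookup K i) y ≡ false) × (∀ j → joined x (lookup K′ j) ≡ false)
  joint-isolated ρ {s , x} {s′ , y} t K K′ c a c′ a′ = by-side (s ≟ᵇ s′)
    where
    L = local ρ K c a
    L′ = local topR K′ c′ a′
    Goal : Set
    Goal = (∀ i j → joined (lookup K i) (lookup K′ j) ≡ false)
           × (∀ i → joined (lookup K i) (s′ , y) ≡ false) × (∀ j → joined (s , x) (lookup K′ j) ≡ false)
    from-cell : s ≢ s′ → ∀ i z → joined (lookup K i) (s′ , z) ≡ false
    from-cell n i z = ≢true⇒≡false λ e →
      let ((ρ₀ , h) , _) = crossing-has n (trans (cong (λ v → joined v (s′ , z)) (sym (equal L i))) e) in
      Axioms.separated (ax s) ρ₀ ρ h (cell L) (clique L) (attach L ρ a) i refl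
    to-cell : s ≢ s′ → ∀ j z → joined (s , z) (lookup K′ j) ≡ false
    to-cell n j z = ≢true⇒≡false λ e →
      let (_ , (ρ₀ , h)) = crossing-has n (trans (cong (joined (s , z)) (sym (equal L′ j))) e) in
      Axioms.separated (ax s′) ρ₀ topR h (cell L′) (clique L′) (attach L′ topR a′) j refl
    by-side : Dec (s ≡ s′) → Goal
    by-side (no n) = (λ i j → trans (cong (joined (lookup K i)) (equal L′ j)) (from-cell n i _)) ,
                     (λ i → from-cell n i y) , (λ j → to-cell n j x)
    by-side (yes refl) =
      let (f , g , h) = Axioms.isolated (ax s) ρ t (cell L) (cell L′) (clique L) (attach L ρ a)
                                        (clique L′) (attach L′ topR a′) in
      (λ i j → trans (cong₂ joined (equal L i) (equal L′ j)) (trans (joined-same s _ _) (f i j))) ,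
      (λ i → trans (cong (λ v → joined v (s , y)) (equal L i)) (trans (joined-same s _ _) (g i))) ,
      (λ j → trans (cong (joined (s , x)) (equal L′ j)) (trans (joined-same s _ _) (h j)))

  joint-leaf : ∀ {w β} → Has joint topR β → Has joint leafR w → joined w β ≡ true
  joint-leaf {s , w} {s′ , β} b h with s ≟ᵇ s′
  ... | yes refl = trans (joined-same s w β) (Axioms.leaf-closed (ax s) (has-local topR b) (has-local leafR h))
  ... | no n = make-edge n (true-does (good? s w) (leaf , val-leaf (has-local leafR h) , ok-leaf)) (has-top b)

  joint-node : ∀ {w y z β} → Has joint topR β → Link joint leftR w y → Link joint rightR w z →
          joined y β ≡ true → joined z β ≡ true → joined w β ≡ true
  joint-node {s , w} {β = s′ , β} b l r e e′ with link-local leftR l | link-local rightR r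
  ... | y , refl , l′ | z , refl , r′ with s ≟ᵇ s′
  ...   | yes refl = trans (joined-same s w β)
            (Axioms.node-closed (ax s) (has-local topR b) l′ r′ (trans (sym (joined-same s y β)) e)
                                (trans (sym (joined-same s z β)) e′))
  ...   | no n =
    let (t , v , k) = does-true (good? s y) (edge-good n (has-local topR b) e)
        (u , v′ , k′) = does-true (good? s z) (edge-good n (has-local topR b) e′) in
    make-edge n (true-does (good? s w) (node t u , val-node l′ r′ v v′ , ok-node k k′)) (has-top b)

  -- Across the sides, the edge at `y` certifies that the tree of `y` is ok, and the match shows
  -- this tree to be an instance of `p`. Hence `der` of it is ok, and the edge at `w` was added.
  joint-der : ∀ {p} → p ∈ rules → ∀ {w y β} e → Has joint topR β → Link joint derR w y → Match joint p e y →
         joined y β ≡ true → joined w β ≡ true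
  joint-der {p} p∈ {s , w} {β = s′ , β} e b l m f with link-local derR l
  ... | y , refl , l′ with s ≟ᵇ s′
  ...   | yes refl = trans (joined-same s w β)
            (Axioms.der-closed (ax s) p∈ _ (has-local topR b) l′ (match-local s y p m) (trans (sym (joined-same s y β)) f))
  ...   | no n with does-true (good? s y) (edge-good n (has-local topR b) f)
  ...     | t , v , k =
    make-edge n (true-does (good? s w) (der t , val-der l′ v , subst (λ u → ok (der u) ≡ true) eq ok-inst)) (has-top b)
    where
    value : Vertex (P s) → Tree
    value x with valued? (G s) (ax s) x
    ... | yes (u , _) = u
    -- Any default will do: only variables absent from `p` can be assigned to points without a
    -- value.
    ... | no _ = leaf
    value-correct : ∀ x {u} → Val (P s) x u → value x ≡ u
    value-correct x w with valued? (G s) (ax s) x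
    ... | yes (_ , w′) = val-unique (ax s) w′ w
    ... | no q = contradiction (_ , w) q
    σ : Fin 8 → Tree
    σ i = value (project s y (e i))
    eq : inst σ p ≡ t
    eq = match-value (ax s) σ (λ i → value-correct _) p (match-local s y p m) v
    ok-inst : ok (der (inst σ p)) ≡ true
    ok-inst = ok-der p∈ σ (trans (cong ok eq) k)

  joint-axioms : Axioms rules joint
  joint-axioms = record
    { functional = joint-functional ; exclusive = joint-exclusive
    ; independent = joint-independent ; separated = joint-separated ; isolated = joint-isolated
    ; leaf-closed = joint-leaf ; node-closed = joint-node ; der-closed = joint-der }

  vertices-joint : List Side
  vertices-joint = map (true ,_) (allFin (size (G true))) ++ map (false ,_) (allFin (size (G false)))

  ∈-vertices-joint : ∀ s x → (s , x) ∈ vertices-joint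
  ∈-vertices-joint true x = ∈-++⁺ˡ (∈-map⁺ (true ,_) (∈-allFin x))
  ∈-vertices-joint false x = ∈-++⁺ʳ (map (true ,_) (allFin (size (G true)))) (∈-map⁺ (false ,_) (∈-allFin x))

  finite-joint : Cover joint vertices-joint
  finite-joint = cover joint (≡-dec _≟ᵇ_ _≟ᶠ_) vertices-joint

  part : ∀ s → P s ⊑ pre (graph finite-joint)
  part s = record
    { to = λ x → proj₁ (at x)
    ; to-injective = λ {x} {y} e →
        to-injective (inclusion s) (trans (sym (proj₂ (at x))) (trans (cong (to (embed finite-joint)) e) (proj₂ (at y))))
    ; to-adjacent = λ x y → trans (sym (to-adjacent (embed finite-joint) _ _))
        (trans (cong₂ joined (proj₂ (at x)) (proj₂ (at y))) (joined-same s x y)) }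
    where
    at : ∀ x → InImage (embed finite-joint) (s , x)
    at x = covers finite-joint (∈-vertices-joint s x)

-- The forest of all trees

<ᵇ-true : ∀ {m n} → m < n → (m <ᵇ n) ≡ true
<ᵇ-true {m} {n} p with m <ᵇ n | <⇒<ᵇ p
... | true | _ = refl

true-<ᵇ : ∀ {m n} → (m <ᵇ n) ≡ true → m < n
true-<ᵇ {m} {n} p = <ᵇ⇒< m n (subst T (sym p) tt)

-- An injection has a pivot at `a`: some `j` at most `a` whose image is at least `a`. This `j` is
-- below `c` while its image is not below `a`.
threshold-≥ : ∀ {n a c} (π : Fin n → Fin n) → (∀ {r s} → π r ≡ π s → r ≡ s) →
              (∀ r → (toℕ (π r) <ᵇ a) ≡ (toℕ r <ᵇ c)) → a < n → a < c → ⊥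
threshold-≥ {n} {a} {c} π inj h a<n a<c with injective⇒existsPivot {f = π} inj (fromℕ< a<n)
... | j , j≤i , i≤πj =
  ≤⇒≯ (subst (_≤ toℕ (π j)) (toℕ-fromℕ< a<n) i≤πj)
      (true-<ᵇ (trans (h j) (<ᵇ-true (≤-<-trans (subst (toℕ j ≤_) (toℕ-fromℕ< a<n) j≤i) a<c))))

injective⇒surjective : ∀ {n} (π : Fin n → Fin n) → (∀ {r s} → π r ≡ π s → r ≡ s) → ∀ k → ∃ λ r → π r ≡ k
injective⇒surjective {suc n} π inj k with any? (λ r → π r ≟ᶠ k)
... | yes p = p
... | no q = contradiction (injective⇒≤ {f = λ r → punchOut (avoid r)} λ {r} {s} e →
                              inj (punchOut-injective (avoid r) (avoid s) e)) 1+n≰n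
  where
  avoid : ∀ r → k ≢ π r
  avoid r e = q (r , sym e)

-- A clique may list the vertices of a cell in any order. The number of them that a point sees does
-- not depend on the order, so its role is unambiguous.
threshold-unique : ∀ {n a c} (π : Fin n → Fin n) → (∀ {r s} → π r ≡ π s → r ≡ s) →
                   (∀ r → (toℕ (π r) <ᵇ a) ≡ (toℕ r <ᵇ c)) → a < n → c < n → a ≡ c
threshold-unique {n} {a} {c} π inj h a<n c<n with <-cmp a c
... | tri< a<c _ _ = ⊥-elim (threshold-≥ π inj h a<n a<c)
... | tri≈ _ e _ = e
... | tri> _ _ c<a = ⊥-elim (threshold-≥ π⁻¹ inj⁻¹ h⁻¹ c<n c<a)
  where
  π⁻¹ : Fin n → Fin n
  π⁻¹ k = proj₁ (injective⇒surjective π inj k)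
  right-inverse : ∀ k → π (π⁻¹ k) ≡ k
  right-inverse k = proj₂ (injective⇒surjective π inj k)
  inj⁻¹ : ∀ {r s} → π⁻¹ r ≡ π⁻¹ s → r ≡ s
  inj⁻¹ {r} {s} e = trans (sym (right-inverse r)) (trans (cong π e) (right-inverse s))
  h⁻¹ : ∀ r → (toℕ (π⁻¹ r) <ᵇ c) ≡ (toℕ r <ᵇ a)
  h⁻¹ r = trans (sym (h (π⁻¹ r))) (cong (λ k → toℕ k <ᵇ a) (right-inverse r))

mark≤7 : ∀ ρ → mark ρ ≤ 7
mark≤7 leafR = <ᵇ⇒< 1 7 tt
mark≤7 leftR = <ᵇ⇒< 2 7 tt
mark≤7 rightR = <ᵇ⇒< 3 7 tt
mark≤7 derR = <ᵇ⇒< 4 7 tt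
mark≤7 childR = <ᵇ⇒< 5 7 tt
mark≤7 topR = ≤-refl

mark-injective : ∀ ρ ρ′ → mark ρ ≡ mark ρ′ → ρ ≡ ρ′
mark-injective leafR leafR _ = refl
mark-injective leftR leftR _ = refl
mark-injective rightR rightR _ = refl
mark-injective derR derR _ = refl
mark-injective childR childR _ = refl
mark-injective topR topR _ = refl

-- Disjoint cells indexed by `I` and pairwise non-adjacent points indexed by `J`, where `count i p`
-- is the number of vertices of cell `i` that `p` sees. The main fact is that all cliques of nine
-- are the given cells, so the axioms reduce to arithmetic of `count`.
module CellSystem {I J : Set} (_≟ᴵ_ : DecidableEquality I) (count : I → J → ℕ) (count≤7 : ∀ i p → count i p ≤ 7) where

  Node : Set
  Node = (I × Fin 9) ⊎ J

  joins : Node → Node → Bool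
  joins (inj₁ (i , r)) (inj₁ (j , s)) = does (i ≟ᴵ j) ∧ not ⌊ r ≟ᶠ s ⌋
  joins (inj₁ (i , r)) (inj₂ p) = toℕ r <ᵇ count i p
  joins (inj₂ p) (inj₁ (i , r)) = toℕ r <ᵇ count i p
  joins (inj₂ p) (inj₂ q) = false

  system : PreGraph
  system = record { Vertex = Node ; adjacent = joins ; adjacent-sym = symm ; adjacent-irrefl = irr }
    where
    symm : ∀ x y → joins x y ≡ joins y x
    symm (inj₁ (i , r)) (inj₁ (j , s)) with i ≟ᴵ j | j ≟ᴵ i
    ... | no _ | no _ = refl
    ... | yes e | no n = contradiction (sym e) n
    ... | no n | yes e = contradiction (sym e) n
    ... | yes _ | yes _ with r ≟ᶠ s | s ≟ᶠ r
    ...   | no _ | no _ = refl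
    ...   | yes e | no n = contradiction (sym e) n
    ...   | no n | yes e = contradiction (sym e) n
    ...   | yes _ | yes _ = refl
    symm (inj₁ (i , r)) (inj₂ p) = refl
    symm (inj₂ p) (inj₁ (i , r)) = refl
    symm (inj₂ p) (inj₂ q) = refl
    irr : ∀ x → joins x x ≡ false
    irr (inj₁ (i , r)) with r ≟ᶠ r
    ... | yes _ = ∧-comm _ false
    ... | no n = contradiction refl n
    irr (inj₂ p) = refl

  distinct-edge : ∀ K → IsClique system K → ∀ {r s} → r ≢ s → joins (lookup K r) (lookup K s) ≡ true
  distinct-edge K c {r} {s} n with r ≟ᶠ s | c r s
  ... | yes e | _ = contradiction e n
  ... | no _ | e = e

  same-cell : ∀ {i r j s} → joins (inj₁ (i , r)) (inj₁ (j , s)) ≡ true → i ≡ j × r ≢ s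
  same-cell {i} {r} {j} {s} e with i ≟ᴵ j | r ≟ᶠ s
  ... | yes p | no n = p , n

  same-vertex : ∀ {i r j s} → i ≡ j → joins (inj₁ (i , r)) (inj₁ (j , s)) ≡ false → r ≡ s
  same-vertex {i} {r} {j} {s} e f with i ≟ᴵ j | r ≟ᶠ s
  ... | no n | _ = contradiction e n
  ... | yes _ | yes q = q

  -- A point sees at most seven vertices of a cell and no other point, too few for a clique of nine.
  no-point : ∀ K → IsClique system K → ∀ r p → lookup K r ≢ inj₂ p
  no-point K c r p eq = clash (pigeonhole ≤-refl λ s → fromℕ< (proj₂ (proj₂ (proj₂ (member s)))))
    where
    member : ∀ (s : Fin 8) → Σ I λ i → Σ (Fin 9) λ t → lookup K (punchIn r s) ≡ inj₁ (i , t) × toℕ t < 7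
    member s with lookup K (punchIn r s) | distinct-edge K c {punchIn r s} {r} (punchInᵢ≢i r s)
    ... | inj₁ (i , t) | e = i , t , refl ,
          ≤-trans (true-<ᵇ (subst (λ v → joins (inj₁ (i , t)) v ≡ true) eq e)) (count≤7 i p)
    ... | inj₂ q | e = contradiction (subst (λ v → joins (inj₂ q) v ≡ true) eq e) λ ()
    clash : (∃ λ s → ∃ λ s′ → toℕ s < toℕ s′ ×
             fromℕ< (proj₂ (proj₂ (proj₂ (member s)))) ≡ fromℕ< (proj₂ (proj₂ (proj₂ (member s′))))) → ⊥
    clash (s , s′ , s<s′ , e) with member s | member s′ | distinct-edge K c {punchIn r s} {punchIn r s′}
                                                       (λ q → n≮n _ (subst (λ z → toℕ s < toℕ z) (sym (punchIn-injective r s s′ q)) s<s′))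
    ... | i , t , p₁ , l | i′ , t′ , p₂ , l′ | d =
      proj₂ (same-cell {i} {t} {i′} {t′} (subst₂ (λ v w → joins v w ≡ true) p₁ p₂ d))
            (toℕ-injective (trans (sym (toℕ-fromℕ< l)) (trans (cong toℕ e) (toℕ-fromℕ< l′))))

  record Standard (K : Cell system) : Set where
    field
      index       : I
      perm        : Fin 9 → Fin 9
      equal       : ∀ r → lookup K r ≡ inj₁ (index , perm r)
      perm-injective : ∀ {r s} → perm r ≡ perm s → r ≡ s
  open Standard public

  standard : ∀ K → IsClique system K → Standard K
  standard K c = record { index = i₀ ; perm = λ r → proj₁ (proj₂ (at r)) ; equal = eq ; perm-injective = inj }
    where
    at : ∀ r → Σ I λ i → Σ (Fin 9) λ t → lookup K r ≡ inj₁ (i , t)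
    at r with lookup K r in e
    ... | inj₁ (i , t) = i , t , refl
    ... | inj₂ p = contradiction e (no-point K c r p)
    i₀ = proj₁ (at (# 0))
    edge-at : ∀ {r s} → r ≢ s → joins (inj₁ (proj₁ (at r) , proj₁ (proj₂ (at r)))) (inj₁ (proj₁ (at s) , proj₁ (proj₂ (at s)))) ≡ true
    edge-at {r} {s} n = trans (cong₂ joins (sym (proj₂ (proj₂ (at r)))) (sym (proj₂ (proj₂ (at s))))) (distinct-edge K c n)
    index-eq : ∀ r → proj₁ (at r) ≡ i₀
    index-eq r with r ≟ᶠ # 0
    ... | yes e = cong (λ z → proj₁ (at z)) e
    ... | no n = proj₁ (same-cell (edge-at n))
    eq : ∀ r → lookup K r ≡ inj₁ (i₀ , proj₁ (proj₂ (at r)))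
    eq r = trans (proj₂ (proj₂ (at r))) (cong (λ i → inj₁ (i , proj₁ (proj₂ (at r)))) (index-eq r))
    inj : ∀ {r s} → proj₁ (proj₂ (at r)) ≡ proj₁ (proj₂ (at s)) → r ≡ s
    inj {r} {s} e with r ≟ᶠ s
    ... | yes p = p
    ... | no n = contradiction e (proj₂ (same-cell (edge-at n)))

  attached-point : ∀ ρ K → (S : Standard K) → ∀ v → Attached system ρ K v → Σ J λ p → v ≡ inj₂ p × count (index S) p ≡ mark ρ
  attached-point ρ K S (inj₂ p) a =
    p , refl , threshold-unique (perm S) (perm-injective S)
                 (λ r → trans (cong (λ v → joins v (inj₂ p)) (sym (equal S r))) (a r))
                 (≤-trans (s≤s (count≤7 _ p)) (n≤1+n 8)) (≤-trans (s≤s (mark≤7 ρ)) (n≤1+n 8))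
  attached-point ρ K S (inj₁ (j , s)) a = ⊥-elim (impossible (index S ≟ᴵ j))
    where
    adj-at : ∀ r → joins (inj₁ (index S , perm S r)) (inj₁ (j , s)) ≡ (toℕ r <ᵇ mark ρ)
    adj-at r = trans (cong (λ v → joins v (inj₁ (j , s))) (sym (equal S r))) (a r)
    0<mark : ∀ ρ → (0 <ᵇ mark ρ) ≡ true
    0<mark leafR = refl
    0<mark leftR = refl
    0<mark rightR = refl
    0<mark derR = refl
    0<mark childR = refl
    0<mark topR = refl
    beyond : ∀ ρ → (7 <ᵇ mark ρ) ≡ false × (8 <ᵇ mark ρ) ≡ false
    beyond leafR = refl , refl
    beyond leftR = refl , refl
    beyond rightR = refl , refl
    beyond derR = refl , refl
    beyond childR = refl , refl
    beyond topR = refl , refl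
    non-edge : ∀ r → index S ≡ j → (toℕ r <ᵇ mark ρ) ≡ false → perm S r ≡ s
    non-edge r e f = same-vertex e (trans (adj-at r) f)
    impossible : Dec (index S ≡ j) → ⊥
    impossible (no n) = n (proj₁ (same-cell (trans (adj-at (# 0)) (0<mark ρ))))
    -- Within its cell the vertex `s` misses only itself, whereas positions 7 and 8 lie beyond every
    -- mark, so both would be `s`.
    impossible (yes e) with perm-injective S (trans (non-edge (# 7) e (proj₁ (beyond ρ)))
                                                    (sym (non-edge (# 8) e (proj₂ (beyond ρ)))))
    ... | ()

  -- `one-sort` keeps tree points and top points in different systems, so the axioms about an
  -- interaction of the two hold vacuously in each.
  record Consistent : Set where
    field
      functional : ∀ ρ {i i′ p q q′} → count i p ≡ mark ρ → count i q ≡ mark childR →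
                   count i′ p ≡ mark ρ → count i′ q′ ≡ mark childR → q ≡ q′
      exclusive  : ∀ ρ ρ′ {i i′ p} → count i p ≡ mark ρ → count i′ p ≡ mark ρ′ → compatible ρ ρ′ ≡ true
      one-sort   : ∀ ρ {i i′ p p′} → isTop ρ ≡ false → count i p ≡ mark ρ → count i′ p′ ≡ mark topR → ⊥

  has-point : ∀ ρ {x} → Has system ρ x → Σ I λ i → Σ J λ p → x ≡ inj₂ p × count i p ≡ mark ρ
  has-point ρ {x} (K , c , a) = index S , attached-point ρ K S x a
    where S = standard K c

  module _ (con : Consistent) where
    open Consistent con

    one-sort-has : ∀ ρ {x y} → isTop ρ ≡ false → Has system ρ x → Has system topR y → ⊥
    one-sort-has ρ t h h′ with has-point ρ h | has-point topR h′
    ... | i , p , refl , e | i′ , p′ , refl , e′ = one-sort ρ t e e′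

    system-axioms : ∀ rules → Axioms rules system
    system-axioms rules = record
      { functional = func ; exclusive = excl ; independent = indep ; separated = sep
      ; isolated = λ ρ t K K′ c a c′ a′ → ⊥-elim (one-sort-has ρ t (K , c , a) (K′ , c′ , a′))
      ; leaf-closed = λ b l → ⊥-elim (one-sort-has leafR refl l b)
      ; node-closed = λ b l _ _ _ → ⊥-elim (one-sort-has leftR refl (link⇒has system leftR l) b)
      ; der-closed = λ _ _ b d _ _ → ⊥-elim (one-sort-has derR refl (link⇒has system derR d) b) }
      where
      func : ∀ ρ {x y y′} → Link system ρ x y → Link system ρ x y′ → y ≡ y′
      func ρ {x} {y} {y′} (K , c , a , b) (K′ , c′ , a′ , b′)
        with attached-point ρ K (standard K c) x a | attached-point childR K (standard K c) y b
           | attached-point ρ K′ (standard K′ c′) x a′ | attached-point childR K′ (standard K′ c′) y′ b′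
      ... | p , refl , e | q , refl , f | .p , refl , e′ | q′ , refl , f′ = cong inj₂ (functional ρ e f e′ f′)
      excl : ∀ ρ ρ′ {x} → Has system ρ x → Has system ρ′ x → compatible ρ ρ′ ≡ true
      excl ρ ρ′ h h′ with has-point ρ h | has-point ρ′ h′
      ... | i , p , refl , e | i′ , .p , refl , e′ = exclusive ρ ρ′ e e′
      indep : ∀ ρ ρ′ {x y} → Has system ρ x → Has system ρ′ y → isTop ρ ≡ isTop ρ′ → joins x y ≡ false
      indep ρ ρ′ h h′ t with has-point ρ h | has-point ρ′ h′
      ... | i , p , refl , e | i′ , q , refl , e′ = refl
      sep : ∀ ρ ρ′ {x y} → Has system ρ x → ∀ K → IsClique system K → Attached system ρ′ K y → ∀ i → x ≢ lookup K i
      sep ρ ρ′ h K c a i e with has-point ρ h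
      ... | _ , p , refl , _ = no-point K c i p (sym e)

  standardCell-clique : ∀ i r s → joins (inj₁ (i , r)) (inj₁ (i , s)) ≡ not ⌊ r ≟ᶠ s ⌋
  standardCell-clique i r s with i ≟ᴵ i
  ... | yes _ = refl
  ... | no n = contradiction refl n

_≟ᵀ_ : DecidableEquality Tree
leaf ≟ᵀ leaf = yes refl
leaf ≟ᵀ node _ _ = no λ ()
leaf ≟ᵀ der _ = no λ ()
node _ _ ≟ᵀ leaf = no λ ()
node t u ≟ᵀ node t′ u′ = map′ (λ (p , q) → cong₂ node p q) (λ { refl → refl , refl }) (t ≟ᵀ t′ ×-dec u ≟ᵀ u′)
node _ _ ≟ᵀ der _ = no λ ()
der _ ≟ᵀ leaf = no λ ()
der _ ≟ᵀ node _ _ = no λ ()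
der t ≟ᵀ der t′ = map′ (cong der) (λ { refl → refl }) (t ≟ᵀ t′)

_≟ᴿ_ : DecidableEquality Role
ρ ≟ᴿ ρ′ = map′ (mark-injective ρ ρ′) (cong mark) (mark ρ ≟ᴺ mark ρ′)

fits : Tree → Role → Bool
fits leaf leafR = true
fits (node _ _) leftR = true
fits (node _ _) rightR = true
fits (der _) derR = true
fits _ _ = false

-- By the default, the child in a leaf cell is its owner, which `treeCount` counts as owner first; a
-- leaf cell thus has a single attached point.
kid : Tree → Role → Tree
kid (node t u) leftR = t
kid (node t u) rightR = u
kid (der t) derR = t
kid t _ = t

-- Each tree has one point, shared by all its occurrences as a subtree. The cell of a tree and a
-- role that does not fit it has no attached point.
treeCount : Tree × Role → Tree → ℕ
treeCount (t , ρ) u =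
  if fits t ρ then (if does (u ≟ᵀ t) then mark ρ else if does (u ≟ᵀ kid t ρ) then mark childR else 0) else 0

data CountView (t : Tree) (ρ : Role) (u : Tree) : ℕ → Set where
  none  : CountView t ρ u 0
  own   : fits t ρ ≡ true → u ≡ t → CountView t ρ u (mark ρ)
  child : fits t ρ ≡ true → u ≢ t → u ≡ kid t ρ → CountView t ρ u (mark childR)

countView : ∀ t ρ u → CountView t ρ u (treeCount (t , ρ) u)
countView t ρ u with fits t ρ in f
... | false = none
... | true with u ≟ᵀ t
...   | yes e = own f e
...   | no n with u ≟ᵀ kid t ρ
...     | yes e = child f n e
...     | no _ = none

treeCount≤7 : ∀ i u → treeCount i u ≤ 7
treeCount≤7 (t , ρ) u with treeCount (t , ρ) u | countView t ρ u
... | _ | none = z≤n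
... | _ | own _ _ = mark≤7 ρ
... | _ | child _ _ _ = <ᵇ⇒< 5 7 tt

module Forest = CellSystem {Tree × Role} {Tree} (≡-dec _≟ᵀ_ _≟ᴿ_) treeCount treeCount≤7

forest : PreGraph
forest = Forest.system

count-inv : ∀ ρ t ρ₀ u → treeCount (t , ρ₀) u ≡ mark ρ →
            (fits t ρ₀ ≡ true × u ≡ t × ρ₀ ≡ ρ) ⊎ (fits t ρ₀ ≡ true × u ≡ kid t ρ₀ × ρ ≡ childR)
count-inv ρ t ρ₀ u e with treeCount (t , ρ₀) u | countView t ρ₀ u
count-inv leafR t ρ₀ u () | _ | none
count-inv leftR t ρ₀ u () | _ | none
count-inv rightR t ρ₀ u () | _ | none
count-inv derR t ρ₀ u () | _ | none
count-inv childR t ρ₀ u () | _ | none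
count-inv topR t ρ₀ u () | _ | none
... | _ | own f p = inj₁ (f , p , mark-injective _ _ e)
... | _ | child f _ p = inj₂ (f , p , sym (mark-injective childR ρ e))

no-fit-child : ∀ t → fits t childR ≡ true → ⊥
no-fit-child leaf ()
no-fit-child (node _ _) ()
no-fit-child (der _) ()

no-fit-top : ∀ t → fits t topR ≡ true → ⊥
no-fit-top leaf ()
no-fit-top (node _ _) ()
no-fit-top (der _) ()

child-inv : ∀ t ρ₀ u → treeCount (t , ρ₀) u ≡ mark childR → u ≡ kid t ρ₀
child-inv t ρ₀ u e with count-inv childR t ρ₀ u e
... | inj₁ (f , _ , refl) = ⊥-elim (no-fit-child t f)
... | inj₂ (_ , p , _) = p

forest-no-top : ∀ i u → treeCount i u ≡ mark topR → ⊥
forest-no-top (t , ρ₀) u e with count-inv topR t ρ₀ u e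
... | inj₁ (f , _ , refl) = no-fit-top t f

fits-compatible : ∀ t ρ ρ′ → fits t ρ ≡ true → fits t ρ′ ≡ true → compatible ρ ρ′ ≡ true
fits-compatible leaf leafR leafR _ _ = refl
fits-compatible (node _ _) leftR leftR _ _ = refl
fits-compatible (node _ _) leftR rightR _ _ = refl
fits-compatible (node _ _) rightR leftR _ _ = refl
fits-compatible (node _ _) rightR rightR _ _ = refl
fits-compatible (der _) derR derR _ _ = refl

forest-consistent : Forest.Consistent
forest-consistent = record { functional = func ; exclusive = excl ; one-sort = λ ρ {_} {i′} {_} {p′} _ _ e → forest-no-top i′ p′ e }
  where
  func : ∀ ρ {i i′ p q q′} → treeCount i p ≡ mark ρ → treeCount i q ≡ mark childR →
         treeCount i′ p ≡ mark ρ → treeCount i′ q′ ≡ mark childR → q ≡ q′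
  func ρ {t , ρ₀} {t′ , ρ₁} {p} {q} {q′} e f e′ f′ with count-inv ρ t ρ₀ p e | count-inv ρ t′ ρ₁ p e′ | child-inv t ρ₀ q f | child-inv t′ ρ₁ q′ f′
  ... | inj₁ (_ , refl , refl) | inj₁ (_ , refl , refl) | refl | refl = refl
  ... | inj₂ (_ , refl , refl) | inj₂ (_ , p , _) | refl | refl = p
  ... | inj₁ (x , refl , refl) | inj₂ (_ , _ , refl) | _ | _ = ⊥-elim (no-fit-child t x)
  ... | inj₂ (_ , _ , refl) | inj₁ (x , refl , refl) | _ | _ = ⊥-elim (no-fit-child t′ x)
  compatible-child : ∀ ρ → isTop ρ ≡ false → compatible childR ρ ≡ true × compatible ρ childR ≡ true
  compatible-child leafR _ = refl , refl
  compatible-child leftR _ = refl , refl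
  compatible-child rightR _ = refl , refl
  compatible-child derR _ = refl , refl
  compatible-child childR _ = refl , refl
  not-top : ∀ ρ {i p} → treeCount i p ≡ mark ρ → isTop ρ ≡ false
  not-top leafR e = refl
  not-top leftR e = refl
  not-top rightR e = refl
  not-top derR e = refl
  not-top childR e = refl
  not-top topR {i} {p} e = ⊥-elim (forest-no-top i p e)
  excl : ∀ ρ ρ′ {i i′ p} → treeCount i p ≡ mark ρ → treeCount i′ p ≡ mark ρ′ → compatible ρ ρ′ ≡ true
  excl ρ ρ′ {t , ρ₀} {t′ , ρ₁} {p} e e′ with count-inv ρ t ρ₀ p e | count-inv ρ′ t′ ρ₁ p e′
  ... | inj₁ (f , refl , refl) | inj₁ (f′ , refl , refl) = fits-compatible t ρ ρ′ f f′
  ... | inj₂ (_ , _ , refl) | _ = proj₁ (compatible-child ρ′ (not-top ρ′ {t′ , ρ₁} {p} e′))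
  ... | inj₁ _ | inj₂ (_ , _ , refl) = proj₂ (compatible-child ρ (not-top ρ {t , ρ₀} {p} e))

forest-axioms : ∀ rules → Axioms rules forest
forest-axioms = Forest.system-axioms forest-consistent

-- Seven is `mark topR`: a lone top cell with its point.
module Beacon = CellSystem {⊤} {⊤} (λ _ _ → yes refl) (λ _ _ → 7) (λ _ _ → ≤-refl)

beacon : PreGraph
beacon = Beacon.system

top-only : ∀ ρ → 7 ≡ mark ρ → ρ ≡ topR
top-only ρ e = sym (mark-injective topR ρ e)

beacon-consistent : Beacon.Consistent
beacon-consistent = record
  { functional = λ _ _ _ _ _ → refl
  ; exclusive = λ ρ ρ′ e e′ → subst₂ (λ a b → compatible a b ≡ true) (sym (top-only ρ e)) (sym (top-only ρ′ e′)) refl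
  ; one-sort = λ ρ t e _ → contradiction (trans (sym t) (cong isTop (top-only ρ e))) λ () }

beacon-axioms : ∀ rules → Axioms rules beacon
beacon-axioms = Beacon.system-axioms beacon-consistent

-- Evaluation of partial recursive functions as a rule system

pattern tag₁ = node leaf leaf
pattern tag₂ = node leaf tag₁
pattern tag₃ = node leaf tag₂
pattern tag₄ = node leaf tag₃
pattern tag₅ = node leaf tag₄

-- Numerals are right spines, so that `chain` can measure a number along `rightR` links.
num : ℕ → Tree
num zero = leaf
num (suc n) = node leaf (num n)

-- Rules are instantiated with arbitrary trees, and soundness must cover all instances; therefore
-- every tree denotes a number, and through `nums` a list.
spine : Tree → ℕ
spine leaf = 0
spine (node t u) = suc (spine u)
spine (der t) = 0

nums : Tree → List ℕ
nums leaf = []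
nums (node t u) = spine t ∷ nums u
nums (der t) = []

prog : ∀ {n} → PR n → Tree
progs : ∀ {m n} → Vec (PR n) m → Tree
prog zer = node leaf leaf
prog succ = node tag₁ leaf
prog (proj i) = node tag₂ (num (toℕ i))
prog (comp f gs) = node tag₃ (node (prog f) (progs gs))
prog (prec f g) = node tag₄ (node (prog f) (prog g))
prog (mu f) = node tag₅ (prog f)
progs [] = leaf
progs (g ∷ gs) = node (prog g) (progs gs)

nth : List ℕ → ℕ → Maybe ℕ
nth [] i = nothing
nth (x ∷ xs) zero = just x
nth (x ∷ xs) (suc i) = nth xs i

iterate : (List ℕ → Maybe ℕ) → (List ℕ → Maybe ℕ) → ℕ → List ℕ → Maybe ℕ
iterate φ γ zero xs = φ xs
iterate φ γ (suc k) xs = iterate φ γ k xs >>= λ r → γ (k ∷ r ∷ xs)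

search : (List ℕ → Maybe ℕ) → List ℕ → ℕ → ℕ → Maybe ℕ
search φ xs zero k = nothing
search φ xs (suc n) k with φ (k ∷ xs)
... | nothing = nothing
... | just zero = just k
... | just (suc _) = search φ xs n (suc k)

-- The fuel only bounds the unbounded search.
run : ℕ → Tree → List ℕ → Maybe ℕ
runs : ℕ → Tree → List ℕ → Maybe (List ℕ)
run N (node leaf _) xs = just 0
run N (node tag₁ _) (x ∷ []) = just (suc x)
run N (node tag₂ i) xs = nth xs (spine i)
run N (node tag₃ (node f gs)) xs = runs N gs xs >>= run N f
run N (node tag₄ (node f g)) (k ∷ xs) = iterate (run N f) (run N g) k xs
run N (node tag₅ f) xs = search (run N f) xs N 0
run N _ _ = nothing
runs N leaf xs = just []
runs N (node g gs) xs = run N g xs >>= λ y → runs N gs xs >>= λ ys → just (y ∷ ys)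
runs N (der _) xs = nothing

-- Besides exhausted fuel, `nothing` covers malformed programs and wrong numbers of arguments.
agree : Maybe ℕ → ℕ → Bool
agree nothing y = true
agree (just x) y = x ≡ᵇ y

agreeAll : Maybe (List ℕ) → List ℕ → Bool
agreeAll nothing ys = true
agreeAll (just xs) ys = does (List.≡-dec _≟ᴺ_ xs ys)

nonzero : Maybe ℕ → Bool
nonzero nothing = true
nonzero (just zero) = false
nonzero (just (suc _)) = true

positive : (List ℕ → Maybe ℕ) → List ℕ → ℕ → Bool
positive φ xs zero = true
positive φ xs (suc k) = positive φ xs k ∧ nonzero (φ (k ∷ xs))

judge : ℕ → Tree → Bool
judge N (node leaf (node p (node xs y))) = agree (run N p (nums xs)) (spine y)
judge N (node tag₁ (node gs (node xs ys))) = agreeAll (runs N gs (nums xs)) (nums ys)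
judge N (node tag₂ (node f (node xs k))) = positive (run N f) (nums xs) (spine k)
judge N _ = true

-- A claim node X leaf at the right of a derivation gives it spine 2, so spine 3 + n₀ is left to
-- the goal for the input n₀, which is declared false.
verdict : ℕ → ℕ → Tree → Bool
verdict N n₀ (node _ (node X leaf)) = judge N X
verdict N n₀ t = not (spine t ≡ᵇ 3 + n₀)

ok : ℕ → ℕ → Tree → Bool
ok N n₀ leaf = true
ok N n₀ (node t u) = ok N n₀ t ∧ ok N n₀ u
ok N n₀ (der t) = ok N n₀ t ∧ verdict N n₀ t

data Rule : Set where
  zeroᴿ succᴿ firstᴿ laterᴿ compᴿ nilᴿ consᴿ baseᴿ stepᴿ muᴿ vacuousᴿ belowᴿ goalᴿ : Rule

pattern ev p xs y = node leaf (node p (node xs y))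
pattern evs gs xs ys = node tag₁ (node gs (node xs ys))
pattern below f xs k = node tag₂ (node f (node xs k))
pattern claim X = node X leaf
-- In a rule `d` is a variable: the derivation of a premise is not inspected there, since the `der`
-- point of the premise obtained its own edge from its own rule.
pattern by d X = der (node d (claim X))
pattern v₀ = var zero
pattern v₁ = var (suc zero)
pattern v₂ = var (suc (suc zero))
pattern v₃ = var (suc (suc (suc zero)))
pattern v₄ = var (suc (suc (suc (suc zero))))
pattern v₅ = var (suc (suc (suc (suc (suc zero)))))
pattern v₆ = var (suc (suc (suc (suc (suc (suc zero))))))
pattern v₇ = var (suc (suc (suc (suc (suc (suc (suc zero)))))))

quoted : Tree → Term
quoted leaf = leaf
quoted (node t u) = node (quoted t) (quoted u)
quoted (der t) = der (quoted t)

inst-quoted : ∀ σ t → inst σ (quoted t) ≡ t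
inst-quoted σ leaf = refl
inst-quoted σ (node t u) = cong₂ node (inst-quoted σ t) (inst-quoted σ u)
inst-quoted σ (der t) = cong der (inst-quoted σ t)

-- Each rule is one tree: the derivations of the premises on the left, the conclusion on the right.
rule : Tree → Rule → Term
rule q zeroᴿ    = node leaf (claim (ev (node leaf leaf) v₀ leaf))
rule q succᴿ    = node leaf (claim (ev (node tag₁ leaf) (node v₀ leaf) (node leaf v₀)))
rule q firstᴿ   = node leaf (claim (ev (node tag₂ leaf) (node v₀ v₁) v₀))
rule q laterᴿ   = node (by v₄ (ev (node tag₂ v₀) v₁ v₂)) (claim (ev (node tag₂ (node leaf v₀)) (node v₃ v₁) v₂))
rule q compᴿ    = node (node (by v₅ (evs v₁ v₂ v₃)) (by v₆ (ev v₀ v₃ v₄)))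
                       (claim (ev (node tag₃ (node v₀ v₁)) v₂ v₄))
rule q nilᴿ     = node leaf (claim (evs leaf v₀ leaf))
rule q consᴿ    = node (node (by v₅ (ev v₀ v₂ v₃)) (by v₆ (evs v₁ v₂ v₄)))
                       (claim (evs (node v₀ v₁) v₂ (node v₃ v₄)))
rule q baseᴿ    = node (by v₄ (ev v₀ v₂ v₃)) (claim (ev (node tag₄ (node v₀ v₁)) (node leaf v₂) v₃))
rule q stepᴿ    = node (node (by v₆ (ev (node tag₄ (node v₀ v₁)) (node v₂ v₃) v₄))
                             (by v₇ (ev v₁ (node v₂ (node v₄ v₃)) v₅)))
                       (claim (ev (node tag₄ (node v₀ v₁)) (node (node leaf v₂) v₃) v₅))
rule q muᴿ      = node (node (by v₃ (ev v₀ (node v₂ v₁) leaf)) (by v₄ (below v₀ v₁ v₂)))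
                       (claim (ev (node tag₅ v₀) v₁ v₂))
rule q vacuousᴿ = node leaf (claim (below v₀ v₁ leaf))
rule q belowᴿ   = node (node (by v₄ (below v₀ v₁ v₂)) (by v₅ (ev v₀ (node v₂ v₁) (node leaf v₃))))
                       (claim (below v₀ v₁ (node leaf v₂)))
-- The two leading leaves keep the conclusion from having the shape `node X leaf` of a claim, even
-- if `v₀` is a leaf. With the outer `node` they add three to the spine of `v₀`.
rule q goalᴿ    = node (by v₁ (ev (quoted q) (node v₀ leaf) (node leaf leaf))) (node leaf (node leaf v₀))

allRules : List Rule
allRules =
  zeroᴿ ∷ succᴿ ∷ firstᴿ ∷ laterᴿ ∷ compᴿ ∷ nilᴿ ∷ consᴿ ∷ baseᴿ ∷ stepᴿ ∷ muᴿ ∷ vacuousᴿ ∷ belowᴿ ∷ goalᴿ ∷ []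

rules : Tree → List Term
rules q = map (rule q) allRules

∈-rules : ∀ q r → rule q r ∈ rules q
∈-rules q r = ∈-map⁺ (rule q) {xs = allRules} (at r)
  where
  at : ∀ r → r ∈ allRules
  at zeroᴿ = here refl
  at succᴿ = there (here refl)
  at firstᴿ = there (there (here refl))
  at laterᴿ = there (there (there (here refl)))
  at compᴿ = there (there (there (there (here refl))))
  at nilᴿ = there (there (there (there (there (here refl)))))
  at consᴿ = there (there (there (there (there (there (here refl))))))
  at baseᴿ = there (there (there (there (there (there (there (here refl)))))))
  at stepᴿ = there (there (there (there (there (there (there (there (here refl))))))))
  at muᴿ = there (there (there (there (there (there (there (there (there (here refl)))))))))
  at vacuousᴿ = there (there (there (there (there (there (there (there (there (there (here refl))))))))))
  at belowᴿ = there (there (there (there (there (there (there (there (there (there (there (here refl)))))))))))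
  at goalᴿ = there (there (there (there (there (there (there (there (there (there (there (there (here refl))))))))))))

rules⁻ : ∀ q {p} → p ∈ rules q → Σ Rule λ r → p ≡ rule q r
rules⁻ q p∈ with ∈-map⁻ (rule q) {xs = allRules} p∈
... | r , _ , e = r , e

-- Soundness of the rules at a fixed fuel

≡ᵇ-refl : ∀ n → (n ≡ᵇ n) ≡ true
≡ᵇ-refl zero = refl
≡ᵇ-refl (suc n) = ≡ᵇ-refl n

true-≡ᵇ : ∀ {m n} → (m ≡ᵇ n) ≡ true → m ≡ n
true-≡ᵇ {m} {n} p = ≡ᵇ⇒≡ m n (subst T (sym p) tt)

agree-if : ∀ m {y} → (∀ {x} → m ≡ just x → x ≡ y) → agree m y ≡ true
agree-if nothing h = refl
agree-if (just x) h with h refl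
... | refl = ≡ᵇ-refl x

agree-bind : ∀ m (f : ℕ → Maybe ℕ) x {y} → agree m x ≡ true → agree (f x) y ≡ true → agree (m >>= f) y ≡ true
agree-bind nothing f x p q = refl
agree-bind (just z) f x p q with true-≡ᵇ {z} p
... | refl = q

agreeAll-bind : ∀ m (f : List ℕ → Maybe ℕ) xs {y} → agreeAll m xs ≡ true → agree (f xs) y ≡ true →
                agree (m >>= f) y ≡ true
agreeAll-bind nothing f xs p q = refl
agreeAll-bind (just zs) f xs p q with does-true (List.≡-dec _≟ᴺ_ zs xs) p
... | refl = q

agreeAll-∷ : ∀ m ms y ys → agree m y ≡ true → agreeAll ms ys ≡ true →
             agreeAll (m >>= λ x → ms >>= λ xs → just (x ∷ xs)) (y ∷ ys) ≡ true
agreeAll-∷ nothing ms y ys p q = refl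
agreeAll-∷ (just x) nothing y ys p q = refl
agreeAll-∷ (just x) (just xs) y ys p q =
  true-does (List.≡-dec _≟ᴺ_ (x ∷ xs) (y ∷ ys)) (cong₂ _∷_ (true-≡ᵇ {x} p) (does-true (List.≡-dec _≟ᴺ_ xs ys) q))

search-zero : ∀ φ xs n k {m} → search φ xs n k ≡ just m → φ (m ∷ xs) ≡ just 0
search-zero φ xs (suc n) k e with φ (k ∷ xs) in eq
search-zero φ xs (suc n) k refl | just zero = eq
... | just (suc _) = search-zero φ xs n (suc k) e

search-positive : ∀ φ xs n k {m} → search φ xs n k ≡ just m → ∀ j → k ≤ j → j < m → ∃ λ w → φ (j ∷ xs) ≡ just (suc w)
search-positive φ xs (suc n) k e j k≤j j<m with φ (k ∷ xs) in eq
search-positive φ xs (suc n) k refl j k≤j j<m | just zero = contradiction (≤-trans j<m k≤j) (n≮n _)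
... | just (suc w) with m≤n⇒m<n∨m≡n k≤j
...   | inj₁ k<j = search-positive φ xs n (suc k) e j k<j j<m
...   | inj₂ refl = w , eq

positive-nonzero : ∀ φ xs k → positive φ xs k ≡ true → ∀ j → j < k → nonzero (φ (j ∷ xs)) ≡ true
positive-nonzero φ xs (suc k) p j (s≤s j≤k) with ∧-true {positive φ xs k} p | m≤n⇒m<n∨m≡n j≤k
... | q , r | inj₁ j<k = positive-nonzero φ xs k q j j<k
... | q , r | inj₂ refl = r

nonzero-agree : ∀ m {w} → agree m (suc w) ≡ true → nonzero m ≡ true
nonzero-agree nothing p = refl
nonzero-agree (just (suc _)) p = refl

-- A result below `k` would be a zero where `positive` excludes one; a result above `k` means that
-- the search passed `k` with a nonzero value. An undefined search agrees with anything.
search-agree : ∀ φ xs N k → agree (φ (k ∷ xs)) 0 ≡ true → positive φ xs k ≡ true → agree (search φ xs N 0) k ≡ true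
search-agree φ xs N k a p = agree-if (search φ xs N 0) unique
  where
  unique : ∀ {m} → search φ xs N 0 ≡ just m → m ≡ k
  unique {m} e with <-cmp m k
  ... | tri≈ _ q _ = q
  ... | tri< m<k _ _ =
    contradiction (trans (sym (positive-nonzero φ xs k p m m<k)) (cong nonzero (search-zero φ xs N 0 e))) λ ()
  ... | tri> _ _ k<m with search-positive φ xs N 0 e k z≤n k<m
  ...   | w , q = contradiction (trans (sym a) (cong (λ r → agree r 0) q)) λ ()

not-spine : ∀ {m n} → m ≢ n → not (m ≡ᵇ n) ≡ true
not-spine {m} {n} h with m ≡ᵇ n in e
... | true = ⊥-elim (h (true-≡ᵇ e))
... | false = refl

-- Other shapes are sent to `leaf`, whose verdict is true, so that the verdict of a premise is
-- available uniformly for all trees.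
only-premise : Tree → Tree
only-premise (node (der t) c) = t
only-premise _ = leaf

left-premise : Tree → Tree
left-premise (node (node (der t) (der u)) c) = t
left-premise _ = leaf

right-premise : Tree → Tree
right-premise (node (node (der t) (der u)) c) = u
right-premise _ = leaf

module _ (N n₀ : ℕ) where
  ok-verdict : ∀ t → ok N n₀ (der t) ≡ true → verdict N n₀ t ≡ true
  ok-verdict t p = proj₂ (∧-true {ok N n₀ t} p)

  ok-left : ∀ t u → ok N n₀ (node t u) ≡ true → ok N n₀ t ≡ true
  ok-left t u p = proj₁ (∧-true p)

  ok-right : ∀ t u → ok N n₀ (node t u) ≡ true → ok N n₀ u ≡ true
  ok-right t u p = proj₂ (∧-true {ok N n₀ t} p)

  only-verdict : ∀ w → ok N n₀ w ≡ true → verdict N n₀ (only-premise w) ≡ true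
  only-verdict leaf p = refl
  only-verdict (der _) p = refl
  only-verdict (node leaf c) p = refl
  only-verdict (node (node _ _) c) p = refl
  only-verdict (node (der t) c) p = ok-verdict t (ok-left (der t) c p)

  both-verdicts : ∀ w → ok N n₀ w ≡ true →
                  verdict N n₀ (left-premise w) ≡ true × verdict N n₀ (right-premise w) ≡ true
  both-verdicts (node (node (der t) (der u)) c) p =
    ok-verdict t (ok-left (der t) (der u) q) , ok-verdict u (ok-right (der t) (der u) q)
    where q = ok-left (node (der t) (der u)) c p
  both-verdicts leaf p = refl , refl
  both-verdicts (der _) p = refl , refl
  both-verdicts (node leaf c) p = refl , refl
  both-verdicts (node (der _) c) p = refl , refl
  both-verdicts (node (node leaf _) c) p = refl , refl
  both-verdicts (node (node (node _ _) _) c) p = refl , refl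
  both-verdicts (node (node (der _) leaf) c) p = refl , refl
  both-verdicts (node (node (der _) (node _ _)) c) p = refl , refl

  -- Each evaluation rule restates a clause of the interpreter at fuel `N`. The known value of the
  -- run on `n₀` enters at `goalᴿ`.
  rule-sound : ∀ q → run N q (n₀ ∷ []) ≡ just 0 → ∀ r σ →
               ok N n₀ (inst σ (rule q r)) ≡ true → verdict N n₀ (inst σ (rule q r)) ≡ true
  rule-sound q h zeroᴿ σ p = refl
  rule-sound q h succᴿ σ p = ≡ᵇ-refl (spine (σ zero))
  rule-sound q h firstᴿ σ p = ≡ᵇ-refl (spine (σ zero))
  rule-sound q h laterᴿ σ p = only-verdict (inst σ (rule q laterᴿ)) p
  rule-sound q h compᴿ σ p with both-verdicts (inst σ (rule q compᴿ)) p
  ... | a , b = agreeAll-bind (runs N (σ (# 1)) (nums (σ (# 2)))) (run N (σ zero)) (nums (σ (# 3))) a b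
  rule-sound q h nilᴿ σ p = refl
  rule-sound q h consᴿ σ p with both-verdicts (inst σ (rule q consᴿ)) p
  ... | a , b = agreeAll-∷ (run N (σ zero) (nums (σ (# 2)))) (runs N (σ (# 1)) (nums (σ (# 2)))) _ _ a b
  rule-sound q h baseᴿ σ p = only-verdict (inst σ (rule q baseᴿ)) p
  rule-sound q h stepᴿ σ p with both-verdicts (inst σ (rule q stepᴿ)) p
  ... | a , b = 
    agree-bind (iterate (run N (σ zero)) (run N (σ (# 1))) (spine (σ (# 2))) (nums (σ (# 3))))
               (λ r → run N (σ (# 1)) (spine (σ (# 2)) ∷ r ∷ nums (σ (# 3)))) (spine (σ (# 4))) a b
  rule-sound q h muᴿ σ p with both-verdicts (inst σ (rule q muᴿ)) p
  ... | a , b = search-agree (run N (σ zero)) (nums (σ (# 1))) N (spine (σ (# 2))) a b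
  rule-sound q h vacuousᴿ σ p = refl
  rule-sound q h belowᴿ σ p with both-verdicts (inst σ (rule q belowᴿ)) p
  ... | a , b = cong₂ _∧_ a (nonzero-agree (run N (σ zero) _) b)
  -- With spine 3 + n₀ the variable `v₀` denotes `n₀`, and the premise claims the value 1 where the
  -- run gives 0.
  rule-sound q h goalᴿ σ p = not-spine λ e →
    contradiction (trans (sym (cong (λ m → agree m 1) h)) (subst₂ (λ f n → agree (run N f (n ∷ [])) 1 ≡ true) (inst-quoted σ q) e premise))
                  λ ()
    where
    premise = only-verdict (inst σ (rule q goalᴿ)) p

  ok-sound : ∀ q → run N q (n₀ ∷ []) ≡ just 0 → Sound (rules q) (ok N n₀)
  ok-sound q h = record
    { ok-leaf = refl
    ; ok-node = cong₂ _∧_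
    ; ok-der = λ {p} p∈ σ k → cong₂ _∧_ k (by-rule p∈ σ k) }
    where
    by-rule : ∀ {p} → p ∈ rules q → ∀ σ → ok N n₀ (inst σ p) ≡ true → verdict N n₀ (inst σ p) ≡ true
    by-rule p∈ σ k with rules⁻ q p∈
    ... | r , refl = rule-sound q h r σ k

  verdict-spine : ∀ t → verdict N n₀ t ≡ true → spine t ≢ 3 + n₀
  verdict-spine (node _ (node X leaf)) v ()
  verdict-spine leaf v ()
  verdict-spine (der _) v ()
  verdict-spine (node _ leaf) v ()
  verdict-spine (node _ (der _)) v ()
  verdict-spine (node _ (node _ (der _))) v ()
  verdict-spine (node _ (node _ (node _ u))) v refl = true≢false v (cong not (≡ᵇ-refl (spine u)))

-- Derivations of true evaluations

data Good (q : Tree) : Tree → Set where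
  g-leaf : Good q leaf
  g-node : ∀ {t u} → Good q t → Good q u → Good q (node t u)
  g-der  : ∀ r σ → Good q (inst σ (rule q r)) → Good q (der (inst σ (rule q r)))

_⊢_ : Tree → Tree → Set
q ⊢ X = Σ Tree λ d → Good q (by d X)

args : ∀ {n} → Vec ℕ n → Tree
args [] = leaf
args (x ∷ xs) = node (num x) (args xs)

module _ {q : Tree} where
  good-num : ∀ n → Good q (num n)
  good-num zero = g-leaf
  good-num (suc n) = g-node g-leaf (good-num n)

  good-args : ∀ {n} (xs : Vec ℕ n) → Good q (args xs)
  good-args [] = g-leaf
  good-args (x ∷ xs) = g-node (good-num x) (good-args xs)

  good-prog : ∀ {n} (p : PR n) → Good q (prog p)
  good-progs : ∀ {m n} (gs : Vec (PR n) m) → Good q (progs gs)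
  good-prog zer = g-node g-leaf g-leaf
  good-prog succ = g-node (good-num 1) g-leaf
  good-prog (proj i) = g-node (good-num 2) (good-num (toℕ i))
  good-prog (comp f gs) = g-node (good-num 3) (g-node (good-prog f) (good-progs gs))
  good-prog (prec f g) = g-node (good-num 4) (g-node (good-prog f) (good-prog g))
  good-prog (mu f) = g-node (good-num 5) (good-prog f)
  good-progs [] = g-leaf
  good-progs (g ∷ gs) = g-node (good-prog g) (good-progs gs)

  good-claim : ∀ tag {p xs y} → Good q p → Good q xs → Good q y → Good q (claim (node (num tag) (node p (node xs y))))
  good-claim tag p xs y = g-node (g-node (good-num tag) (g-node p (g-node xs y))) g-leaf

  assign : Vec Tree 8 → Fin 8 → Tree
  assign = lookup

  derive-proj : ∀ {n} (i : Fin n) xs → q ⊢ ev (prog (proj i)) (args xs) (num (lookupV xs i))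
  derive-proj zero (x ∷ xs) =
    leaf , g-der firstᴿ (assign (num x ∷ args xs ∷ leaf ∷ leaf ∷ leaf ∷ leaf ∷ leaf ∷ leaf ∷ []))
      (g-node g-leaf (good-claim 0 (good-prog {1} (proj zero)) (good-args (x ∷ xs)) (good-num x)))
  derive-proj (suc i) (x ∷ xs) with derive-proj i xs
  ... | d , g = _ , g-der laterᴿ
      (assign (num (toℕ i) ∷ args xs ∷ num (lookupV xs i) ∷ num x ∷ d ∷ leaf ∷ leaf ∷ leaf ∷ []))
      (g-node g (good-claim 0 (good-prog (proj (suc i))) (good-args (x ∷ xs)) (good-num (lookupV xs i))))

  derive : ∀ {n} {p : PR n} {xs v} → Eval p xs v → q ⊢ ev (prog p) (args xs) (num v)
  deriveAll : ∀ {m n} {gs : Vec (PR n) m} {xs ys} → EvalAll gs xs ys → q ⊢ evs (progs gs) (args xs) (args ys)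
  -- The derivations for smaller arguments come as a function, so that `derive` stays structural on
  -- the evaluation while this recursion runs on `k`.
  derive-below : ∀ {n} (f : PR (suc n)) xs k → (∀ j → j < k → Σ ℕ λ w → Eval f (j ∷ xs) (suc w)) →
                 (∀ j → (j<k : j < k) → Σ ℕ λ w → q ⊢ ev (prog f) (args (j ∷ xs)) (num (suc w))) →
                 q ⊢ below (prog f) (args xs) (num k)
  derive (e-zer {xs = xs}) =
    leaf , g-der zeroᴿ (assign (args xs ∷ leaf ∷ leaf ∷ leaf ∷ leaf ∷ leaf ∷ leaf ∷ leaf ∷ []))
      (g-node g-leaf (good-claim 0 (good-prog {0} zer) (good-args xs) g-leaf))
  derive (e-succ {x}) =
    leaf , g-der succᴿ (assign (num x ∷ leaf ∷ leaf ∷ leaf ∷ leaf ∷ leaf ∷ leaf ∷ leaf ∷ []))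
      (g-node g-leaf (good-claim 0 (good-prog succ) (good-args (x ∷ [])) (good-num (suc x))))
  derive (e-proj {xs = xs} i) = derive-proj i xs
  derive (e-comp {f = f} {gs} {xs} {ys} {v} es e) with deriveAll es | derive e
  ... | d , g | d′ , g′ = _ , g-der compᴿ
      (assign (prog f ∷ progs gs ∷ args xs ∷ args ys ∷ num v ∷ d ∷ d′ ∷ leaf ∷ []))
      (g-node (g-node g g′) (good-claim 0 (good-prog (comp f gs)) (good-args xs) (good-num v)))
  derive (e-prec0 {f = f} {g} {xs} {v} e) with derive e
  ... | d , h = _ , g-der baseᴿ
      (assign (prog f ∷ prog g ∷ args xs ∷ num v ∷ d ∷ leaf ∷ leaf ∷ leaf ∷ []))
      (g-node h (good-claim 0 (good-prog (prec f g)) (good-args (0 ∷ xs)) (good-num v)))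
  derive (e-precS {f = f} {g} {k} {xs} {r} {v} e e′) with derive e | derive e′
  ... | d , h | d′ , h′ = _ , g-der stepᴿ
      (assign (prog f ∷ prog g ∷ num k ∷ args xs ∷ num r ∷ num v ∷ d ∷ d′ ∷ []))
      (g-node (g-node h h′) (good-claim 0 (good-prog (prec f g)) (good-args (suc k ∷ xs)) (good-num v)))
  derive (e-mu {f = f} {xs} {k} e es)
    with derive e | derive-below f xs k es (λ j j<k → proj₁ (es j j<k) , derive (proj₂ (es j j<k)))
  ... | d , h | d′ , h′ = _ , g-der muᴿ
      (assign (prog f ∷ args xs ∷ num k ∷ d ∷ d′ ∷ leaf ∷ leaf ∷ leaf ∷ []))
      (g-node (g-node h h′) (good-claim 0 (good-prog (mu f)) (good-args xs) (good-num k)))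
  deriveAll (ea-[] {xs = xs}) =
    leaf , g-der nilᴿ (assign (args xs ∷ leaf ∷ leaf ∷ leaf ∷ leaf ∷ leaf ∷ leaf ∷ leaf ∷ []))
      (g-node g-leaf (good-claim 1 g-leaf (good-args xs) g-leaf))
  deriveAll (ea-∷ {g = g} {gs} {xs} {y} {ys} e es) with derive e | deriveAll es
  ... | d , h | d′ , h′ = _ , g-der consᴿ
      (assign (prog g ∷ progs gs ∷ args xs ∷ num y ∷ args ys ∷ d ∷ d′ ∷ leaf ∷ []))
      (g-node (g-node h h′) (good-claim 1 (good-progs (g ∷ gs)) (good-args xs) (good-args (y ∷ ys))))
  derive-below f xs zero es ds =
    leaf , g-der vacuousᴿ (assign (prog f ∷ args xs ∷ leaf ∷ leaf ∷ leaf ∷ leaf ∷ leaf ∷ leaf ∷ []))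
      (g-node g-leaf (good-claim 2 (good-prog f) (good-args xs) g-leaf))
  derive-below f xs (suc k) es ds
    with derive-below f xs k (λ j j<k → es j (m≤n⇒m≤1+n j<k)) (λ j j<k → ds j (m≤n⇒m≤1+n j<k)) | ds k (n<1+n k)
  ... | d , h | w , d′ , h′ = _ , g-der belowᴿ
      (assign (prog f ∷ args xs ∷ num k ∷ num w ∷ d ∷ d′ ∷ leaf ∷ leaf ∷ []))
      (g-node (g-node h h′) (good-claim 2 (good-prog f) (good-args xs) (good-num (suc k))))

derive-goal : ∀ (p : PR 1) {n} → Eval p (n ∷ []) 1 →
              Σ Tree λ d → Good (prog p) (der (node d (node leaf (node leaf (num n)))))
derive-goal p {n} e with derive {q = prog p} e
... | d , h = _ , g-der goalᴿ σ
    (g-node (subst (λ t → Good (prog p) (by d (ev t (args (n ∷ [])) (num 1)))) (sym (inst-quoted σ (prog p))) h)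
            (g-node g-leaf (g-node g-leaf (good-num n))))
  where
  σ : Fin 8 → Tree
  σ = lookup (num n ∷ d ∷ leaf ∷ leaf ∷ leaf ∷ leaf ∷ leaf ∷ leaf ∷ [])

spine-num : ∀ n → spine (num n) ≡ n
spine-num zero = refl
spine-num (suc n) = cong suc (spine-num n)

-- Subcomputations need different fuels. Properties of all large fuels are closed under finite
-- conjunction, which replaces an argument that `run` is monotone in its fuel.
Eventually : (ℕ → Set) → Set
Eventually P = Σ ℕ λ N₀ → ∀ N → N₀ ≤ N → P N

eventually-both : ∀ {P Q : ℕ → Set} → Eventually P → Eventually Q → Eventually (λ N → P N × Q N)
eventually-both (N , p) (N′ , q) =
  N ⊔ N′ , λ M h → p M (≤-trans (m≤m⊔n N N′) h) , q M (≤-trans (m≤n⊔m N N′) h)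

eventually-all : ∀ k {P : ℕ → ℕ → Set} → (∀ j → j < k → Eventually (P j)) → Eventually (λ N → ∀ j → j < k → P j N)
eventually-all zero h = 0 , λ _ _ j ()
eventually-all (suc k) {P} h
  with eventually-both (eventually-all k {P} (λ j j<k → h j (m≤n⇒m≤1+n j<k))) (h k (n<1+n k))
... | N₀ , g = N₀ , λ N N₀≤N j j<1+k → pick (g N N₀≤N) j<1+k
  where
  pick : ∀ {N j} → (∀ j → j < k → P j N) × P k N → j < suc k → P j N
  pick (a , b) (s≤s j≤k) with m≤n⇒m<n∨m≡n j≤k
  ... | inj₁ j<k = a _ j<k
  ... | inj₂ refl = b

search-finds : ∀ φ xs n k m → (∀ j → j < m → Σ ℕ λ w → φ (j ∷ xs) ≡ just (suc w)) → φ (m ∷ xs) ≡ just 0 →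
               k ≤ m → m < k + n → search φ xs n k ≡ just m
search-finds φ xs zero k m h z k≤m l = contradiction (≤-<-trans k≤m (subst (m <_) (+-identityʳ k) l)) (n≮n k)
search-finds φ xs (suc n) k m h z k≤m l with m≤n⇒m<n∨m≡n k≤m
... | inj₂ refl rewrite z = refl
... | inj₁ k<m with h k k<m
...   | w , e rewrite e = search-finds φ xs n (suc k) m h z k<m (subst (m <_) (+-suc k n) l)

nth-lookup : ∀ {n} (i : Fin n) xs → nth (toList xs) (spine (num (toℕ i))) ≡ just (lookupV xs i)
nth-lookup zero (x ∷ xs) = refl
nth-lookup (suc i) (x ∷ xs) = nth-lookup i xs

eval-run : ∀ {n} {p : PR n} {xs v} → Eval p xs v → Eventually λ N → run N (prog p) (toList xs) ≡ just v
eval-runs : ∀ {m n} {gs : Vec (PR n) m} {xs ys} → EvalAll gs xs ys →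
            Eventually λ N → runs N (progs gs) (toList xs) ≡ just (toList ys)
eval-run e-zer = 0 , λ _ _ → refl
eval-run e-succ = 0 , λ _ _ → refl
eval-run (e-proj {xs = xs} i) = 0 , λ _ _ → nth-lookup i xs
eval-run (e-comp {f = f} es e) with eventually-both (eval-runs es) (eval-run e)
... | N₀ , h = N₀ , λ N l → trans (cong (_>>= run N (prog f)) (proj₁ (h N l))) (proj₂ (h N l))
eval-run (e-prec0 e) = eval-run e
eval-run (e-precS e e′) with eventually-both (eval-run e) (eval-run e′)
... | N₀ , h = N₀ , λ N l → trans (cong (_>>= _) (proj₁ (h N l))) (proj₂ (h N l))
eval-run (e-mu {f = f} {xs} {k} e es)
  with eventually-both (eval-run e) (eventually-both {Q = λ N → k < N}
         (eventually-all k {λ j N → Σ ℕ λ w → run N (prog f) (j ∷ toList xs) ≡ just (suc w)}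
            λ j j<k → let (N₀ , h) = eval-run (proj₂ (es j j<k)) in N₀ , λ N l → proj₁ (es j j<k) , h N l)
         -- The search tries the `N` arguments starting at 0, so reaching `k` takes fuel above `k`.
         (suc k , λ N l → l))
... | N₀ , h = N₀ , λ N l → let (z , w , k<N) = h N l in
                            search-finds (run N (prog f)) (toList xs) N 0 k w z z≤n k<N
eval-runs ea-[] = 0 , λ _ _ → refl
eval-runs (ea-∷ {g = g} {gs} e es) with eventually-both (eval-run e) (eval-runs es)
... | N₀ , h = N₀ , λ N l → trans (cong (_>>= _) (proj₁ (h N l))) (cong (_>>= _) (proj₂ (h N l)))

-- The chain

-- Division by ten, the size of a block of nine cell vertices and a point, in a form that primitive
-- recursion computes verbatim.
remainder quotient : ℕ → ℕ
remainder zero = 0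
remainder (suc v) = if remainder v ≡ᵇ 9 then 0 else suc (remainder v)
quotient zero = 0
quotient (suc v) = if remainder v ≡ᵇ 9 then suc (quotient v) else quotient v

≢⇒≡ᵇ-false : ∀ {m n} → m ≢ n → (m ≡ᵇ n) ≡ false
≢⇒≡ᵇ-false {m} {n} h = ≢true⇒≡false λ p → h (true-≡ᵇ p)

split-digits : ∀ i r → r < 10 → remainder (r + i * 10) ≡ r × quotient (r + i * 10) ≡ i
split-digits zero zero _ = refl , refl
split-digits (suc i) zero _ with split-digits i 9 (n<1+n 9)
... | p , q rewrite p | q = refl , refl
split-digits i (suc r) (s≤s r<9) with split-digits i r (m≤n⇒m≤1+n r<9)
... | p , q rewrite p | q | ≢⇒≡ᵇ-false (<⇒≢ r<9) = refl , refl

join-digits : ∀ v → remainder v + quotient v * 10 ≡ v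
join-digits zero = refl
join-digits (suc v) with remainder v ≡ᵇ 9 in e
... | true = trans (cong (λ r → suc (r + quotient v * 10)) (sym (true-≡ᵇ {remainder v} e))) (cong suc (join-digits v))
... | false = cong suc (join-digits v)

remainder<10 : ∀ v → remainder v < 10
remainder<10 zero = s≤s z≤n
remainder<10 (suc v) with remainder v ≡ᵇ 9 in e
... | true = s≤s z≤n
... | false with m≤n⇒m<n∨m≡n (remainder<10 v)
...   | inj₁ l = l
...   | inj₂ p = contradiction (trans (sym e) (trans (cong (_≡ᵇ 9) (suc-injective p)) refl)) λ ()

-- The values are the marks of `topR`, `leafR`, `derR` and `rightR`.
own-mark : ℕ → ℕ → ℕ
own-mark ℓ i = if i ≡ᵇ 0 then 7 else if i ≡ᵇ 1 then 2 else if i ≡ᵇ 2 + ℓ then 5 else 4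

-- How many vertices of cell `i` the point of block `j` sees. Six is `mark childR`: each block has
-- the previous one as child, except that block 1 is a leaf and the top point is nobody's child.
attach : ℕ → ℕ → ℕ → ℕ
attach ℓ i j = if i ≡ᵇ j then own-mark ℓ i else if i ≡ᵇ suc j then (if j ≡ᵇ 0 then 0 else 6) else 0

-- The top point sees every other point: subtrees of a good tree are good, so a common extension has
-- all these edges and not just the one at the root.
pointAdj : ℕ → ℕ → Bool
pointAdj i j = if i ≡ᵇ 0 then not (j ≡ᵇ 0) else (j ≡ᵇ 0)

cellAdj : ℕ → ℕ → ℕ → ℕ → Bool
cellAdj i r j s = if i ≡ᵇ j then not (r ≡ᵇ s) else false

-- Block 0 is a top cell with its point, block i + 1 the cell and the point of the i-th tree of the
-- chain; in every block the vertex numbered 9 is the point.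
blockAdj : ℕ → ℕ → ℕ → ℕ → ℕ → Bool
blockAdj ℓ i r j s =
  if r <ᵇ 9 then (if s <ᵇ 9 then cellAdj i r j s else (r <ᵇ attach ℓ i j))
            else (if s <ᵇ 9 then (s <ᵇ attach ℓ j i) else pointAdj i j)

linkAdj : ℕ → ℕ → ℕ → Bool
linkAdj ℓ u v = blockAdj ℓ (quotient u) (remainder u) (quotient v) (remainder v)

≡ᵇ-sym : ∀ m n → (m ≡ᵇ n) ≡ (n ≡ᵇ m)
≡ᵇ-sym zero zero = refl
≡ᵇ-sym zero (suc n) = refl
≡ᵇ-sym (suc m) zero = refl
≡ᵇ-sym (suc m) (suc n) = ≡ᵇ-sym m n

pointAdj-sym : ∀ i j → pointAdj i j ≡ pointAdj j i
pointAdj-sym zero zero = refl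
pointAdj-sym zero (suc j) = refl
pointAdj-sym (suc i) zero = refl
pointAdj-sym (suc i) (suc j) = refl

blockAdj-sym : ∀ ℓ i r j s → blockAdj ℓ i r j s ≡ blockAdj ℓ j s i r
blockAdj-sym ℓ i r j s with r <ᵇ 9 | s <ᵇ 9
... | true | true = cong₂ (λ a b → if a then not b else false) (≡ᵇ-sym i j) (≡ᵇ-sym r s)
... | true | false = refl
... | false | true = refl
... | false | false = pointAdj-sym i j

blockAdj-irrefl : ∀ ℓ i r → blockAdj ℓ i r i r ≡ false
blockAdj-irrefl ℓ i r with r <ᵇ 9
... | true rewrite ≡ᵇ-refl i | ≡ᵇ-refl r = refl
blockAdj-irrefl ℓ zero r | false = refl
blockAdj-irrefl ℓ (suc i) r | false = refl

-- Block 1 + k carries the subtree of spine k, for k up to `ℓ`, and block 2 + ℓ the `der` point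
-- above; with the top block this makes 3 + ℓ. Left children are left out, since only the length of
-- the spine is to be tested.
chain : ℕ → Graph
chain ℓ = record
  { size = (3 + ℓ) * 10
  ; adj = λ u v → linkAdj ℓ (toℕ u) (toℕ v)
  ; sym = λ u v → blockAdj-sym ℓ (quotient (toℕ u)) (remainder (toℕ u)) (quotient (toℕ v)) (remainder (toℕ v))
  ; irrefl = λ u → blockAdj-irrefl ℓ (quotient (toℕ u)) (remainder (toℕ u)) }

own-right : ∀ {ℓ k} → k < ℓ → own-mark ℓ (2 + k) ≡ 4
own-right k<ℓ rewrite ≢⇒≡ᵇ-false (<⇒≢ k<ℓ) = refl

own-der : ∀ ℓ → own-mark ℓ (2 + ℓ) ≡ 5
own-der ℓ rewrite ≡ᵇ-refl ℓ = refl

attach-own : ∀ ℓ i → attach ℓ i i ≡ own-mark ℓ i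
attach-own ℓ i rewrite ≡ᵇ-refl i = refl

attach-child : ∀ ℓ k → attach ℓ (2 + k) (1 + k) ≡ 6
attach-child ℓ k rewrite ≢⇒≡ᵇ-false {suc k} {k} (λ ()) | ≡ᵇ-refl k = refl

quotient-bound : ∀ ℓ v → v < (3 + ℓ) * 10 → quotient v < 3 + ℓ
quotient-bound ℓ v h with quotient v <? 3 + ℓ
... | yes p = p
... | no n = contradiction (≤-trans h (≤-trans (*-monoˡ-≤ 10 (≮⇒≥ n))
                             (≤-trans (m≤n+m _ (remainder v)) (subst (_≤ v) (sym (join-digits v)) ≤-refl)))) (n≮n v)
  where open import Data.Nat.Properties using (n≮n)

module _ (ℓ : ℕ) where
  block-bound : ∀ {i r} → i < 3 + ℓ → r < 10 → r + i * 10 < (3 + ℓ) * 10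
  block-bound {i} {r} i< r< = ≤-trans (+-mono-<-≤ r< (≤-refl {i * 10})) (*-monoˡ-≤ 10 i<)

  at : ∀ {i r} → i < 3 + ℓ → r < 10 → Fin (size (chain ℓ))
  at i< r< = fromℕ< (block-bound i< r<)

  at-adj : ∀ {i r j s} (i< : i < 3 + ℓ) (r< : r < 10) (j< : j < 3 + ℓ) (s< : s < 10) →
           adj (chain ℓ) (at i< r<) (at j< s<) ≡ blockAdj ℓ i r j s
  at-adj {i} {r} {j} {s} i< r< j< s<
    rewrite toℕ-fromℕ< (block-bound i< r<) | toℕ-fromℕ< (block-bound j< s<)
          | proj₁ (split-digits i r r<) | proj₂ (split-digits i r r<)
          | proj₁ (split-digits j s s<) | proj₂ (split-digits j s s<) = refl

  assemble : ∀ {Q} (pv : ℕ → ℕ → Vertex Q) →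
             (∀ {i r j s} → i < 3 + ℓ → r < 10 → j < 3 + ℓ → s < 10 → adjacent Q (pv i r) (pv j s) ≡ blockAdj ℓ i r j s) →
             (∀ {i r j s} → i < 3 + ℓ → r < 10 → j < 3 + ℓ → s < 10 → pv i r ≡ pv j s → i ≡ j × r ≡ s) →
             pre (chain ℓ) ⊑ Q
  assemble {Q} pv pv-adj pv-inj = record
    { to = λ v → pv (quotient (toℕ v)) (remainder (toℕ v))
    ; to-injective = λ {u} {v} e →
        let (p , q) = pv-inj (bound u) (remainder<10 (toℕ u)) (bound v) (remainder<10 (toℕ v)) e in
        toℕ-injective (trans (sym (join-digits (toℕ u))) (trans (cong₂ (λ a b → a + b * 10) q p) (join-digits (toℕ v))))
    ; to-adjacent = λ u v → pv-adj (bound u) (remainder<10 (toℕ u)) (bound v) (remainder<10 (toℕ v)) }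
    where
    bound : ∀ v → quotient (toℕ v) < 3 + ℓ
    bound v = quotient-bound ℓ (toℕ v) (toℕ<n v)

  below-ten : ∀ (r : Fin 9) → toℕ r < 10
  below-ten r = m≤n⇒m≤1+n (toℕ<n r)

  module Extract {Q : PreGraph} (f : pre (chain ℓ) ⊑ Q) where
    cellAt : ∀ {i} → i < 3 + ℓ → Cell Q
    cellAt i< = tabulate λ r → to f (at i< (below-ten r))

    pointAt : ∀ {i} → i < 3 + ℓ → Vertex Q
    pointAt i< = to f (at i< ≤-refl)

    lookup-cell : ∀ {i} (i< : i < 3 + ℓ) r → lookup (cellAt i<) r ≡ to f (at i< (below-ten r))
    lookup-cell i< r = lookup∘tabulate (λ r → to f (at i< (below-ten r))) r

    abstract
      cell-clique : ∀ {i} (i< : i < 3 + ℓ) → IsClique Q (cellAt i<)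
      cell-clique {i} i< r s =
        trans (cong₂ (adjacent Q) (lookup-cell i< r) (lookup-cell i< s))
        (trans (to-adjacent f _ _) (trans (at-adj i< (below-ten r) i< (below-ten s)) value))
        where
        value : blockAdj ℓ i (toℕ r) i (toℕ s) ≡ not ⌊ r ≟ᶠ s ⌋
        value rewrite <ᵇ-true (toℕ<n r) | <ᵇ-true (toℕ<n s) | ≡ᵇ-refl i with r ≟ᶠ s
        ... | yes refl rewrite ≡ᵇ-refl (toℕ r) = refl
        ... | no n rewrite ≢⇒≡ᵇ-false {toℕ r} {toℕ s} (λ e → n (toℕ-injective e)) = refl

      cell-attached : ∀ ρ {i j} (i< : i < 3 + ℓ) (j< : j < 3 + ℓ) → attach ℓ i j ≡ mark ρ →
                      Attached Q ρ (cellAt i<) (pointAt j<)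
      cell-attached ρ {i} {j} i< j< e r =
        trans (cong (λ v → adjacent Q v (pointAt j<)) (lookup-cell i< r))
        (trans (to-adjacent f _ _) (trans (at-adj i< (below-ten r) j< ≤-refl) value))
        where
        value : blockAdj ℓ i (toℕ r) j 9 ≡ (toℕ r <ᵇ mark ρ)
        value rewrite <ᵇ-true (toℕ<n r) | e = refl

      has-point-at : ∀ ρ {i} (i< : i < 3 + ℓ) → own-mark ℓ i ≡ mark ρ → Has Q ρ (pointAt i<)
      has-point-at ρ {i} i< e = cellAt i< , cell-clique i< , cell-attached ρ i< i< (trans (attach-own ℓ i) e)

      link-at : ∀ ρ {k} (i< : 2 + k < 3 + ℓ) (j< : 1 + k < 3 + ℓ) → own-mark ℓ (2 + k) ≡ mark ρ →
                Link Q ρ (pointAt i<) (pointAt j<)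
      link-at ρ {k} i< j< e = cellAt i< , cell-clique i< ,
        cell-attached ρ i< i< (trans (attach-own ℓ (2 + k)) e) , cell-attached childR i< j< (attach-child ℓ k)

    root< : 2 + ℓ < 3 + ℓ
    root< = ≤-refl

    top< : 0 < 3 + ℓ
    top< = s≤s z≤n

    root-edge : adjacent Q (pointAt root<) (pointAt top<) ≡ true
    root-edge = trans (to-adjacent f _ _) (at-adj {2 + ℓ} {9} {0} {9} root< ≤-refl top< ≤-refl)

module _ {rules P} (ax : Axioms rules P) where
  open Axioms ax

  val-leaf⁻ : ∀ {x t} → Has P leafR x → Val P x t → t ≡ leaf
  val-leaf⁻ h v = sym (val-unique ax (val-leaf h) v)

  val-right⁻ : ∀ {x y t} → Link P rightR x y → Val P x t → Σ Tree λ a → Σ Tree λ b → t ≡ node a b × Val P y b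
  val-right⁻ l (val-leaf h) = contradiction (exclusive leafR rightR h (link⇒has P rightR l)) λ ()
  val-right⁻ l (val-der d _) = contradiction (exclusive rightR derR (link⇒has P rightR l) (link⇒has P derR d)) λ ()
  val-right⁻ l (val-node {t = a} {b} l′ r′ v w) with functional rightR l r′
  ... | refl = a , b , refl , w

  val-der⁻ : ∀ {x y t} → Link P derR x y → Val P x t → Σ Tree λ a → t ≡ der a × Val P y a
  val-der⁻ d (val-leaf h) = contradiction (exclusive leafR derR h (link⇒has P derR d)) λ ()
  val-der⁻ d (val-node l _ _ _) = contradiction (exclusive leftR derR (link⇒has P leftR l) (link⇒has P derR d)) λ ()
  val-der⁻ d (val-der {t = a} d′ v) with functional derR d d′
  ... | refl = a , refl , v

-- The joint graph contains no chain

module _ {rules ok} (sound : Sound rules ok) (G : Bool → Graph) (ax : ∀ s → Axioms rules (pre (G s))) where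
  open Join sound G ax

  localised : ∀ {s} (v : Side) → proj₁ v ≡ s → Σ (Vertex (P s)) λ x → v ≡ (s , x)
  localised (_ , x) refl = x , refl

  abstract
    leaf-value : ∀ {s v x t} → v ≡ (s , x) → Has joint leafR v → Val (P s) x t → spine t ≡ 0
    leaf-value {s} refl h v = cong spine (val-leaf⁻ (ax s) (has-local leafR h) v)

    right-value : ∀ {s v v′ x t} → v ≡ (s , x) → Link joint rightR v v′ → Val (P s) x t →
                  Σ (Vertex (P s)) λ y → v′ ≡ (s , y) × Σ Tree λ b → Val (P s) y b × spine t ≡ suc (spine b)
    right-value {s} refl l v with link-local rightR l
    ... | y , e , l′ with val-right⁻ (ax s) l′ v
    ...   | a , b , refl , v′ = y , e , b , v′ , refl

    der-value : ∀ {s v v′ x t} → v ≡ (s , x) → Link joint derR v v′ → Val (P s) x t →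
                Σ (Vertex (P s)) λ y → v′ ≡ (s , y) × Σ Tree λ a → Val (P s) y a × t ≡ der a
    der-value {s} refl l v with link-local derR l
    ... | y , e , l′ with val-der⁻ (ax s) l′ v
    ...   | a , p , v′ = y , e , a , v′ , p

  module ChainFree (ℓ : ℕ) (no-goal : ∀ t → ok (der t) ≡ true → spine t ≢ ℓ) (free : ∀ s → ¬ (pre (chain ℓ) ⊑ P s))
                   (f : pre (chain ℓ) ⊑ joint) where
    open Extract ℓ f
    w β : Side
    w = pointAt root<
    β = pointAt top<
    s = proj₁ w

    linked-side : ∀ ρ {v v′} → Link joint ρ v v′ → proj₁ v′ ≡ proj₁ v
    linked-side ρ {v} l with link-local ρ {w = _} l
    ... | y , refl , _ = refl

    index< : ∀ {k} → k ≤ ℓ → 1 + k < 3 + ℓ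
    index< h = s≤s (s≤s (m≤n⇒m≤1+n h))

    spine-side : ∀ m k (h : k ≤ ℓ) → m + k ≡ ℓ → proj₁ (pointAt (index< h)) ≡ s
    spine-side zero k h refl = linked-side derR (link-at derR root< (index< h) (own-der ℓ))
    spine-side (suc m) k h e = trans (linked-side rightR (link-at rightR (index< k<ℓ) (index< h) (own-right k<ℓ)))
                                     (spine-side m (suc k) k<ℓ (trans (+-suc m k) e))
      where
      open import Data.Nat.Properties using (+-suc)
      k<ℓ : k < ℓ
      k<ℓ = subst (suc k ≤_) e (s≤s (m≤n+m k m))

    point-side : proj₁ β ≡ s → ∀ {i} (i< : i < 3 + ℓ) → proj₁ (pointAt i<) ≡ s
    point-side eβ {zero} i< = trans (cong (λ p → proj₁ (pointAt p)) (<-irrelevant i< top<)) eβ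
    point-side eβ {suc k} i< = by-position (m≤n⇒m<n∨m≡n (s≤s⁻¹ (s≤s⁻¹ i<)))
      where
      by-position : k < suc ℓ ⊎ k ≡ suc ℓ → proj₁ (pointAt i<) ≡ s
      by-position (inj₂ refl) = cong (λ p → proj₁ (pointAt p)) (<-irrelevant i< root<)
      by-position (inj₁ k<) = trans (cong (λ p → proj₁ (pointAt p)) (<-irrelevant i< (index< (s≤s⁻¹ k<))))
                                    (spine-side (ℓ ∸ k) k (s≤s⁻¹ k<) (m∸n+n≡m (s≤s⁻¹ k<)))

    own-role : ∀ i → Σ Role λ ρ → own-mark ℓ i ≡ mark ρ
    own-role zero = topR , refl
    own-role (suc zero) = leafR , refl
    own-role (suc (suc k)) with k ≡ᵇ ℓ
    ... | true = derR , refl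
    ... | false = rightR , refl

    vertex-side : proj₁ β ≡ s → ∀ v → proj₁ (to f v) ≡ s
    vertex-side eβ v = trans (cong (λ z → proj₁ (to f z)) v-eq) (block-side (m≤n⇒m<n∨m≡n (remainder<10 (toℕ v))))
      where
      i = quotient (toℕ v)
      r = remainder (toℕ v)
      i< : i < 3 + ℓ
      i< = quotient-bound ℓ (toℕ v) (toℕ<n v)
      v-eq : v ≡ at ℓ i< (remainder<10 (toℕ v))
      v-eq = toℕ-injective (sym (trans (toℕ-fromℕ< (block-bound ℓ i< (remainder<10 (toℕ v)))) (join-digits (toℕ v))))
      at-cong : ∀ {r r′} (p : r < 10) (q : r′ < 10) → r ≡ r′ → at ℓ i< p ≡ at ℓ i< q
      at-cong p q refl = toℕ-injective (trans (toℕ-fromℕ< (block-bound ℓ i< p)) (sym (toℕ-fromℕ< (block-bound ℓ i< q))))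
      block-side : suc r < 10 ⊎ suc r ≡ 10 → proj₁ (to f (at ℓ i< (remainder<10 (toℕ v)))) ≡ s
      block-side (inj₂ e) = trans (cong (λ z → proj₁ (to f z)) (at-cong (remainder<10 (toℕ v)) ≤-refl (suc-injective e))) (point-side eβ i<)
      block-side (inj₁ (s≤s r<9)) =
        trans (cong (λ z → proj₁ (to f z)) (at-cong (remainder<10 (toℕ v)) (below-ten ℓ (fromℕ< r<9)) (sym (toℕ-fromℕ< r<9))))
        (trans (cong proj₁ (sym (lookup-cell i< (fromℕ< r<9))))
        (trans (attached-side (proj₁ (own-role i)) (cellAt i<) (cell-clique i<)
                  (cell-attached (proj₁ (own-role i)) i< i< (trans (attach-own ℓ i) (proj₂ (own-role i)))) (fromℕ< r<9))
               (point-side eβ i<)))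

    spine-value : ∀ k (h : k ≤ ℓ) {x} → pointAt (index< h) ≡ (s , x) → ∀ {t} → Val (P s) x t → spine t ≡ k
    spine-value zero h {x} e {t} v = leaf-value {s} {pointAt (index< h)} {x} {t} e (has-point-at leafR (index< h) refl) v
    spine-value (suc k) h {x} e {t} v = trans p (cong suc (spine-value k k≤ℓ e′ v′))
      where
      k≤ℓ : k ≤ ℓ
      k≤ℓ = ≤-trans (n≤1+n k) h
      step : Σ (Vertex (P s)) λ y → pointAt (index< k≤ℓ) ≡ (s , y) × Σ Tree λ b → Val (P s) y b × spine t ≡ suc (spine b)
      step = right-value {s} {pointAt (index< h)} {pointAt (index< k≤ℓ)} {x} {t} e
                         (link-at rightR (index< h) (index< k≤ℓ) (own-right h)) v
      e′ = proj₁ (proj₂ step)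
      v′ = proj₁ (proj₂ (proj₂ (proj₂ step)))
      p = proj₂ (proj₂ (proj₂ (proj₂ step)))

    by-side : Dec (proj₁ w ≡ proj₁ β) → ⊥
    by-side (yes e) = free s record
      { to = λ v → proj₁ (local-at v)
      ; to-injective = λ {u} {v} eq → to-injective f (trans (proj₂ (local-at u)) (trans (cong (s ,_) eq) (sym (proj₂ (local-at v)))))
      ; to-adjacent = λ u v → trans (sym (joined-same s _ _))
          (trans (cong₂ joined (sym (proj₂ (local-at u))) (sym (proj₂ (local-at v)))) (to-adjacent f u v)) }
      where
      local-at : ∀ v → Σ (Vertex (P s)) λ x → to f v ≡ (s , x)
      local-at v = localised (to f v) (vertex-side (sym e) v)
    by-side (no n) = no-goal (proj₁ u) (trans (cong ok (sym p)) (proj₂ (proj₂ value))) (spine-value ℓ ≤-refl e v′)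
      where
      is-good : good s (proj₂ w) ≡ true
      is-good = edge-good {s} {proj₂ w} {proj₁ β} {proj₂ β} n (has-local topR (has-point-at topR top< refl)) root-edge
      value : Σ Tree λ t → Val (P s) (proj₂ w) t × ok t ≡ true
      value = does-true (good? s (proj₂ w)) is-good
      step : Σ (Vertex (P s)) λ y → pointAt (index< ≤-refl) ≡ (s , y) × Σ Tree λ a → Val (P s) y a × proj₁ value ≡ der a
      step = der-value {s} {w} {pointAt (index< ≤-refl)} {proj₂ w} {proj₁ value} refl
                       (link-at derR root< (index< ≤-refl) (own-der ℓ)) (proj₁ (proj₂ value))
      e = proj₁ (proj₂ step)
      u = proj₂ (proj₂ step)
      v′ = proj₁ (proj₂ u)
      p = proj₂ (proj₂ u)

  -- Links keep the whole spine on the side of the root. If the top point is there too, the chain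
  -- lies in one of the given graphs. If not, the edge from root to top crosses, so the root has an
  -- ok tree `der t`, and following the links gives `t` the spine `ℓ`.
  chain-free : ∀ ℓ → (∀ t → ok (der t) ≡ true → spine t ≢ ℓ) → (∀ s → ¬ (pre (chain ℓ) ⊑ P s)) →
               ¬ (pre (chain ℓ) ⊑ joint)
  chain-free ℓ no-goal free f = by-side (proj₁ w ≟ᵇ proj₁ β)
    where open ChainFree ℓ no-goal free f

-- Planting the forest

-- Vertices of a finite piece copied into `Q` are addressed by the vertices of `P` themselves; those
-- outside `xs` are sent to the place of `x₀` to make this total.
module Piece {P Q : PreGraph} (_≟_ : DecidableEquality (Vertex P)) {xs} (c : Cover P xs)
             (f : pre (graph c) ⊑ Q) {x₀} (x₀∈ : x₀ ∈ xs) where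
  abstract
    locate : Vertex P → Fin (size (graph c))
    locate v with any? (λ i → to (embed c) i ≟ v)
    ... | yes (i , _) = i
    ... | no _ = proj₁ (covers c x₀∈)

    locate-correct : ∀ {v} → v ∈ xs → to (embed c) (locate v) ≡ v
    locate-correct {v} v∈ with any? (λ i → to (embed c) i ≟ v)
    ... | yes (i , e) = e
    ... | no n = contradiction (covers c v∈) n

  place : Vertex P → Vertex Q
  place v = to f (locate v)

  place-adjacent : ∀ {v w} → v ∈ xs → w ∈ xs → adjacent Q (place v) (place w) ≡ adjacent P v w
  place-adjacent v∈ w∈ = trans (to-adjacent f _ _)
    (trans (sym (to-adjacent (embed c) _ _)) (cong₂ (adjacent P) (locate-correct v∈) (locate-correct w∈)))

  place-injective : ∀ {v w} → v ∈ xs → w ∈ xs → place v ≡ place w → v ≡ w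
  place-injective v∈ w∈ e =
    trans (sym (locate-correct v∈)) (trans (cong (to (embed c)) (to-injective f e)) (locate-correct w∈))

subtrees : Tree → List Tree
subtrees leaf = leaf ∷ []
subtrees (node t u) = node t u ∷ subtrees t ++ subtrees u
subtrees (der t) = der t ∷ subtrees t

self-∈ : ∀ t → t ∈ subtrees t
self-∈ leaf = here refl
self-∈ (node t u) = here refl
self-∈ (der t) = here refl

node-∈ : ∀ s {t u} → node t u ∈ subtrees s → t ∈ subtrees s × u ∈ subtrees s
node-∈ leaf (there ())
node-∈ (node t u) (here refl) = there (∈-++⁺ˡ (self-∈ t)) , there (∈-++⁺ʳ (subtrees t) (self-∈ u))
node-∈ (node t u) (there p) with ∈-++⁻ (subtrees t) p
... | inj₁ q = there (∈-++⁺ˡ (proj₁ (node-∈ t q))) , there (∈-++⁺ˡ (proj₂ (node-∈ t q)))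
... | inj₂ q = there (∈-++⁺ʳ (subtrees t) (proj₁ (node-∈ u q))) , there (∈-++⁺ʳ (subtrees t) (proj₂ (node-∈ u q)))
node-∈ (der t) (there p) = there (proj₁ (node-∈ t p)) , there (proj₂ (node-∈ t p))

der-∈ : ∀ s {t} → der t ∈ subtrees s → t ∈ subtrees s
der-∈ leaf (there ())
der-∈ (node t u) (there p) with ∈-++⁻ (subtrees t) p
... | inj₁ q = there (∈-++⁺ˡ (der-∈ t q))
... | inj₂ q = there (∈-++⁺ʳ (subtrees t) (der-∈ u q))
der-∈ (der t) (here refl) = there (self-∈ t)
der-∈ (der t) (there p) = there (der-∈ t p)

over : Tree → List (Vertex forest)
over t = inj₂ t ∷ cartesianProductWith (λ ρ r → inj₁ ((t , ρ) , r)) roles (allFin 9)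

abstract
  nodes : Tree → List (Vertex forest)
  nodes s = concatMap over (subtrees s)

  ∈-nodes : ∀ {s t v} → t ∈ subtrees s → v ∈ over t → v ∈ nodes s
  ∈-nodes {s} {t} {v} t∈ v∈ = ∈-concatMap⁺ over (lose t∈ v∈)

  point-∈ : ∀ {s t} → t ∈ subtrees s → inj₂ t ∈ nodes s
  point-∈ t∈ = ∈-nodes t∈ (here refl)

  cell-∈ : ∀ {s t} ρ r → t ∈ subtrees s → inj₁ ((t , ρ) , r) ∈ nodes s
  cell-∈ {s} {t} ρ r t∈ =
    ∈-nodes t∈ (there (∈-cartesianProductWith⁺ (λ ρ r → inj₁ ((t , ρ) , r)) (∈-roles ρ) (∈-allFin r)))

_≟ᶠᵒ_ : DecidableEquality (Vertex forest)
_≟ᶠᵒ_ = Sum.≡-dec (≡-dec (≡-dec _≟ᵀ_ _≟ᴿ_) _≟ᶠ_) _≟ᵀ_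

abstract
  piece : ∀ s → Cover forest (nodes s)
  piece s = cover forest _≟ᶠᵒ_ (nodes s)

count-own : ∀ t ρ → fits t ρ ≡ true → treeCount (t , ρ) t ≡ mark ρ
count-own t ρ f rewrite f with t ≟ᵀ t
... | yes _ = refl
... | no n = contradiction refl n

count-kid : ∀ t ρ → fits t ρ ≡ true → kid t ρ ≢ t → treeCount (t , ρ) (kid t ρ) ≡ mark childR
count-kid t ρ f n rewrite f with kid t ρ ≟ᵀ t
... | yes e = contradiction e n
... | no _ with kid t ρ ≟ᵀ kid t ρ
...   | yes _ = refl
...   | no m = contradiction refl m

kid≢ˡ : ∀ t {u} → t ≢ node t u
kid≢ˡ t e = <⇒≢ (s≤s (m≤m⊔n (height t) _)) (cong height e)

kid≢ʳ : ∀ {t} u → u ≢ node t u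
kid≢ʳ {t} u e = <⇒≢ (s≤s (m≤n⊔m (height t) (height u))) (cong height e)

kid≢ᵈ : ∀ t → t ≢ der t
kid≢ᵈ t e = <⇒≢ ≤-refl (cong height e)

module Planted {q Q} (ax : Axioms (rules q) Q) (s : Tree) (f : pre (graph (piece s)) ⊑ Q) where
  open Piece _≟ᶠᵒ_ (piece s) f (point-∈ (self-∈ s)) public
  open Axioms ax

  pointOf : Tree → Vertex Q
  pointOf t = place (inj₂ t)

  cellOf : Tree → Role → Cell Q
  cellOf t ρ = tabulate λ r → place (inj₁ ((t , ρ) , r))

  lookup-cellOf : ∀ t ρ r → lookup (cellOf t ρ) r ≡ place (inj₁ ((t , ρ) , r))
  lookup-cellOf t ρ r = lookup∘tabulate (λ r → place (inj₁ ((t , ρ) , r))) r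

  abstract
    cellOf-clique : ∀ {t} ρ → t ∈ subtrees s → IsClique Q (cellOf t ρ)
    cellOf-clique {t} ρ t∈ i j =
      trans (cong₂ (adjacent Q) (lookup-cellOf t ρ i) (lookup-cellOf t ρ j))
            (trans (place-adjacent (cell-∈ ρ i t∈) (cell-∈ ρ j t∈)) (Forest.standardCell-clique (t , ρ) i j))

    cellOf-attached : ∀ ρ′ {t u} ρ → t ∈ subtrees s → u ∈ subtrees s → treeCount (t , ρ) u ≡ mark ρ′ →
                      Attached Q ρ′ (cellOf t ρ) (pointOf u)
    cellOf-attached ρ′ {t} {u} ρ t∈ u∈ e i =
      trans (cong (λ v → adjacent Q v (pointOf u)) (lookup-cellOf t ρ i))
            (trans (place-adjacent (cell-∈ ρ i t∈) (point-∈ u∈)) (cong (toℕ i <ᵇ_) e))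

    planted-has : ∀ {t} ρ → t ∈ subtrees s → fits t ρ ≡ true → Has Q ρ (pointOf t)
    planted-has {t} ρ t∈ f = cellOf t ρ , cellOf-clique ρ t∈ , cellOf-attached ρ ρ t∈ t∈ (count-own t ρ f)

    planted-link : ∀ {t} ρ → t ∈ subtrees s → kid t ρ ∈ subtrees s → fits t ρ ≡ true → kid t ρ ≢ t →
                   Link Q ρ (pointOf t) (pointOf (kid t ρ))
    planted-link {t} ρ t∈ k∈ f n = cellOf t ρ , cellOf-clique ρ t∈ , cellOf-attached ρ ρ t∈ t∈ (count-own t ρ f) ,
                                   cellOf-attached childR ρ t∈ k∈ (count-kid t ρ f n)

    link-left : ∀ {t u} → node t u ∈ subtrees s → Link Q leftR (pointOf (node t u)) (pointOf t)
    link-left {t} p = planted-link leftR p (proj₁ (node-∈ s p)) refl (kid≢ˡ t)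

    link-right : ∀ {t u} → node t u ∈ subtrees s → Link Q rightR (pointOf (node t u)) (pointOf u)
    link-right {u = u} p = planted-link rightR p (proj₂ (node-∈ s p)) refl (kid≢ʳ u)

    link-der : ∀ {t} → der t ∈ subtrees s → Link Q derR (pointOf (der t)) (pointOf t)
    link-der {t} p = planted-link derR p (der-∈ s p) refl (kid≢ᵈ t)

    -- All occurrences of a subtree share one point, so the occurrences of a repeated variable meet
    -- the same vertex.
    match-inst : ∀ p σ → inst σ p ∈ subtrees s → Match Q p (λ i → pointOf (σ i)) (pointOf (inst σ p))
    match-inst (var i) σ p∈ = refl
    match-inst leaf σ p∈ = planted-has leafR p∈ refl
    match-inst (node p p′) σ p∈ = _ , _ , link-left p∈ , link-right p∈ ,
      match-inst p σ (proj₁ (node-∈ s p∈)) , match-inst p′ σ (proj₂ (node-∈ s p∈))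
    match-inst (der p) σ p∈ = _ , link-der p∈ , match-inst p σ (der-∈ s p∈)

    -- The constructors of `Good` correspond to the three closure axioms, so the edge is forced by
    -- induction on the derivation.
    good-edge : ∀ {β t} → Has Q topR β → Good q t → t ∈ subtrees s → adjacent Q (pointOf t) β ≡ true
    good-edge b g-leaf t∈ = leaf-closed b (planted-has leafR t∈ refl)
    good-edge b (g-node g h) t∈ =
      node-closed b (link-left t∈) (link-right t∈) (good-edge b g (proj₁ (node-∈ s t∈))) (good-edge b h (proj₂ (node-∈ s t∈)))
    good-edge b (g-der r σ g) t∈ =
      der-closed (∈-rules q r) (λ i → pointOf (σ i)) b (link-der t∈) (match-inst (rule q r) σ (der-∈ s t∈))
                 (good-edge b g (der-∈ s t∈))

-- The spine of a derivation as a chain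

slot : ∀ {I J : Set} → I → J → ℕ → (I × Fin 9) ⊎ J
slot i p r with r <? 9
... | yes l = inj₁ (i , fromℕ< l)
... | no _ = inj₂ p

data Slot {I J : Set} (i : I) (p : J) (r : ℕ) : (I × Fin 9) ⊎ J → Set where
  in-cell : (l : r < 9) → Slot i p r (inj₁ (i , fromℕ< l))
  is-point : r ≡ 9 → Slot i p r (inj₂ p)

slot-view : ∀ {I J : Set} (i : I) (p : J) {r} → r < 10 → Slot i p r (slot i p r)
slot-view i p {r} r< with r <? 9
... | yes l = in-cell l
... | no n = is-point (≤-antisym (s≤s⁻¹ r<) (≮⇒≥ n))

slot-injective : ∀ {I J : Set} {i j : I} {p q : J} {r s} → r < 10 → s < 10 → slot i p r ≡ slot j q s →
                 r ≡ s × (i ≡ j ⊎ p ≡ q)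
slot-injective {i = i} {j} {p} {q} {r} {s} r< s< e
  with slot i p r | slot j q s | slot-view i p r< | slot-view j q s<
slot-injective r< s< refl | _ | _ | in-cell l | v = cell-case l v refl
  where
  cell-case : ∀ {I J : Set} {i j : I} {p q : J} {r s w} (l : r < 9) → Slot j q s w → w ≡ inj₁ (i , fromℕ< l) →
              r ≡ s × (i ≡ j ⊎ p ≡ q)
  cell-case l (in-cell l′) e with Sum.inj₁-injective e
  ... | e′ = trans (sym (toℕ-fromℕ< l)) (trans (cong (λ z → toℕ (proj₂ z)) (sym e′)) (toℕ-fromℕ< l′)) ,
             inj₁ (sym (cong proj₁ e′))
slot-injective r< s< refl | _ | _ | is-point refl | is-point refl = refl , inj₂ refl

module _ {I J : Set} (_≟ᴵ_ : DecidableEquality I) (count : I → J → ℕ) (count≤7 : ∀ i p → count i p ≤ 7) where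
  open CellSystem _≟ᴵ_ count count≤7

  slot-adjacent : ∀ ℓ b b′ {i j p q} → (i ≡ j → b ≡ b′) → (b ≡ b′ → i ≡ j) →
                  count i q ≡ attach ℓ b b′ → count j p ≡ attach ℓ b′ b → pointAdj b b′ ≡ false →
                  ∀ {r s} → r < 10 → s < 10 → joins (slot i p r) (slot j q s) ≡ blockAdj ℓ b r b′ s
  slot-adjacent ℓ b b′ {i} {j} {p} {q} to-b from-b c c′ pa {r} {s} r< s<
    with slot i p r | slot j q s | slot-view i p r< | slot-view j q s<
  ... | _ | _ | in-cell l | in-cell l′ rewrite <ᵇ-true l | <ᵇ-true l′ = cells
    where
    cells : does (i ≟ᴵ j) ∧ not ⌊ fromℕ< l ≟ᶠ fromℕ< l′ ⌋ ≡ cellAdj b r b′ s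
    cells with i ≟ᴵ j
    ... | no n rewrite ≢⇒≡ᵇ-false (λ e → n (from-b e)) = refl
    ... | yes e rewrite to-b e | ≡ᵇ-refl b′ with fromℕ< l ≟ᶠ fromℕ< l′
    ...   | yes e′ rewrite trans (sym (toℕ-fromℕ< l)) (trans (cong toℕ e′) (toℕ-fromℕ< l′)) | ≡ᵇ-refl s = refl
    ...   | no n rewrite ≢⇒≡ᵇ-false {r} {s} (λ { refl → n (toℕ-injective (trans (toℕ-fromℕ< l) (sym (toℕ-fromℕ< l′)))) }) = refl
  ... | _ | _ | in-cell l | is-point refl rewrite <ᵇ-true l | toℕ-fromℕ< l | c = refl
  ... | _ | _ | is-point refl | in-cell l′ rewrite <ᵇ-true l′ | toℕ-fromℕ< l′ | c′ = refl
  ... | _ | _ | is-point refl | is-point refl = sym pa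

beaconNodes : List (Vertex beacon)
beaconNodes = inj₂ tt ∷ map (λ r → inj₁ (tt , r)) (allFin 9)

_≟ᵇᵉ_ : DecidableEquality (Vertex beacon)
_≟ᵇᵉ_ = Sum.≡-dec (≡-dec (λ _ _ → yes refl) _≟ᶠ_) (λ _ _ → yes refl)

abstract
  beaconPiece : Cover beacon beaconNodes
  beaconPiece = cover beacon _≟ᵇᵉ_ beaconNodes

∈-beaconNodes : ∀ v → v ∈ beaconNodes
∈-beaconNodes (inj₁ (tt , r)) = there (∈-map⁺ (λ r → inj₁ (tt , r)) (∈-allFin r))
∈-beaconNodes (inj₂ tt) = here refl

right : Tree → Tree
right (node t u) = u
right _ = leaf

dropRight : ℕ → Tree → Tree
dropRight zero t = t
dropRight (suc m) t = dropRight m (right t)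

dropRight-right : ∀ m t → right (dropRight m t) ≡ dropRight (suc m) t
dropRight-right zero t = refl
dropRight-right (suc m) t = dropRight-right m (right t)

spine-right : ∀ t → spine (right t) ≡ spine t ∸ 1
spine-right leaf = refl
spine-right (node t u) = refl
spine-right (der t) = refl

spine-dropRight : ∀ m t → spine (dropRight m t) ≡ spine t ∸ m
spine-dropRight zero t = refl
spine-dropRight (suc m) t =
  trans (spine-dropRight m (right t)) (trans (cong (_∸ m) (spine-right t)) (∸-+-assoc (spine t) 1 m))

-- Left inverse of `link`, which makes the trees of the chain pairwise distinct; it differs from
-- `spine` at `der`.
index : Tree → ℕ
index leaf = 0
index (node t u) = suc (spine u)
index (der t) = suc (spine t)

spine-node : ∀ t {k} → spine t ≡ suc k → Σ Tree λ a → t ≡ node a (right t)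
spine-node (node a b) _ = a , refl

-- The spine length does not tell whether the spine ends in `leaf` or in `der`; `bottom` fixes the
-- former, as block 1 is a leaf cell.
module Spined (u : Tree) (ℓ : ℕ) (spine-ℓ : spine u ≡ ℓ) (bottom : dropRight ℓ u ≡ leaf) where
  link : ℕ → Tree
  link k = if k ≡ᵇ suc ℓ then der u else dropRight (ℓ ∸ k) u

  linkRole : ℕ → Role
  linkRole k = if k ≡ᵇ suc ℓ then derR else if k ≡ᵇ 0 then leafR else rightR

  data Position : ℕ → Tree → Role → Set where
    at-leaf : Position 0 leaf leafR
    at-node : ∀ {k a} → k < ℓ → Position (suc k) (node a (link k)) rightR
    at-root : Position (suc ℓ) (der (link ℓ)) derR

  low : ∀ {k} → k ≤ ℓ → (k ≡ᵇ suc ℓ) ≡ false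
  low h = ≢⇒≡ᵇ-false (<⇒≢ (s≤s h))

  link-low : ∀ {k} → k ≤ ℓ → link k ≡ dropRight (ℓ ∸ k) u
  link-low h rewrite low h = refl

  link-ℓ : link ℓ ≡ u
  link-ℓ = trans (link-low ≤-refl) (cong (λ m → dropRight m u) (n∸n≡0 ℓ))

  link-spine : ∀ {k} → k ≤ ℓ → spine (link k) ≡ k
  link-spine {k} h = trans (cong spine (link-low h))
    (trans (spine-dropRight (ℓ ∸ k) u) (trans (cong (_∸ (ℓ ∸ k)) spine-ℓ) (m∸[m∸n]≡n h)))

  position : ∀ k → k ≤ suc ℓ → Position k (link k) (linkRole k)
  position k h with m≤n⇒m<n∨m≡n h
  ... | inj₂ refl rewrite ≡ᵇ-refl ℓ = subst (λ t → Position (suc ℓ) (der t) derR) link-ℓ at-root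
  position zero h | inj₁ _ = subst (λ t → Position 0 t leafR) (sym bottom) at-leaf
  position (suc k) h | inj₁ (s≤s k<ℓ) =
    subst₂ (Position (suc k)) (sym node-eq) (sym role-eq) (at-node k<ℓ)
    where
    is-node : Σ Tree λ a → link (suc k) ≡ node a (right (link (suc k)))
    is-node = spine-node (link (suc k)) (link-spine k<ℓ)
    right-eq : right (link (suc k)) ≡ link k
    right-eq = trans (cong right (link-low k<ℓ)) (trans (dropRight-right (ℓ ∸ suc k) u)
      (trans (cong (λ m → dropRight m u) (sym (+-∸-assoc 1 k<ℓ))) (sym (link-low (≤-trans (n≤1+n k) k<ℓ)))))
    node-eq : link (suc k) ≡ node (proj₁ is-node) (link k)
    node-eq = trans (proj₂ is-node) (cong (node (proj₁ is-node)) right-eq)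
    role-eq : linkRole (suc k) ≡ rightR
    role-eq rewrite low k<ℓ = refl

  index-position : ∀ {k t ρ} → Position k t ρ → index t ≡ k
  index-position at-leaf = refl
  index-position (at-node h) = cong suc (link-spine (≤-trans (n≤1+n _) h))
  index-position at-root = cong suc (link-spine ≤-refl)

  fits-position : ∀ {k t ρ} → Position k t ρ → fits t ρ ≡ true
  fits-position at-leaf = refl
  fits-position (at-node h) = refl
  fits-position at-root = refl

  mark-position : ∀ {k t ρ} → Position k t ρ → own-mark ℓ (suc k) ≡ mark ρ
  mark-position at-leaf = refl
  mark-position (at-node h) = own-right h
  mark-position at-root = own-der ℓ

  kid-position : ∀ {k t ρ} → Position (suc k) t ρ → kid t ρ ≡ link k
  kid-position (at-node h) = refl
  kid-position at-root = refl

  link-injective : ∀ {k m} → k ≤ suc ℓ → m ≤ suc ℓ → link k ≡ link m → k ≡ m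
  link-injective h h′ e =
    trans (sym (index-position (position _ h))) (trans (cong index e) (index-position (position _ h′)))

  kid-leaf : ∀ {t ρ} → Position 0 t ρ → kid t ρ ≡ t
  kid-leaf at-leaf = refl

  not-kid : ∀ k {m} → k ≤ suc ℓ → m ≤ suc ℓ → k ≢ m → k ≢ suc m → link m ≢ kid (link k) (linkRole k)
  not-kid zero h h′ n _ e = n (link-injective h h′ (sym (trans e (kid-leaf (position 0 h)))))
  not-kid (suc j) h h′ _ n e =
    n (cong suc (link-injective (≤-trans (n≤1+n j) h) h′ (sym (trans e (kid-position (position (suc j) h))))))

  -- Blocks are shifted by one because block 0 is the top cell. Distinctness of the links rules out
  -- attachments other than of the owner and of the next lower link.
  link-count : ∀ {k m} → k ≤ suc ℓ → m ≤ suc ℓ → treeCount (link k , linkRole k) (link m) ≡ attach ℓ (suc k) (suc m)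
  link-count {k} {m} h h′ with k ≟ᴺ m
  ... | yes refl = trans (count-own (link k) (linkRole k) (fits-position (position k h)))
                         (sym (trans (attach-own ℓ (suc k)) (mark-position (position k h))))
  ... | no k≢m with k ≟ᴺ suc m
  ...   | yes refl = trans (trans (cong (treeCount (link (suc m) , linkRole (suc m))) (sym kid-eq))
                                  (count-kid (link (suc m)) (linkRole (suc m)) (fits-position (position (suc m) h))
                                     (λ e → k≢m (link-injective h h′ (trans (sym e) kid-eq)))))
                           (sym (attach-child ℓ m))
    where
    kid-eq : kid (link (suc m)) (linkRole (suc m)) ≡ link m
    kid-eq = kid-position (position (suc m) h)
  ...   | no k≢1+m rewrite ≢⇒≡ᵇ-false k≢m | ≢⇒≡ᵇ-false k≢1+m = vanish _ (countView (link k) (linkRole k) (link m)) refl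
    where
    vanish : ∀ c → CountView (link k) (linkRole k) (link m) c → treeCount (link k , linkRole k) (link m) ≡ c →
             treeCount (link k , linkRole k) (link m) ≡ 0
    vanish _ none e = e
    vanish _ (own _ p) e = contradiction (sym (link-injective h′ h p)) k≢m
    vanish _ (child _ _ p) e = contradiction p (not-kid k h h′ k≢m k≢1+m)

  link-down : ∀ {k t ρ} s → Position (suc k) t ρ → t ∈ subtrees s → link k ∈ subtrees s
  link-down s (at-node _) t∈ = proj₂ (node-∈ s t∈)
  link-down s at-root t∈ = der-∈ s t∈

  link-∈ : ∀ m {k} → m + k ≡ suc ℓ → link k ∈ subtrees (der u)
  link-∈ zero {k} refl = subst (_∈ subtrees (der u)) (sym top-eq) (here refl)
    where
    top-eq : link (suc ℓ) ≡ der u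
    top-eq rewrite ≡ᵇ-refl ℓ = refl
  link-∈ (suc m) {k} e = link-down (der u) (position (suc k) (subst (suc k ≤_) e (s≤s (m≤n+m k m))))
                                   (link-∈ m (trans (+-suc m k) e))

-- Joint embedding for the obstructions

good-subtree : ∀ {q s t} → Good q s → t ∈ subtrees s → Good q t
good-subtree g-leaf (here refl) = g-leaf
good-subtree g@(g-node _ _) (here refl) = g
good-subtree {s = node a b} (g-node g h) (there p) with ∈-++⁻ (subtrees a) p
... | inj₁ p′ = good-subtree g p′
... | inj₂ p′ = good-subtree h p′
good-subtree g@(g-der _ _ _) (here refl) = g
good-subtree (g-der r σ g) (there p) = good-subtree g p

attach-zero : ∀ ℓ m → attach ℓ (suc m) 0 ≡ 0
attach-zero ℓ zero = refl
attach-zero ℓ (suc m) = refl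

no-edge-cells : ∀ ℓ m {r s} → r < 9 → s < 9 → blockAdj ℓ (suc m) r 0 s ≡ false
no-edge-cells ℓ m l l′ rewrite <ᵇ-true l | <ᵇ-true l′ = refl

no-edge-cell-point : ∀ ℓ m {r} → r < 9 → blockAdj ℓ (suc m) r 0 9 ≡ false
no-edge-cell-point ℓ m l rewrite <ᵇ-true l | attach-zero ℓ m = refl

no-edge-point-cell : ∀ ℓ m {s} → s < 9 → blockAdj ℓ (suc m) 9 0 s ≡ false
no-edge-point-cell ℓ m l rewrite <ᵇ-true l = refl

no-edge-to-cell : ∀ ℓ m s {t} → t < 9 → blockAdj ℓ (suc m) s 0 t ≡ false
no-edge-to-cell ℓ m s l rewrite <ᵇ-true l with s <ᵇ 9
... | true = refl
... | false = refl

other : ℕ → ℕ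
other zero = 1
other (suc _) = 0

other< : ∀ r → other r < 9
other< zero = s≤s (s≤s z≤n)
other< (suc _) = s≤s z≤n

other-edge : ∀ ℓ r → blockAdj ℓ 0 r 0 (other r) ≡ true
other-edge ℓ zero = refl
other-edge ℓ (suc r) with suc r <ᵇ 9
... | true = refl
... | false = refl

module Embedding {q Q} (ax : Axioms (rules q) Q) (u : Tree) (ℓ : ℕ) (spine-ℓ : spine u ≡ ℓ) (bottom : dropRight ℓ u ≡ leaf)
                 (f : pre (graph (piece (der u))) ⊑ Q) (g : pre (graph beaconPiece) ⊑ Q) (derivation : Good q (der u)) where
  open Planted ax (der u) f
  open Spined u ℓ spine-ℓ bottom
  module B = Piece _≟ᵇᵉ_ beaconPiece g (∈-beaconNodes (inj₂ tt))

  β : Vertex Q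
  β = B.place (inj₂ tt)

  topCell : Cell Q
  topCell = tabulate λ r → B.place (inj₁ (tt , r))

  lookup-top : ∀ r → lookup topCell r ≡ B.place (inj₁ (tt , r))
  lookup-top r = lookup∘tabulate (λ r → B.place (inj₁ (tt , r))) r

  beacon-adjacent : ∀ v w → adjacent Q (B.place v) (B.place w) ≡ adjacent beacon v w
  beacon-adjacent v w = B.place-adjacent (∈-beaconNodes v) (∈-beaconNodes w)

  abstract
    top-clique : IsClique Q topCell
    top-clique r s = trans (cong₂ (adjacent Q) (lookup-top r) (lookup-top s))
      (trans (beacon-adjacent (inj₁ (tt , r)) (inj₁ (tt , s))) (Beacon.standardCell-clique tt r s))

    top-attached : Attached Q topR topCell β
    top-attached r = trans (cong (λ v → adjacent Q v β) (lookup-top r)) (beacon-adjacent (inj₁ (tt , r)) (inj₂ tt))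

  spot : ℕ → ℕ → Vertex forest
  spot k r = slot (link k , linkRole k) (link k) r

  link-member : ∀ {k} → k ≤ suc ℓ → link k ∈ subtrees (der u)
  link-member {k} h = link-∈ (suc ℓ ∸ k) (m∸n+n≡m h)

  spot-∈ : ∀ {k r} → k ≤ suc ℓ → r < 10 → spot k r ∈ nodes (der u)
  spot-∈ {k} {r} h r< with slot (link k , linkRole k) (link k) r | slot-view (link k , linkRole k) (link k) r<
  ... | _ | in-cell l = cell-∈ (linkRole k) (fromℕ< l) (link-member h)
  ... | _ | is-point _ = point-∈ (link-member h)

  spot-adjacent : ∀ {k r m s} → k ≤ suc ℓ → r < 10 → m ≤ suc ℓ → s < 10 →
                  adjacent forest (spot k r) (spot m s) ≡ blockAdj ℓ (suc k) r (suc m) s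
  spot-adjacent {k} {r} {m} {s} h r< h′ s< =
    slot-adjacent (≡-dec _≟ᵀ_ _≟ᴿ_) treeCount treeCount≤7 ℓ (suc k) (suc m)
      (λ e → cong suc (link-injective h h′ (cong proj₁ e)))
      (λ e → cong (λ n → link n , linkRole n) (suc-injective e))
      (link-count h h′) (link-count h′ h) refl r< s<

  -- The two pieces may be connected arbitrarily in `Q`, yet `isolated` excludes the edges at cell
  -- vertices, and `good-edge` forces the one between the two points.
  mixed : ∀ {m r s} → m ≤ suc ℓ → r < 10 → s < 10 →
          adjacent Q (place (spot m r)) (B.place (slot tt tt s)) ≡ blockAdj ℓ (suc m) r 0 s
  mixed {m} {r} {s} h r< s< = cases (slot-view (link m , linkRole m) (link m) r<) (slot-view tt tt s<)
    where
    t∈ = link-member h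
    fits-m : fits (link m) (linkRole m) ≡ true
    fits-m = fits-position (position m h)
    role-sort : ∀ {k t ρ} → Position k t ρ → isTop ρ ≡ false
    role-sort at-leaf = refl
    role-sort (at-node _) = refl
    role-sort at-root = refl
    apart = Axioms.isolated ax (linkRole m) (role-sort (position m h))
              (cellOf (link m) (linkRole m)) topCell (cellOf-clique (linkRole m) t∈)
              (cellOf-attached (linkRole m) (linkRole m) t∈ t∈ (count-own (link m) (linkRole m) fits-m))
              top-clique top-attached
    cases : ∀ {v w} → Slot (link m , linkRole m) (link m) r v → Slot tt tt s w →
            adjacent Q (place v) (B.place w) ≡ blockAdj ℓ (suc m) r 0 s
    cases (in-cell l) (in-cell l′) =
      trans (cong₂ (adjacent Q) (sym (lookup-cellOf (link m) (linkRole m) (fromℕ< l))) (sym (lookup-top (fromℕ< l′))))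
            (trans (proj₁ apart (fromℕ< l) (fromℕ< l′)) (sym (no-edge-cells ℓ m l l′)))
    cases (in-cell l) (is-point refl) =
      trans (cong (λ v → adjacent Q v β) (sym (lookup-cellOf (link m) (linkRole m) (fromℕ< l))))
            (trans (proj₁ (proj₂ apart) (fromℕ< l)) (sym (no-edge-cell-point ℓ m l)))
    cases (is-point refl) (in-cell l′) =
      trans (cong (adjacent Q (pointOf (link m))) (sym (lookup-top (fromℕ< l′))))
            (trans (proj₂ (proj₂ apart) (fromℕ< l′)) (sym (no-edge-point-cell ℓ m l′)))
    cases (is-point refl) (is-point refl) =
      good-edge (topCell , top-clique , top-attached) (good-subtree derivation t∈) t∈

  vertexAt : ℕ → ℕ → Vertex Q
  vertexAt zero r = B.place (slot tt tt r)
  vertexAt (suc k) r = place (spot k r)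

  vertexAt-adjacent : ∀ {i r j s} → i < 3 + ℓ → r < 10 → j < 3 + ℓ → s < 10 →
                      adjacent Q (vertexAt i r) (vertexAt j s) ≡ blockAdj ℓ i r j s
  vertexAt-adjacent {zero} {r} {zero} {s} _ r< _ s< =
    trans (beacon-adjacent (slot tt tt r) (slot tt tt s))
          (slot-adjacent (λ _ _ → yes refl) (λ _ _ → 7) (λ _ _ → ≤-refl) ℓ 0 0 (λ _ → refl) (λ _ → refl) refl refl refl r< s<)
  vertexAt-adjacent {suc k} {r} {zero} {s} i< r< _ s< = mixed (s≤s⁻¹ (s≤s⁻¹ i<)) r< s<
  vertexAt-adjacent {zero} {r} {suc m} {s} _ r< j< s< =
    trans (adjacent-sym Q _ _) (trans (mixed (s≤s⁻¹ (s≤s⁻¹ j<)) s< r<) (blockAdj-sym ℓ (suc m) s 0 r))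
  vertexAt-adjacent {suc k} {r} {suc m} {s} i< r< j< s< =
    trans (place-adjacent (spot-∈ h r<) (spot-∈ h′ s<)) (spot-adjacent h r< h′ s<)
    where
    h = s≤s⁻¹ (s≤s⁻¹ i<)
    h′ = s≤s⁻¹ (s≤s⁻¹ j<)

  -- A priori the two pieces could overlap in `Q`. But every vertex of block 0 has a neighbour in
  -- the top cell, and no vertex of another block has one.
  blocks-apart : ∀ {m r s} → m ≤ suc ℓ → r < 10 → s < 10 → vertexAt 0 r ≢ vertexAt (suc m) s
  blocks-apart {m} {r} {s} h r< s< e =
    true≢false (other-edge ℓ r) (trans (probe (other r) (other< r)) (no-edge-to-cell ℓ m s (other< r)))
    where
    probe : ∀ t → t < 9 → blockAdj ℓ 0 r 0 t ≡ blockAdj ℓ (suc m) s 0 t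
    probe t t< = trans (sym (vertexAt-adjacent {0} {r} {0} {t} (s≤s z≤n) r< (s≤s z≤n) (m≤n⇒m≤1+n t<)))
      (trans (cong (λ v → adjacent Q v (vertexAt 0 t)) e)
             (vertexAt-adjacent {suc m} {s} {0} {t} (s≤s (s≤s h)) s< (s≤s z≤n) (m≤n⇒m≤1+n t<)))

  vertexAt-injective : ∀ {i r j s} → i < 3 + ℓ → r < 10 → j < 3 + ℓ → s < 10 → vertexAt i r ≡ vertexAt j s → i ≡ j × r ≡ s
  vertexAt-injective {zero} {r} {zero} {s} _ r< _ s< e =
    refl , proj₁ (slot-injective r< s< (B.place-injective (∈-beaconNodes (slot tt tt r)) (∈-beaconNodes (slot tt tt s)) e))
  vertexAt-injective {zero} {r} {suc m} _ r< j< s< e = ⊥-elim (blocks-apart (s≤s⁻¹ (s≤s⁻¹ j<)) r< s< e)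
  vertexAt-injective {suc k} {r} {zero} i< r< _ s< e = ⊥-elim (blocks-apart (s≤s⁻¹ (s≤s⁻¹ i<)) s< r< (sym e))
  vertexAt-injective {suc k} {r} {suc m} {s} i< r< j< s< e
    with slot-injective r< s< (place-injective (spot-∈ (s≤s⁻¹ (s≤s⁻¹ i<)) r<) (spot-∈ (s≤s⁻¹ (s≤s⁻¹ j<)) s<) e)
  ... | p , inj₁ p′ = cong suc (link-injective (s≤s⁻¹ (s≤s⁻¹ i<)) (s≤s⁻¹ (s≤s⁻¹ j<)) (cong proj₁ p′)) , p
  ... | p , inj₂ p′ = cong suc (link-injective (s≤s⁻¹ (s≤s⁻¹ i<)) (s≤s⁻¹ (s≤s⁻¹ j<)) p′) , p

  chain-embeds : pre (chain ℓ) ⊑ Q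
  chain-embeds = assemble ℓ vertexAt vertexAt-adjacent vertexAt-injective

constraints : Tree → List Graph
constraints q = family (sentences (rules q))

obstructions : Tree → ℕ → List Graph
obstructions q ℓ = chain ℓ ∷ constraints q

forb-obstructions : ∀ q ℓ H → ¬ (pre (chain ℓ) ⊑ pre H) → Forb (constraints q) H → Forb (obstructions q ℓ) H
forb-obstructions q ℓ H n forb G (here refl) f = n (↪⇒⊑ {chain ℓ} {H} f)
forb-obstructions q ℓ H n forb G (there p) f = forb G p f

no-chain-in-forest : ∀ ℓ → ¬ (pre (chain ℓ) ⊑ forest)
no-chain-in-forest ℓ f with Forest.has-point topR (Extract.has-point-at ℓ f topR (Extract.top< ℓ f) refl)
... | i , p , _ , e = forest-no-top i p e

no-chain-in-beacon : ∀ ℓ → ¬ (pre (chain ℓ) ⊑ beacon)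
no-chain-in-beacon ℓ f with Beacon.has-point leafR (Extract.has-point-at ℓ f leafR {1} (s≤s (s≤s z≤n)) refl)
... | i , p , _ , ()

no-common-extension : ∀ q u ℓ → spine u ≡ ℓ → dropRight ℓ u ≡ leaf → Good q (der u) → ∀ C →
                      Forb (obstructions q ℓ) C → ¬ (pre (graph (piece (der u))) ⊑ pre C × pre (graph beaconPiece) ⊑ pre C)
no-common-extension q u ℓ spine-ℓ bottom derivation C C-in (f , g) =
  C-in (chain ℓ) (here refl) (⊑⇒↪ {chain ℓ} {C} chain-embeds)
  where
  ax : Axioms (rules q) (pre C)
  ax = class⇒axioms (rules q) C λ H p → C-in H (there p)
  open Embedding ax u ℓ spine-ℓ bottom f g derivation

forest-piece-in-class : ∀ q s ℓ → Forb (obstructions q ℓ) (graph (piece s))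
forest-piece-in-class q s ℓ =
  forb-obstructions q ℓ (graph (piece s)) (λ f → no-chain-in-forest ℓ (⊑-trans f (embed (piece s))))
    (axioms⇒class (rules q) (graph (piece s)) (embed (piece s)) (forest-axioms (rules q)))

beacon-piece-in-class : ∀ q ℓ → Forb (obstructions q ℓ) (graph beaconPiece)
beacon-piece-in-class q ℓ =
  forb-obstructions q ℓ (graph beaconPiece) (λ f → no-chain-in-beacon ℓ (⊑-trans f (embed beaconPiece)))
    (axioms⇒class (rules q) (graph beaconPiece) (embed beaconPiece) (beacon-axioms (rules q)))

no-jep : ∀ q u ℓ → spine u ≡ ℓ → dropRight ℓ u ≡ leaf → Good q (der u) → ¬ JEP (Forb (obstructions q ℓ))
no-jep q u ℓ spine-ℓ bottom derivation jep =
  let (C , C-in , f , g) = jep (graph (piece (der u))) (graph beaconPiece)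
                               (forest-piece-in-class q (der u) ℓ) (beacon-piece-in-class q ℓ) in
  no-common-extension q u ℓ spine-ℓ bottom derivation C C-in
    (↪⇒⊑ {graph (piece (der u))} {C} f , ↪⇒⊑ {graph beaconPiece} {C} g)

has-jep : ∀ q ℓ {ok} → Sound (rules q) ok → (∀ t → ok (der t) ≡ true → spine t ≢ ℓ) → JEP (Forb (obstructions q ℓ))
has-jep q ℓ sound no-goal A B A-in B-in = C , C-in , ⊑⇒↪ {A} {C} (part true) , ⊑⇒↪ {B} {C} (part false)
  where
  G : Bool → Graph
  G true = A
  G false = B
  G-in : ∀ s → Forb (obstructions q ℓ) (G s)
  G-in true = A-in
  G-in false = B-in
  ax : ∀ s → Axioms (rules q) (pre (G s))
  ax s = class⇒axioms (rules q) (G s) λ H p → G-in s H (there p)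
  open Join sound G ax
  C = graph finite-joint
  C-in : Forb (obstructions q ℓ) C
  C-in = forb-obstructions q ℓ C
    (λ f → chain-free sound G ax ℓ no-goal (λ s h → G-in s (chain ℓ) (here refl) (⊑⇒↪ {chain ℓ} {G s} h))
                      (⊑-trans f (embed finite-joint)))
    (axioms⇒class (rules q) C (embed finite-joint) joint-axioms)

-- Recursive functions

record Computable {n} (f : Vec ℕ n → ℕ) : Set where
  field
    program : PR n
    correct : ∀ xs → Eval program xs (f xs)
open Computable

module _ {n : ℕ} where
  by-ext : ∀ {f g : Vec ℕ n → ℕ} → (∀ xs → f xs ≡ g xs) → Computable f → Computable g
  by-ext e F = record { program = program F ; correct = λ xs → subst (Eval (program F) xs) (e xs) (correct F xs) }

  zeroᶜ : Computable {n} λ _ → 0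
  zeroᶜ = record { program = zer ; correct = λ _ → e-zer }

  argᶜ : ∀ i → Computable {n} λ xs → lookupV xs i
  argᶜ i = record { program = proj i ; correct = λ _ → e-proj i }

  sucᶜ : ∀ {f} → Computable {n} f → Computable λ xs → suc (f xs)
  sucᶜ F = record { program = comp succ (program F ∷ [])
                  ; correct = λ xs → e-comp (ea-∷ (correct F xs) ea-[]) e-succ }

  constᶜ : ∀ k → Computable {n} λ _ → k
  constᶜ zero = zeroᶜ
  constᶜ (suc k) = sucᶜ (constᶜ k)

  apply₁ : ∀ {h f} → Computable {1} h → Computable {n} f → Computable λ xs → h (f xs ∷ [])
  apply₁ H F = record { program = comp (program H) (program F ∷ [])
                      ; correct = λ xs → e-comp (ea-∷ (correct F xs) ea-[]) (correct H _) }

  apply₂ : ∀ {h f g} → Computable {2} h → Computable {n} f → Computable g → Computable λ xs → h (f xs ∷ g xs ∷ [])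
  apply₂ H F G = record { program = comp (program H) (program F ∷ program G ∷ [])
                        ; correct = λ xs → e-comp (ea-∷ (correct F xs) (ea-∷ (correct G xs) ea-[])) (correct H _) }

  apply₃ : ∀ {h f g k} → Computable {3} h → Computable {n} f → Computable g → Computable k →
           Computable λ xs → h (f xs ∷ g xs ∷ k xs ∷ [])
  apply₃ H F G K = record
    { program = comp (program H) (program F ∷ program G ∷ program K ∷ [])
    ; correct = λ xs → e-comp (ea-∷ (correct F xs) (ea-∷ (correct G xs) (ea-∷ (correct K xs) ea-[]))) (correct H _) }

  apply₅ : ∀ {h f g k l m} → Computable {5} h → Computable {n} f → Computable g → Computable k → Computable l →
           Computable m → Computable λ xs → h (f xs ∷ g xs ∷ k xs ∷ l xs ∷ m xs ∷ [])
  apply₅ H F G K L M = record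
    { program = comp (program H) (program F ∷ program G ∷ program K ∷ program L ∷ program M ∷ [])
    ; correct = λ xs → e-comp (ea-∷ (correct F xs) (ea-∷ (correct G xs) (ea-∷ (correct K xs)
                                (ea-∷ (correct L xs) (ea-∷ (correct M xs) ea-[]))))) (correct H _) }

  recursion : ∀ (f : ℕ → Vec ℕ n → ℕ) {h} → Computable (f 0) → Computable {2 + n} h →
              (∀ k xs → f (suc k) xs ≡ h (k ∷ f k xs ∷ xs)) → Computable λ xs → f (Vec.head xs) (Vec.tail xs)
  recursion f {h} B S e = record { program = prec (program B) (program S) ; correct = λ { (k ∷ xs) → run-to k xs } }
    where
    run-to : ∀ k xs → Eval (prec (program B) (program S)) (k ∷ xs) (f k xs)
    run-to zero xs = e-prec0 (correct B xs)
    run-to (suc k) xs = e-precS (run-to k xs) (subst (Eval (program S) _) (sym (e k xs)) (correct S _))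

addition : Computable {2} λ xs → Vec.head xs + lookupV xs (# 1)
addition = by-ext (λ { (_ ∷ _ ∷ []) → refl }) (recursion (λ k xs → k + lookupV xs zero) (argᶜ (# 0)) (sucᶜ (argᶜ (# 1))) (λ _ _ → refl))

_+ᶜ_ : ∀ {n} {f g : Vec ℕ n → ℕ} → Computable f → Computable g → Computable λ xs → f xs + g xs
_+ᶜ_ = apply₂ addition

multiplication : Computable {2} λ xs → Vec.head xs * lookupV xs (# 1)
multiplication = by-ext (λ { (_ ∷ _ ∷ []) → refl })
  (recursion (λ k xs → k * lookupV xs zero) zeroᶜ (argᶜ (# 2) +ᶜ argᶜ (# 1)) (λ { k (x ∷ []) → refl }))

_*ᶜ_ : ∀ {n} {f g : Vec ℕ n → ℕ} → Computable f → Computable g → Computable λ xs → f xs * g xs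
_*ᶜ_ = apply₂ multiplication

predecessor : Computable {1} λ xs → Vec.head xs ∸ 1
predecessor = recursion (λ k _ → k ∸ 1) zeroᶜ (argᶜ (# 0)) (λ _ _ → refl)

-- The subtrahend comes first because the recursion runs on the first argument.
subtraction : Computable {2} λ xs → lookupV xs (# 1) ∸ Vec.head xs
subtraction = by-ext (λ { (_ ∷ _ ∷ []) → refl })
  (recursion (λ k xs → lookupV xs zero ∸ k) (argᶜ (# 0)) (apply₁ predecessor (argᶜ (# 1)))
             (λ { k (x ∷ []) → sym (trans (pred≡∸1 (x ∸ k)) (pred[m∸n]≡m∸[1+n] x k)) }))
  where
  pred≡∸1 : ∀ m → m ∸ 1 ≡ pred m
  pred≡∸1 zero = refl
  pred≡∸1 (suc m) = refl

_∸ᶜ_ : ∀ {n} {f g : Vec ℕ n → ℕ} → Computable f → Computable g → Computable λ xs → f xs ∸ g xs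
F ∸ᶜ G = apply₂ subtraction G F

exponential : Computable {1} λ xs → 2 ^ Vec.head xs
exponential = recursion (λ k _ → 2 ^ k) (constᶜ 1) (constᶜ 2 *ᶜ argᶜ (# 1)) (λ _ _ → refl)

choose : ℕ → ℕ → ℕ → ℕ
choose zero a b = b
choose (suc _) a b = a

choice : Computable {3} λ xs → choose (Vec.head xs) (lookupV xs (# 1)) (lookupV xs (# 2))
choice = by-ext (λ { (_ ∷ _ ∷ _ ∷ []) → refl })
  (recursion (λ k xs → choose k (lookupV xs (# 0)) (lookupV xs (# 1))) (argᶜ (# 1)) (argᶜ (# 2)) (λ { k (x ∷ y ∷ []) → refl }))

module _ {n : ℕ} where
  Test : (Vec ℕ n → Bool) → Set
  Test b = Computable λ xs → bit (b xs)

  ifᶜ : ∀ {b f g} → Test b → Computable f → Computable g → Computable λ xs → if b xs then f xs else g xs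
  ifᶜ {b} B F G = by-ext (λ xs → choose-bit (b xs)) (apply₃ choice B F G)
    where
    choose-bit : ∀ c {x y} → choose (bit c) x y ≡ (if c then x else y)
    choose-bit true = refl
    choose-bit false = refl

  if-test : ∀ {b c d} → Test b → Test c → Test d → Test λ xs → if b xs then c xs else d xs
  if-test {b} B C D = by-ext (λ xs → push-bit (b xs)) (ifᶜ B C D)
    where
    push-bit : ∀ x {y z} → (if x then bit y else bit z) ≡ bit (if x then y else z)
    push-bit true = refl
    push-bit false = refl

  not-test : ∀ {b} → Test b → Test λ xs → not (b xs)
  not-test {b} B = by-ext (λ xs → flip-bit (b xs)) (ifᶜ B zeroᶜ (constᶜ 1))
    where
    flip-bit : ∀ x → (if x then 0 else 1) ≡ bit (not x)
    flip-bit true = refl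
    flip-bit false = refl

  false-test : Test λ _ → false
  false-test = zeroᶜ

  equal-test : ∀ {f g} → Computable f → Computable g → Test λ xs → f xs ≡ᵇ g xs
  equal-test {f} {g} F G = by-ext (λ xs → as-choice (f xs) (g xs)) (apply₃ choice ((F ∸ᶜ G) +ᶜ (G ∸ᶜ F)) zeroᶜ (constᶜ 1))
    where
    as-choice : ∀ x y → choose ((x ∸ y) + (y ∸ x)) 0 1 ≡ bit (x ≡ᵇ y)
    as-choice zero zero = refl
    as-choice zero (suc y) = refl
    as-choice (suc x) zero = refl
    as-choice (suc x) (suc y) = as-choice x y

  less-test : ∀ {f g} → Computable f → Computable g → Test λ xs → f xs <ᵇ g xs
  less-test {f} {g} F G = by-ext (λ xs → as-choice (f xs) (g xs)) (apply₃ choice (G ∸ᶜ F) (constᶜ 1) zeroᶜ)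
    where
    as-choice : ∀ x y → choose (y ∸ x) 1 0 ≡ bit (x <ᵇ y)
    as-choice zero zero = refl
    as-choice zero (suc y) = refl
    as-choice (suc x) zero = refl
    as-choice (suc x) (suc y) = as-choice x y

-- The code of the chain as a recursive function

remainderᶜ : Computable {1} λ xs → remainder (Vec.head xs)
remainderᶜ = recursion (λ k _ → remainder k) zeroᶜ
  (ifᶜ (equal-test (argᶜ (# 1)) (constᶜ 9)) zeroᶜ (sucᶜ (argᶜ (# 1)))) (λ _ _ → refl)

quotientᶜ : Computable {1} λ xs → quotient (Vec.head xs)
quotientᶜ = recursion (λ k _ → quotient k) zeroᶜ
  (ifᶜ (equal-test (apply₁ remainderᶜ (argᶜ (# 0))) (constᶜ 9)) (sucᶜ (argᶜ (# 1))) (argᶜ (# 1))) (λ _ _ → refl)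

module _ {n : ℕ} {ℓ : Vec ℕ n → ℕ} (L : Computable ℓ) where
  own-markᶜ : ∀ {i} → Computable i → Computable λ xs → own-mark (ℓ xs) (i xs)
  own-markᶜ I = ifᶜ (equal-test I (constᶜ 0)) (constᶜ 7)
    (ifᶜ (equal-test I (constᶜ 1)) (constᶜ 2) (ifᶜ (equal-test I (sucᶜ (sucᶜ L))) (constᶜ 5) (constᶜ 4)))

  attachᶜ : ∀ {i j} → Computable i → Computable j → Computable λ xs → attach (ℓ xs) (i xs) (j xs)
  attachᶜ I J = ifᶜ (equal-test I J) (own-markᶜ I)
    (ifᶜ (equal-test I (sucᶜ J)) (ifᶜ (equal-test J zeroᶜ) zeroᶜ (constᶜ 6)) zeroᶜ)

  block-test : ∀ {i r j s} → Computable i → Computable r → Computable j → Computable s →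
               Test λ xs → blockAdj (ℓ xs) (i xs) (r xs) (j xs) (s xs)
  block-test I R J S =
    if-test (less-test R (constᶜ 9))
      (if-test (less-test S (constᶜ 9)) (if-test (equal-test I J) (not-test (equal-test R S)) false-test)
                                        (less-test R (attachᶜ I J)))
      (if-test (less-test S (constᶜ 9)) (less-test S (attachᶜ J I))
               (if-test (equal-test I zeroᶜ) (not-test (equal-test J zeroᶜ)) (equal-test J zeroᶜ)))

  link-test : ∀ {u v} → Computable u → Computable v → Test λ xs → linkAdj (ℓ xs) (u xs) (v xs)
  link-test U V = block-test (apply₁ quotientᶜ U) (apply₁ remainderᶜ U) (apply₁ quotientᶜ V) (apply₁ remainderᶜ V)

push : ℕ → ℕ → ℕ
push x c = suc (pair x c)

pushᶜ : ∀ {n} {f g : Vec ℕ n → ℕ} → Computable f → Computable g → Computable λ xs → push (f xs) (g xs)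
pushᶜ F G = sucᶜ (apply₁ exponential F *ᶜ sucᶜ (constᶜ 2 *ᶜ G))

codeList-++ : ∀ xs ys → codeList (xs ++ ys) ≡ foldr push (codeList ys) xs
codeList-++ [] ys = refl
codeList-++ (x ∷ xs) ys = cong (push x) (codeList-++ xs ys)

codeList-concatMap : ∀ {A : Set} (h : A → List ℕ) as → codeList (concatMap h as) ≡ foldr (λ a c → foldr push c (h a)) 0 as
codeList-concatMap h [] = refl
codeList-concatMap h (a ∷ as) =
  trans (codeList-++ (h a) (concatMap h as)) (cong (λ c → foldr push c (h a)) (codeList-concatMap h as))

-- A right fold over the last `k` indices below `s`: primitive recursion on `k` adds them from the
-- end of the list, hence the index `s ∸ suc k`.
iter : (ℕ → ℕ → ℕ) → ℕ → ℕ → ℕ → ℕ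
iter F s zero c = c
iter F s (suc k) c = F (s ∸ suc k) (iter F s k c)

foldr-tabulate : ∀ (F : ℕ → ℕ → ℕ) c s k (g : Fin k → Fin s) → k ≤ s → (∀ i → toℕ (g i) ≡ (s ∸ k) + toℕ i) →
                 foldr (λ i → F (toℕ i)) c (tabulateᴸ g) ≡ iter F s k c
foldr-tabulate F c s zero g h e = refl
foldr-tabulate F c s (suc k) g h e =
  cong₂ F (trans (e zero) (+-identityʳ _))
          (foldr-tabulate F c s k (λ i → g (suc i)) (≤-trans (n≤1+n k) h)
             (λ i → trans (e (suc i)) (trans (+-suc (s ∸ suc k) (toℕ i)) (cong (_+ toℕ i) (sym (+-∸-assoc 1 h))))))

foldr-allFin : ∀ (F : ℕ → ℕ → ℕ) c s → foldr (λ i → F (toℕ i)) c (allFin s) ≡ iter F s s c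
foldr-allFin F c s = foldr-tabulate F c s s (λ i → i) ≤-refl (λ i → cong (_+ toℕ i) (sym (n∸n≡0 s)))

foldr-cong′ : ∀ {A : Set} {F G : A → ℕ → ℕ} c as → (∀ a c → F a c ≡ G a c) → foldr F c as ≡ foldr G c as
foldr-cong′ c [] h = refl
foldr-cong′ {F = F} c (a ∷ as) h = trans (cong (F a) (foldr-cong′ c as h)) (h a _)

columns : (ℕ → ℕ → Bool) → ℕ → ℕ → ℕ → ℕ → ℕ
columns a s i k c = iter (λ j → push (bit (a i j))) s k c

rows : (ℕ → ℕ → Bool) → ℕ → ℕ → ℕ
rows a s k = iter (λ i → columns a s i s) s k 0

codeGraph-iter : ∀ G (a : ℕ → ℕ → Bool) → (∀ i j → adj G i j ≡ a (toℕ i) (toℕ j)) →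
                 codeGraph G ≡ push (size G) (rows a (size G) (size G))
codeGraph-iter G a h = cong (push s) (trans (codeList-concatMap row (allFin s))
  (trans (foldr-cong′ 0 (allFin s) row-code) (foldr-allFin (λ i → columns a s i s) 0 s)))
  where
  s = size G
  row : Fin s → List ℕ
  row i = map (λ j → bit (adj G i j)) (allFin s)
  row-code : ∀ i c → foldr push c (row i) ≡ columns a s (toℕ i) s c
  row-code i c = trans (foldr-map push (λ j → bit (adj G i j)) c (allFin s))
    (trans (foldr-cong′ c (allFin s) (λ j d → cong (λ b → push (bit b) d) (h i j)))
           (foldr-allFin (λ j → push (bit (a (toℕ i) j))) c s))

codeGraph-chain : ∀ ℓ → codeGraph (chain ℓ) ≡
                  push (size (chain ℓ)) (rows (linkAdj ℓ) (size (chain ℓ)) (size (chain ℓ)))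
codeGraph-chain ℓ = codeGraph-iter (chain ℓ) (linkAdj ℓ) (λ _ _ → refl)

chainSizeᶜ : ∀ {n} {ℓ : Vec ℕ n → ℕ} → Computable ℓ → Computable λ xs → size (chain (ℓ xs))
chainSizeᶜ L = sucᶜ (sucᶜ (sucᶜ L)) *ᶜ constᶜ 10

columnsᶜ : Computable {5} λ xs →
  columns (linkAdj (lookupV xs (# 4))) (lookupV xs (# 3)) (lookupV xs (# 2)) (Vec.head xs) (lookupV xs (# 1))
columnsᶜ = by-ext (λ { (_ ∷ _ ∷ _ ∷ _ ∷ _ ∷ []) → refl })
  (recursion (λ k xs → columns (linkAdj (lookupV xs (# 3))) (lookupV xs (# 2)) (lookupV xs (# 1)) k (lookupV xs (# 0))) (argᶜ (# 0))
    (pushᶜ (link-test (argᶜ (# 5)) (argᶜ (# 3)) (argᶜ (# 4) ∸ᶜ sucᶜ (argᶜ (# 0)))) (argᶜ (# 1)))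
    (λ { k (c ∷ i ∷ s ∷ ℓ ∷ []) → refl }))

rowsᶜ : Computable {3} λ xs → rows (linkAdj (lookupV xs (# 2))) (lookupV xs (# 1)) (Vec.head xs)
rowsᶜ = by-ext (λ { (_ ∷ _ ∷ _ ∷ []) → refl })
  (recursion (λ k xs → rows (linkAdj (lookupV xs (# 1))) (lookupV xs (# 0)) k) zeroᶜ
    (apply₅ columnsᶜ (argᶜ (# 2)) (argᶜ (# 1)) (argᶜ (# 2) ∸ᶜ sucᶜ (argᶜ (# 0))) (argᶜ (# 2)) (argᶜ (# 3)))
    (λ { k (s ∷ ℓ ∷ []) → refl }))

rows-linkᶜ : ∀ {n} {k s ℓ : Vec ℕ n → ℕ} → Computable k → Computable s → Computable ℓ →
             Computable λ xs → rows (linkAdj (ℓ xs)) (s xs) (k xs)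
rows-linkᶜ K S L = apply₃ rowsᶜ K S L

push-linkᶜ : ∀ {n} {s ℓ : Vec ℕ n → ℕ} → Computable s → Computable ℓ →
             Computable λ xs → push (s xs) (rows (linkAdj (ℓ xs)) (s xs) (s xs))
push-linkᶜ {s = s} {ℓ} S L = pushᶜ {f = s} {λ xs → rows (linkAdj (ℓ xs)) (s xs) (s xs)} S (rows-linkᶜ {k = s} {s} {ℓ} S S L)

codeGraph-chainᶜ : ∀ {n} {ℓ : Vec ℕ n → ℕ} → Computable ℓ → Computable λ xs → codeGraph (chain (ℓ xs))
codeGraph-chainᶜ {n} {ℓ} L =
  by-ext {f = λ xs → push (size (chain (ℓ xs))) (rows (linkAdj (ℓ xs)) (size (chain (ℓ xs))) (size (chain (ℓ xs))))}
         {λ xs → codeGraph (chain (ℓ xs))}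
         (λ xs → sym (codeGraph-chain (ℓ xs)))
         (push-linkᶜ {s = λ xs → size (chain (ℓ xs))} {ℓ} (chainSizeᶜ L) L)

abstract
  -- Kept opaque, because codes of this size must never be evaluated.
  chainCode : Σ (ℕ → ℕ) λ g → ∀ ℓ → codeGraph (chain ℓ) ≡ g ℓ
  chainCode = (λ ℓ → codeGraph (chain ℓ)) , λ ℓ → refl

chainCodeᶜ : ∀ {n} {ℓ : Vec ℕ n → ℕ} → Computable ℓ → Computable λ xs → proj₁ chainCode (ℓ xs)
chainCodeᶜ {ℓ = ℓ} L = by-ext {f = λ xs → codeGraph (chain (ℓ xs))} (λ xs → proj₂ chainCode (ℓ xs)) (codeGraph-chainᶜ {ℓ = ℓ} L)

-- The argument is used twice: as the number that the chain tests, and as the code of the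
-- constraints to which the chain is prepended.
extendCodeᶜ : Computable {1} λ xs → push (proj₁ chainCode (3 + lookupV xs zero)) (lookupV xs zero)
extendCodeᶜ = pushᶜ (chainCodeᶜ (sucᶜ (sucᶜ (sucᶜ (argᶜ zero))))) (argᶜ zero)

-- Diagonalisation

dropRight-num : ∀ n → dropRight n (num n) ≡ leaf
dropRight-num zero = refl
dropRight-num (suc n) = dropRight-num n

accepts⇒no-jep : ∀ (p : PR 1) n → Eval p (n ∷ []) 1 → ¬ JEP (Forb (chain (3 + n) ∷ constraints (prog p)))
accepts⇒no-jep p n e = no-jep (prog p) (node d (node leaf (node leaf (num n)))) (3 + n)
                              (cong (3 +_) (spine-num n)) (dropRight-num n) derivation
  where
  d = proj₁ (derive-goal p e)
  derivation = proj₂ (derive-goal p e)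

rejects⇒jep : ∀ (p : PR 1) n → Eval p (n ∷ []) 0 → JEP (Forb (chain (3 + n) ∷ constraints (prog p)))
rejects⇒jep p n e = has-jep (prog p) (3 + n) (ok-sound N n (prog p) (proj₂ (eval-run e) N ≤-refl))
                            (λ t k → verdict-spine N n t (ok-verdict N n t k))
  -- Fuel with which the run on `n` returns 0, so that the claim of the value 1 is seen to be false.
  where N = proj₁ (eval-run e)

codeFamily-∷ : ∀ G F {m} → codeGraph G ≡ m → codeFamily (G ∷ F) ≡ push m (codeFamily F)
codeFamily-∷ G F refl = refl

-- It builds the chain from its input alone, so the constraints can be formed from its code first
-- and their code supplied as the input afterwards. Self-reference thus arises without a recursion
-- theorem.
diagonal : PR 1 → PR 1
diagonal p = comp p (Computable.program extendCodeᶜ ∷ [])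

diagonal-eval : ∀ p F {v} → Eval p (codeFamily (chain (3 + codeFamily F) ∷ F) ∷ []) v →
                Eval (diagonal p) (codeFamily F ∷ []) v
diagonal-eval p F {v} e =
  e-comp (ea-∷ (Computable.correct extendCodeᶜ (codeFamily F ∷ [])) ea-[])
         (subst (λ c → Eval p (c ∷ []) v) (codeFamily-∷ (chain (3 + codeFamily F)) F (proj₂ chainCode (3 + codeFamily F))) e)

-- No case distinction on joint embedding is made: assuming it yields the answer 1 and hence a
-- contradiction, so it fails; then the answer is 0, which gives joint embedding after all.
refuted-at : ∀ p F {A : ℕ → Set} → (∀ {v} → Eval p (codeFamily F ∷ []) v → A v) →
             (A 1 → ¬ JEP (Forb F)) → (A 0 → JEP (Forb F)) → ¬ Decides p (λ F → JEP (Forb F))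
refuted-at p F transfer accepts rejects decides = fails (rejects (transfer (proj₂ (decides F) fails)))
  where
  fails : ¬ JEP (Forb F)
  fails jep = accepts (transfer (proj₁ (decides F) jep)) jep

theorem4p17 : ¬ (Σ (PR 1) λ p → Decides p (λ F → JEP (Forb F)))
theorem4p17 (p , decides) =
  refuted-at p (chain (3 + codeFamily (constraints (prog (diagonal p)))) ∷ constraints (prog (diagonal p)))
    {λ v → Eval (diagonal p) (codeFamily (constraints (prog (diagonal p))) ∷ []) v}
    (λ {v} → diagonal-eval p (constraints (prog (diagonal p))) {v})
    (accepts⇒no-jep (diagonal p) (codeFamily (constraints (prog (diagonal p)))))
    (rejects⇒jep (diagonal p) (codeFamily (constraints (prog (diagonal p)))))
    decides
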